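{- There exists an infinite sequence $(\Gamma_n)_{n=1}^\infty$ of CNF formulas such that $\Gamma_n$ admits $\mathsf{RAT}^-$ proofs of size $n^{O(1)}$ but requires $\mathsf{GER}^-$ proofs of size $2^{\Omega(n)}$. Conversely, there exists an infinite sequence $(\Delta_n)_{n=1}^\infty$ of CNF formulas such that $\Delta_n$ admits $\mathsf{GER}^-$ proofs of size $n^{O(1)}$ but requires $\mathsf{RAT}^-$ proofs of size $2^{\Omega(n)}$.
   Context: A literal is a propositional variable or its negation; $\overline{p}$ is the complement of $p$. A set of literals is tautological if it contains some $x$ and $\overline{x}$. A clause is a finite nontautological set of literals (read as a disjunction); $\bot$ is the empty clause. A CNF is a finite set of clauses; $\mathrm{var}(\Gamma)$ is the set of variables occurring in $\Gamma$. "Proof" of $\Gamma$ means refutation. Resolution. If $A\cup\{x\}$ and $B\cup\{\overline{x}\}$ are clauses with $x$ a variable not occurring in $A$ or $B$, and $A\cup B$ is a clause, then $A\cup B$ is their resolvent on $x$. A weakening of a clause $A$ is any clause $A\cup B$. A resolution proof of $\Gamma$ is a sequence $\Pi=(\Gamma_1,\dots,\Gamma_N)$ of CNFs with $\Gamma_1=\Gamma$, $\bot\in\Gamma_N$, and each $\Gamma_{i+1}=\Gamma_i\cup\{C\}$, where $C$ is a resolvent of two clauses of $\Gamma_i$ or a weakening of a clause of $\Gamma_i$. Its size is $|\Pi|=N$. Unit propagation. A unit propagation proof is a resolution proof in which, in each use of the resolution rule, one of the two premises is a clause with a single literal. For a set $L$ of literals, $\Gamma\vdash_1 L$ means that $\Gamma\cup\{\{\overline{p}\}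 : p\in L\}$ has a unit propagation proof. RAT. A clause $C=\{p\}\cup C'$ (with the variable of $p$ not in $C'$) is a resolution asymmetric tautology (RAT) for $p$ with respect to $\Gamma$ if for every clause $D\in\Gamma$ of the form $\{\overline{p}\}\cup D'$ (with the variable of $p$ not in $D'$) we have $\Gamma\vdash_1 C'\cup D'$. $C$ is a RAT with respect to $\Gamma$ if it is one for some $p\in C$. A $\mathsf{RAT}$ proof of $\Gamma$ is defined like a resolution proof, except that each added clause $C$ may also be any RAT with respect to the current CNF $\Gamma_i$; its size is $N$. A $\mathsf{RAT}^-$ proof of $\Gamma$ is a $\mathsf{RAT}$ proof in which only variables of $\mathrm{var}(\Gamma)$ occur. GER. A clause $C=\{p\}\cup C'$ (variable of $p$ not in $C'$) is blocked for $p$ with respect to $\Gamma$ if for every $D\in\Gamma$ of the form $\{\overline{p}\}\cup D'$ the set $C'\cup D'$ is tautological; $C$ is blocked with respect to $\Gamma$ if it is so for some $p\in C$. The kernel $\ker(\Gamma)$ is the CNF obtained from $\Gamma$ by repeatedly removing a clause that is blocked with respect to the current set, until no clause of the current set is blocked with respect to it (the result does not depend on the order of removal). A CNF $\Lambda$ is a blocked extension for $\Gamma$ if $\ker(\Gamma\cup\Lambda)=\ker(\Gamma)$. A $\mathsf{GER}$ proof of $\Gamma$ is a pair $(\Lambda,\Pi)$ where $\Lambda$ is a blocked extension for $\Gamma$ and $\Pi$ is a resolution proof of $\Gamma\cup\Lambda$; its size is $|\Lambda|+|\Pi|$, where $|\Lambda|$ is the number of clauses. It is a $\mathsf{GER}^-$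 proof if $\mathrm{var}(\Lambda)\subseteq\mathrm{var}(\Gamma)$. -}

module Defs where

open import Data.List.Base
  using (List; []; _∷_; [_]; _++_; map; concatMap; filter; deduplicate; length)
open import Data.List.Relation.Unary.Any using (here; there)
open import Data.Nat.Base using (ℕ; suc; _+_; _^_; _≤_; NonZero)
import Data.List.Membership.Propositional as Membershipₚ
import Data.List.Membership.Setoid as Membershipₛ
import Data.List.Relation.Binary.Subset.DecSetoid as DecSubset
import Data.List.Relation.Binary.Subset.Propositional as Subsetₚ
import Data.Nat.Properties as ℕ
open import Data.Product.Base using (Σ; ∃₂; ∃-syntax; _×_; _,_)
open import Data.Sum.Base using (_⊎_)
open import Level using (0ℓ)
open import Relation.Binary.Bundles using (DecSetoid)
import Relation.Binary.Construct.On as On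
open import Relation.Binary.Construct.Closure.ReflexiveTransitive using (Star)
open import Relation.Binary.Definitions using (DecidableEquality)
open import Relation.Binary.PropositionalEquality.Core using (_≡_; refl; cong)
import Relation.Binary.PropositionalEquality.Properties as ≡
open import Relation.Nullary.Decidable using (no; map′; _×-dec_; ¬?)
open import Relation.Nullary.Negation using (¬_)

-- Finite sets are represented by lists, compared extensionally.
module FiniteSets (S : DecSetoid 0ℓ 0ℓ) where

  open DecSubset S using (_⊆_; _⊆?_)

  infix 4 _≐_

  _≐_ : List (DecSetoid.Carrier S) → List (DecSetoid.Carrier S) → Set
  A ≐ B = A ⊆ B × B ⊆ A

  decSetoid : DecSetoid 0ℓ 0ℓ
  decSetoid = record
    { _≈_ = _≐_
    ; isDecEquivalence = record
      { isEquivalence = record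
        { refl  = (λ x∈ → x∈) , (λ x∈ → x∈)
        ; sym   = λ (f , g) → g , f
        ; trans = λ (f , g) (h , k) → (λ x∈ → h (f x∈)) , (λ x∈ → g (k x∈))
        }
      ; _≟_ = λ A B → (A ⊆? B) ×-dec (B ⊆? A)
      }
    }

------------------------------------------------------------------------
-- Literals, clauses and CNFs

Var : Set
Var = ℕ

data Literal : Set where
  pos neg : Var → Literal

compl : Literal → Literal
compl (pos x) = neg x
compl (neg x) = pos x

var : Literal → Var
var (pos x) = x
var (neg x) = x

_≟ᴸ_ : DecidableEquality Literal
pos x ≟ᴸ pos y = map′ (cong pos) (λ { refl → refl }) (x ℕ.≟ y)
pos x ≟ᴸ neg y = no λ ()
neg x ≟ᴸ pos y = no λ ()
neg x ≟ᴸ neg y = map′ (cong neg) (λ { refl → refl }) (x ℕ.≟ y)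

module LitSet = FiniteSets (≡.decSetoid _≟ᴸ_)

open LitSet public using (_≐_)

Tautological : List Literal → Set
Tautological L = ∃[ x ] pos x ∈ L × neg x ∈ L
  where open Membershipₚ using (_∈_)

record Clause : Set where
  constructor clause
  field
    lits            : List Literal
    nontautological : ¬ Tautological lits

open Clause public

⊥ᶜ : Clause
⊥ᶜ = clause [] λ { (_ , () , _) }

unit : Literal → Clause
unit p = clause [ p ] λ { (_ , here refl , here ()) ; (_ , _ , there ()) }

clauseDecSetoid : DecSetoid 0ℓ 0ℓ
clauseDecSetoid = On.decSetoid LitSet.decSetoid lits

open DecSetoid clauseDecSetoid public
  using () renaming (_≈_ to _≈ᶜ_; _≟_ to _≟ᶜ_)

CNF : Set
CNF = List Clause

open Membershipₛ (DecSetoid.setoid clauseDecSetoid) public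
  using () renaming (_∈_ to _∈ᶜ_)

module ClauseSet = FiniteSets clauseDecSetoid

open ClauseSet public using () renaming (_≐_ to _≐ᶜ_)

vars : CNF → List Var
vars = concatMap (λ C → map var (lits C))

-- Repeated entries (up to equality of clauses as sets) count once.
numClauses : CNF → ℕ
numClauses Γ = length (deduplicate _≟ᶜ_ Γ)

-- C = {p} ∪ C′, where the variable of p does not occur in C′.
record _≈[_]∪_ (C : Clause) (p : Literal) (C′ : List Literal) : Set where
  field
    fresh : ¬ (var p Membershipₚ.∈ map var C′)
    union : lits C ≐ p ∷ C′

------------------------------------------------------------------------
-- Proofs as sequences of CNFs

-- A rule says which clauses may be added to the current CNF.
Rule : Set₁
Rule = CNF → Clause → Set

-- Refutation R Γ is the type of sequences Γ = Γ₁, …, Γ_N with ⊥ ∈ Γ_N, each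
-- obtained from the previous one by adding a clause that R permits.
data Refutation (R : Rule) (Γ : CNF) : Set where
  stop : ⊥ᶜ ∈ᶜ Γ → Refutation R Γ
  add  : (C : Clause) → R Γ C → Refutation R (C ∷ Γ) → Refutation R Γ

-- The number N of CNFs in the sequence.
size : ∀ {R Γ} → Refutation R Γ → ℕ
size (stop _)    = 1
size (add _ _ Π) = suc (size Π)

-- The last CNF Γ_N, which contains every clause of the proof.
final : ∀ {R Γ} → Refutation R Γ → CNF
final {Γ = Γ} (stop _) = Γ
final (add _ _ Π)      = final Π

------------------------------------------------------------------------
-- Resolution and unit propagation

-- E is the resolvent on x of C = A ∪ {x} and D = B ∪ {x̄}.
record Resolvent (C D E : Clause) : Set where
  field
    x     : Var
    A B   : List Literal
    left  : C ≈[ pos x ]∪ A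
    right : D ≈[ neg x ]∪ B
    union : lits E ≐ A ++ B

Weakening : Clause → Clause → Set
Weakening C E = lits C ⊆ lits E
  where open Subsetₚ using (_⊆_)

data ResolutionRule (Γ : CNF) (E : Clause) : Set where
  resolve : ∀ {C D} → C ∈ᶜ Γ → D ∈ᶜ Γ → Resolvent C D E → ResolutionRule Γ E
  weaken  : ∀ {C} → C ∈ᶜ Γ → Weakening C E → ResolutionRule Γ E

IsUnit : Clause → Set
IsUnit C = ∃[ p ] C ≈ᶜ unit p

data UnitPropagationRule (Γ : CNF) (E : Clause) : Set where
  resolve : ∀ {C D} → C ∈ᶜ Γ → D ∈ᶜ Γ → IsUnit C ⊎ IsUnit D →
            Resolvent C D E → UnitPropagationRule Γ E
  weaken  : ∀ {C} → C ∈ᶜ Γ → Weakening C E → UnitPropagationRule Γ E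

infix 4 _⊢₁_

_⊢₁_ : CNF → List Literal → Set
Γ ⊢₁ L = Refutation UnitPropagationRule (Γ ++ map (λ p → unit (compl p)) L)

------------------------------------------------------------------------
-- RAT

IsRATFor : CNF → Clause → Literal → Set
IsRATFor Γ C p = ∃[ C′ ] C ≈[ p ]∪ C′ ×
  (∀ D D′ → D ∈ᶜ Γ → D ≈[ compl p ]∪ D′ → Γ ⊢₁ C′ ++ D′)

IsRAT : CNF → Clause → Set
IsRAT Γ C = ∃[ p ] IsRATFor Γ C p

data RATRule (Γ : CNF) (C : Clause) : Set where
  resolution : ResolutionRule Γ C → RATRule Γ C
  rat        : IsRAT Γ C → RATRule Γ C

------------------------------------------------------------------------
-- Blocked clauses, kernels and GER

IsBlockedFor : CNF → Clause → Literal → Set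
IsBlockedFor Γ C p = ∃[ C′ ] C ≈[ p ]∪ C′ ×
  (∀ D D′ → D ∈ᶜ Γ → D ≈[ compl p ]∪ D′ → Tautological (C′ ++ D′))

IsBlocked : CNF → Clause → Set
IsBlocked Γ C = ∃[ p ] IsBlockedFor Γ C p

-- Removes every occurrence of C, so that it is removed from the set.
_∖_ : CNF → Clause → CNF
Γ ∖ C = filter (λ D → ¬? (C ≟ᶜ D)) Γ

data _⟶_ (Γ : CNF) : CNF → Set where
  remove : ∀ {C} → C ∈ᶜ Γ → IsBlocked Γ C → Γ ⟶ (Γ ∖ C)

-- K is the outcome of a maximal sequence of removals from Γ.  As the outcome
-- is independent of the order of removal, this is the graph of Γ ↦ ker Γ.
IsKernel : CNF → CNF → Set
IsKernel Γ K = Star _⟶_ Γ K × (∀ C → C ∈ᶜ K → ¬ IsBlocked K C)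

-- ker (Γ ∪ Λ) = ker Γ.
IsBlockedExtension : CNF → CNF → Set
IsBlockedExtension Γ Λ =
  ∃₂ λ K K′ → IsKernel (Γ ++ Λ) K × IsKernel Γ K′ × K ≐ᶜ K′

record GERProof (Γ : CNF) : Set where
  field
    Λ                : CNF
    blockedExtension : IsBlockedExtension Γ Λ
    Π                : Refutation ResolutionRule (Γ ++ Λ)

  sizeᴳ : ℕ
  sizeᴳ = numClauses Λ + size Π

------------------------------------------------------------------------
-- The two proof systems without new variables

record ProofSystem : Set₁ where
  field
    Proof : CNF → Set
    ∣_∣   : ∀ {Γ} → Proof Γ → ℕ

RAT⁻ : ProofSystem
RAT⁻ = record
  { Proof = λ Γ → Σ (Refutation RATRule Γ) λ Π → vars (final Π) ⊆ vars Γ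
  ; ∣_∣   = λ (Π , _) → size Π
  }
  where open Subsetₚ using (_⊆_)

GER⁻ : ProofSystem
GER⁻ = record
  { Proof = λ Γ → Σ (GERProof Γ) λ π → vars (GERProof.Λ π) ⊆ vars Γ
  ; ∣_∣   = λ (π , _) → GERProof.sizeᴳ π
  }
  where open Subsetₚ using (_⊆_)

------------------------------------------------------------------------
-- Asymptotic size bounds; sequences are indexed from 1, and the value at 0
-- is ignored.

-- f(n) = n^{O(1)}.
IsPolynomial : (ℕ → ℕ) → Set
IsPolynomial f = ∃₂ λ c n₀ → ∀ n → n₀ ≤ n → f n ≤ n ^ c

-- f(n) = 2^{Ω(n)}: for some k ≥ 1, eventually f(n) ≥ 2^{n/k}, with the k-th
-- root cleared.
IsExponential : (ℕ → ℕ) → Set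
IsExponential f =
  ∃₂ λ k n₀ → NonZero k × (∀ n → n₀ ≤ n → 2 ^ n ≤ f n ^ k)

module _ (P : ProofSystem) (Γ : ℕ → CNF) where

  open ProofSystem P

  AdmitsPolynomial : Set
  AdmitsPolynomial = ∃[ f ] IsPolynomial f ×
    (∀ n → 1 ≤ n → Σ (Proof (Γ n)) λ π → ∣ π ∣ ≤ f n)

  RequiresExponential : Set
  RequiresExponential = ∃[ f ] IsExponential f ×
    (∀ n → 1 ≤ n → (π : Proof (Γ n)) → f n ≤ ∣ π ∣)

{-# OPTIONS --safe #-}
module Submission where

-- The starting point is a linear system over GF(2) on a g × g matrix, asking
-- that only the first of its rows, and none of its columns, has an odd sum.
-- Every line carries the sums of its initial segments as further unknowns, so
-- that all equations are short, and every unknown is the exclusive or of two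
-- variables.  Naming the sums of the upper left blocks of the matrix gives
-- short refutations (the two ways of summing a block agree, which is a local
-- inference).  Without them resolution is exponentially slow: some restriction
-- of one variable per unknown satisfies all wide clauses of a small proof, and
-- a narrow clause involves so few lines that these can be balanced all at once,
-- through entries shared with lines that the clause does not involve.
--
-- Weakening each clause by every literal leaves resolution where it was, but
-- then no clause over these variables is blocked, as the formula is
-- unsatisfiable; so GER⁻ reduces to resolution, while RAT⁻ can still name the
-- blocks.  Conversely, if every variable has a twin that is equivalent to it,
-- then a RAT is obtained by unit propagation and one resolution with the twin,
-- so RAT⁻ reduces to resolution; but the clauses about twins are blocked, hence
-- invisible to GER⁻.

-- The exclusive or makes restrictions harmless to the linear system: when one of the two variables
-- of a cell is fixed, the other can still give the cell either value. A clause that mentions a cell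
-- is satisfied by at least one of the four ways of fixing a variable of that cell; so a clause on
-- `3 * n` cells escapes at most a fraction (3/4)^(3n) of all restrictions, which is at most 1/2^n.
-- Narrower clauses involve at most `3 * n` lines each, and one inference concerns up to three such
-- groups of lines, whence `g = 9 * n`. The invariant also has to survive unit propagation of any
-- length, whose clauses the restriction does not control. It does because resolving with a unit
-- adds no lines to those on which the other premise depends. The areas must occur in the formulas,
-- as new variables are forbidden, yet without being constrained: in the first family they occur
-- only in weakenings of clauses, in the second only in clauses that make them equivalent to their
-- twins.

open import Defs
open import Data.Bool.Base using (Bool; true; false; not; _xor_; if_then_else_)
import Data.Bool.Properties as Bool
open import Data.Empty using (⊥-elim)
open import Data.List.Base hiding (find; sum)
import Data.List.Membership.DecPropositional as DecMembership
open import Data.List.Membership.Propositional using (_∈_; _∉_; find; lose)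
open import Data.List.Membership.Propositional.Properties
open import Data.List.Properties
  using (length-++; length-map; length-filter; length-deduplicate; length-upTo; filter-notAll; ++-identityʳ; ++-assoc)
open import Data.List.Relation.Binary.Subset.Propositional using (_⊆_)
open import Data.List.Relation.Unary.All as All using (All; []; _∷_)
open import Data.List.Relation.Unary.Any as Any using (Any; here; there)
open import Data.List.Relation.Unary.Unique.Propositional using (Unique; []; _∷_)
import Data.List.Relation.Unary.Unique.DecPropositional.Properties as DecUnique
open import Data.Nat.Base hiding (parity)
open import Data.Nat.ListAction using (sum)
open import Data.Nat.Properties as ℕ using (_≟_)
open import Data.Nat.Tactic.RingSolver using (solve-∀)
open import Data.Product.Base using (Σ-syntax; ∃-syntax; ∃₂; _×_; _,_; proj₁; proj₂)
open import Data.Sum.Base using (_⊎_; inj₁; inj₂; [_,_]′)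
open import Function.Base using (_∘_; id; case_of_)
open import Relation.Binary.Construct.Closure.ReflexiveTransitive using (Star; ε; _◅_)
open import Relation.Binary.Definitions using (DecidableEquality)
open import Relation.Binary.PropositionalEquality
open import Relation.Nullary
open import Relation.Nullary.Decidable using (dec-true; dec-false)

-- Literals, clauses and assignments

compl-involutive : ∀ l → compl (compl l) ≡ l
compl-involutive (pos x) = refl
compl-involutive (neg x) = refl

var-compl : ∀ l → var (compl l) ≡ var l
var-compl (pos x) = refl
var-compl (neg x) = refl

same-var : ∀ l m → var l ≡ var m → l ≡ m ⊎ l ≡ compl m
same-var (pos x) (pos y) refl = inj₁ refl
same-var (pos x) (neg y) refl = inj₂ refl
same-var (neg x) (pos y) refl = inj₂ refl
same-var (neg x) (neg y) refl = inj₁ refl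

_∈ᴸ?_ : ∀ l L → Dec (l ∈ L)
_∈ᴸ?_ = DecMembership._∈?_ _≟ᴸ_

conflict⇒tautological : ∀ {L} l → l ∈ L → compl l ∈ L → Tautological L
conflict⇒tautological (pos x) l∈ l̄∈ = x , l∈ , l̄∈
conflict⇒tautological (neg x) l∈ l̄∈ = x , l̄∈ , l∈

conflict-free : ∀ C {l} → l ∈ lits C → compl l ∉ lits C
conflict-free C l∈ l̄∈ = nontautological C (conflict⇒tautological _ l∈ l̄∈)

tautological-⊆ : ∀ {L M} → L ⊆ M → Tautological L → Tautological M
tautological-⊆ L⊆M (x , p , n) = x , L⊆M p , L⊆M n

tautological? : ∀ L → Dec (Tautological L)
tautological? L = map′
  (λ any → let l , l∈ , l̄∈ = find any in conflict⇒tautological l l∈ l̄∈)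
  (λ (x , p , n) → lose p n)
  (Any.any? (λ l → compl l ∈ᴸ? L) L)

-- C ∈ᶜ Γ unfolds to lits C ∈ˡ Γ, in which lits C (but not C) can be inferred.
infix 4 _∈ˡ_

_∈ˡ_ : List Literal → CNF → Set
L ∈ˡ Γ = Any (λ D → L ≐ lits D) Γ

∈⇒∈ᶜ : ∀ {C Γ} → C ∈ Γ → lits C ∈ˡ Γ
∈⇒∈ᶜ = Any.map λ { refl → id , id }

find-∈ᶜ : ∀ {L Γ} → L ∈ˡ Γ → ∃[ D ] D ∈ Γ × L ⊆ lits D × lits D ⊆ L
find-∈ᶜ L∈ = let D , D∈ , L⊆D , D⊆L = find L∈ in D , D∈ , L⊆D , D⊆L

∈ᶜ-resp : ∀ {L M Γ} → L ⊆ M → M ⊆ L → M ∈ˡ Γ → L ∈ˡ Γ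
∈ᶜ-resp f g = Any.map λ (h , k) → (λ x∈ → h (f x∈)) , (λ x∈ → g (k x∈))

clausesOf : List (List Literal) → CNF
clausesOf []       = []
clausesOf (L ∷ Ls) with tautological? L
... | yes _     = clausesOf Ls
... | no nontaut = clause L nontaut ∷ clausesOf Ls

clausesOf⁻ : ∀ {C} Ls → C ∈ clausesOf Ls → lits C ∈ Ls
clausesOf⁻ (L ∷ Ls) C∈ with tautological? L
clausesOf⁻ (L ∷ Ls) C∈          | yes _ = there (clausesOf⁻ Ls C∈)
clausesOf⁻ (L ∷ Ls) (here refl) | no _  = here refl
clausesOf⁻ (L ∷ Ls) (there C∈)  | no _  = there (clausesOf⁻ Ls C∈)

clausesOf⁺ : ∀ {L} Ls → L ∈ Ls → ¬ Tautological L → ∃[ C ] C ∈ clausesOf Ls × lits C ≡ L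
clausesOf⁺ (L ∷ Ls) L∈ nontaut with tautological? L
clausesOf⁺ (L ∷ Ls) (here refl) nontaut | yes taut = ⊥-elim (nontaut taut)
clausesOf⁺ (L ∷ Ls) (there L∈)  nontaut | yes taut = clausesOf⁺ Ls L∈ nontaut
clausesOf⁺ (L ∷ Ls) (here refl) nontaut | no _     = _ , here refl , refl
clausesOf⁺ (L ∷ Ls) (there L∈)  nontaut | no _     =
  let C , C∈ , eq = clausesOf⁺ Ls L∈ nontaut in C , there C∈ , eq

length-clausesOf : ∀ Ls → length (clausesOf Ls) ≤ length Ls
length-clausesOf []       = z≤n
length-clausesOf (L ∷ Ls) with tautological? L
... | yes _ = ℕ.m≤n⇒m≤1+n (length-clausesOf Ls)
... | no _  = s≤s (length-clausesOf Ls)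

without : Literal → List Literal → List Literal
without p = filter (λ l → ¬? (l ≟ᴸ p))

∈-without⁺ : ∀ {p l L} → l ∈ L → l ≢ p → l ∈ without p L
∈-without⁺ {p} = ∈-filter⁺ (λ l → ¬? (l ≟ᴸ p))

∈-without⁻ : ∀ {p l L} → l ∈ without p L → l ∈ L × l ≢ p
∈-without⁻ {p} = ∈-filter⁻ (λ l → ¬? (l ≟ᴸ p))

≈-without : ∀ C {p} → p ∈ lits C → C ≈[ p ]∪ without p (lits C)
≈-without C {p} p∈ = record
  { fresh = λ v∈ → fresh′ (∈-map⁻ var v∈)
  ; union = split , λ { (here refl) → p∈ ; (there l∈) → proj₁ (∈-without⁻ l∈) }
  }
  where
  fresh′ : ¬ (∃[ l ] l ∈ without p (lits C) × var p ≡ var l)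
  fresh′ (l , l∈ , eq) with ∈-without⁻ l∈ | same-var l p (sym eq)
  ... | l∈C , l≢p | inj₁ refl = l≢p refl
  ... | l∈C , _   | inj₂ refl = conflict-free C p∈ l∈C
  split : ∀ {l} → l ∈ lits C → l ∈ p ∷ without p (lits C)
  split {l} l∈ with l ≟ᴸ p
  ... | yes refl = here refl
  ... | no l≢p   = there (∈-without⁺ l∈ l≢p)

module _ {C : Clause} {p : Literal} {C′ : List Literal} (split : C ≈[ p ]∪ C′) where
  open _≈[_]∪_ split

  head∈ : p ∈ lits C
  head∈ = proj₂ union (here refl)

  tail⊆ : C′ ⊆ lits C
  tail⊆ l∈ = proj₂ union (there l∈)

  tail-≢ : ∀ {l} → l ∈ C′ → var l ≢ var p
  tail-≢ l∈ eq = fresh (subst (_∈ map var C′) eq (∈-map⁺ var l∈))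

  head∨tail : ∀ {l} → l ∈ lits C → l ≡ p ⊎ l ∈ C′
  head∨tail l∈ with proj₁ union l∈
  ... | here eq = inj₁ eq
  ... | there l∈C′ = inj₂ l∈C′

Assignment : Set
Assignment = Var → Bool

eval : Assignment → Literal → Bool
eval α (pos x) = α x
eval α (neg x) = not (α x)

eval-compl : ∀ α l → eval α (compl l) ≡ not (eval α l)
eval-compl α (pos x) = refl
eval-compl α (neg x) = sym (Bool.not-involutive (α x))

_⊨_ : Assignment → List Literal → Set
α ⊨ L = Any (λ l → eval α l ≡ true) L

_⊨?_ : ∀ α L → Dec (α ⊨ L)
α ⊨? L = Any.any? (λ l → eval α l Bool.≟ true) L

⊨-⊆ : ∀ {α L M} → L ⊆ M → α ⊨ L → α ⊨ M
⊨-⊆ L⊆M sat = let l , l∈ , t = find sat in lose (L⊆M l∈) t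

⊭⇒false : ∀ {α L l} → ¬ (α ⊨ L) → l ∈ L → eval α l ≡ false
⊭⇒false {α} {L} {l} ⊭L l∈ with eval α l in eq
... | true  = ⊥-elim (⊭L (lose l∈ eq))
... | false = refl

⊨-compl : ∀ {α l} → eval α l ≡ true → eval α (compl l) ≢ true
⊨-compl {α} {l} t t′ with trans (sym t′) (trans (eval-compl α l) (cong not t))
... | ()

tautological⇒⊨ : ∀ {α L} → Tautological L → α ⊨ L
tautological⇒⊨ {α} (x , p , n) with α x in eq
... | true  = lose p eq
... | false = lose n (cong not eq)

_⊨ᶜ_ : Assignment → CNF → Set
α ⊨ᶜ Γ = ∀ {C} → C ∈ Γ → α ⊨ lits C

⊨ᶜ-clausesOf : ∀ {α} Ls → α ⊨ᶜ clausesOf Ls → ∀ {L} → L ∈ Ls → α ⊨ L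
⊨ᶜ-clausesOf Ls sat {L} L∈ with tautological? L
... | yes taut    = tautological⇒⊨ taut
... | no nontaut with clausesOf⁺ Ls L∈ nontaut
...   | C , C∈ , refl = sat C∈

clausesOf-⊨ᶜ : ∀ {α} Ls → (∀ {L} → L ∈ Ls → α ⊨ L) → α ⊨ᶜ clausesOf Ls
clausesOf-⊨ᶜ Ls sat C∈ = sat (clausesOf⁻ Ls C∈)

∈-vars⁺ : ∀ {Γ C l} → C ∈ Γ → l ∈ lits C → var l ∈ vars Γ
∈-vars⁺ C∈ l∈ = ∈-concatMap⁺ (λ C → map var (lits C)) (lose C∈ (∈-map⁺ var l∈))

∈-vars⁻ : ∀ Γ {x} → x ∈ vars Γ → ∃₂ λ C l → C ∈ Γ × l ∈ lits C × x ≡ var l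
∈-vars⁻ Γ x∈ =
  let C , C∈ , x∈C = find (∈-concatMap⁻ (λ C → map var (lits C)) {xs = Γ} x∈)
      l , l∈ , eq  = ∈-map⁻ var x∈C
  in C , l , C∈ , l∈ , eq

-- Parity constraints

-- For distinct variables, one clause of full width for each assignment to `xs` of the wrong parity.
-- The contradictory constraint on no variables gives the empty clause, which is how refutations
-- end.
parityLits : List Var → Bool → List (List Literal)
parityLits []       true  = [] ∷ []
parityLits []       false = []
parityLits (x ∷ xs) c     =
  map (pos x ∷_) (parityLits xs c) ++ map (neg x ∷_) (parityLits xs (not c))

parity : Assignment → List Var → Bool
parity α []       = false
parity α (x ∷ xs) = α x xor parity α xs

∈-parityLits⁻ : ∀ x xs c {L} → L ∈ parityLits (x ∷ xs) c →
  ∃₂ λ l M → L ≡ l ∷ M × var l ≡ x × (l ≡ pos x × M ∈ parityLits xs c ⊎ l ≡ neg x × M ∈ parityLits xs (not c))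
∈-parityLits⁻ x xs c L∈ with ∈-++⁻ (map (pos x ∷_) (parityLits xs c)) L∈
... | inj₁ L∈₁ = let M , M∈ , eq = ∈-map⁻ (pos x ∷_) L∈₁ in _ , M , eq , refl , inj₁ (refl , M∈)
... | inj₂ L∈₂ = let M , M∈ , eq = ∈-map⁻ (neg x ∷_) L∈₂ in _ , M , eq , refl , inj₂ (refl , M∈)

parityLits-vars : ∀ xs c {L} → L ∈ parityLits xs c → ∀ {l} → l ∈ L → var l ∈ xs
parityLits-vars []       true  (here refl) ()
parityLits-vars (x ∷ xs) c     L∈ l∈ with ∈-parityLits⁻ x xs c L∈
parityLits-vars (x ∷ xs) c L∈ (here refl) | _ , M , refl , eq , _ = here eq
parityLits-vars (x ∷ xs) c L∈ (there l∈)  | _ , M , refl , eq , inj₁ (_ , M∈) =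
  there (parityLits-vars xs c M∈ l∈)
parityLits-vars (x ∷ xs) c L∈ (there l∈)  | _ , M , refl , eq , inj₂ (_ , M∈) =
  there (parityLits-vars xs (not c) M∈ l∈)

length-parityLits : ∀ xs c → length (parityLits xs c) ≤ 2 ^ length xs
length-parityLits []       true  = s≤s z≤n
length-parityLits []       false = z≤n
length-parityLits (x ∷ xs) c = begin
  length (map (pos x ∷_) P ++ map (neg x ∷_) N)          ≡⟨ length-++ (map (pos x ∷_) P) ⟩
  length (map (pos x ∷_) P) + length (map (neg x ∷_) N)  ≡⟨ cong₂ _+_ (length-map _ P) (length-map _ N) ⟩
  length P + length N                                    ≤⟨ ℕ.+-mono-≤ (length-parityLits xs c) (length-parityLits xs (not c)) ⟩
  2 ^ length xs + 2 ^ length xs                          ≡⟨ cong (2 ^ length xs +_) (ℕ.+-identityʳ _) ⟨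
  2 ^ length (x ∷ xs)                                    ∎
  where
  open ℕ.≤-Reasoning
  P = parityLits xs c
  N = parityLits xs (not c)

parity⇒⊨ : ∀ {α} xs c → parity α xs ≡ c → ∀ {L} → L ∈ parityLits xs c → α ⊨ L
parity⇒⊨ []       true  () L∈
parity⇒⊨ {α} (x ∷ xs) c eq L∈ with ∈-parityLits⁻ x xs c L∈ | α x in αx
... | _ , M , refl , _ , inj₁ (refl , M∈) | true  = here αx
... | _ , M , refl , _ , inj₁ (refl , M∈) | false = there (parity⇒⊨ xs c eq M∈)
... | _ , M , refl , _ , inj₂ (refl , M∈) | false = here (cong not αx)
... | _ , M , refl , _ , inj₂ (refl , M∈) | true  =
  there (parity⇒⊨ xs (not c) (trans (sym (Bool.not-involutive _)) (cong not eq)) M∈)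

falsified-parity : ∀ {α} xs c → parity α xs ≢ c → ∃[ L ] L ∈ parityLits xs c × ¬ (α ⊨ L)
falsified-parity []       true  ne = [] , here refl , λ ()
falsified-parity []       false ne = ⊥-elim (ne refl)
falsified-parity {α} (x ∷ xs) c ne with α x in αx
... | false = let L , L∈ , ⊭L = falsified-parity xs c ne in
  pos x ∷ L , ∈-++⁺ˡ (∈-map⁺ (pos x ∷_) L∈) ,
  λ { (here t) → case trans (sym t) αx of λ () ; (there t) → ⊭L t }
... | true  = let L , L∈ , ⊭L = falsified-parity xs (not c) (λ eq → ne (trans (cong not eq) (Bool.not-involutive c))) in
  neg x ∷ L , ∈-++⁺ʳ _ (∈-map⁺ (neg x ∷_) L∈) ,
  λ { (here t) → case trans (sym t) (cong not αx) of λ () ; (there t) → ⊭L t }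

-- The signs of a clause determine the right-hand side it belongs to, so clauses of opposite
-- constraints have different signs somewhere and clash there. This makes defining clauses blocked.
parityLits-conflict : ∀ xs c {L M} → L ∈ parityLits xs c → M ∈ parityLits xs (not c) →
  ∃[ l ] l ∈ L × compl l ∈ M
parityLits-conflict [] true L∈ ()
parityLits-conflict [] false () M∈
parityLits-conflict (x ∷ xs) c L∈ M∈ with ∈-parityLits⁻ x xs c L∈ | ∈-parityLits⁻ x xs (not c) M∈
... | _ , _ , refl , _ , inj₁ (refl , L∈′) | _ , _ , refl , _ , inj₁ (refl , M∈′) =
  let l , l∈ , l̄∈ = parityLits-conflict xs c L∈′ M∈′ in l , there l∈ , there l̄∈
... | _ , _ , refl , _ , inj₁ (refl , L∈′) | _ , _ , refl , _ , inj₂ (refl , M∈′) =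
  pos x , here refl , here refl
... | _ , _ , refl , _ , inj₂ (refl , L∈′) | _ , _ , refl , _ , inj₁ (refl , M∈′) =
  neg x , here refl , here refl
... | _ , _ , refl , _ , inj₂ (refl , L∈′) | _ , _ , refl , _ , inj₂ (refl , M∈′) =
  let l , l∈ , l̄∈ = parityLits-conflict xs (not c) L∈′ M∈′ in l , there l∈ , there l̄∈

-- Variable names

nextPair : ℕ × ℕ → ℕ × ℕ
nextPair (zero  , b) = suc b , zero
nextPair (suc a , b) = a , suc b

-- The inverse of Cantor's pairing, found by walking `k` steps along the diagonals rather than by
-- extracting a root.
unpair : ℕ → ℕ × ℕ
unpair zero    = zero , zero
unpair (suc k) = nextPair (unpair k)

diagonal : ℕ → ℕ
diagonal zero    = zero
diagonal (suc d) = suc (d + diagonal d)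

pair : ℕ → ℕ → ℕ
pair a b = b + diagonal (a + b)

unpair-diagonal : ∀ d b a → a + b ≡ d → unpair (b + diagonal d) ≡ (a , b)
unpair-diagonal zero    zero    zero    refl = refl
unpair-diagonal (suc d) zero    (suc a) eq   =
  cong nextPair (unpair-diagonal d d zero refl) ∙ cong (λ a → suc a , zero) (sym (ℕ.suc-injective (sym (cong suc (ℕ.+-identityʳ a)) ∙ eq)))
  where _∙_ = trans
unpair-diagonal d (suc b) a eq =
  cong nextPair (unpair-diagonal d b (suc a) (trans (sym (ℕ.+-suc a b)) eq))

unpair-pair : ∀ a b → unpair (pair a b) ≡ (a , b)
unpair-pair a b = unpair-diagonal (a + b) b a refl

data Line : Set where
  row col : ℕ → Line

-- The entries of a matrix, the sums of the first k entries of its lines, and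
-- the sums of its upper left i × j blocks.
data Cell : Set where
  entry  : ℕ → ℕ → Cell
  prefix : Line → ℕ → Cell
  area   : ℕ → ℕ → Cell

_≟ᴺ_ : DecidableEquality Line
row i ≟ᴺ row j = map′ (cong row) (λ { refl → refl }) (i ≟ j)
row i ≟ᴺ col j = no λ ()
col i ≟ᴺ row j = no λ ()
col i ≟ᴺ col j = map′ (cong col) (λ { refl → refl }) (i ≟ j)

_≟ᴱ_ : DecidableEquality Cell
entry i j  ≟ᴱ entry k l  = map′ (λ { (refl , refl) → refl }) (λ { refl → refl , refl }) (i ≟ k ×-dec j ≟ l)
entry i j  ≟ᴱ prefix k l = no λ ()
entry i j  ≟ᴱ area k l   = no λ ()
prefix i j ≟ᴱ entry k l  = no λ ()
prefix i j ≟ᴱ prefix k l = map′ (λ { (refl , refl) → refl }) (λ { refl → refl , refl }) (i ≟ᴺ k ×-dec j ≟ l)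
prefix i j ≟ᴱ area k l   = no λ ()
area i j   ≟ᴱ entry k l  = no λ ()
area i j   ≟ᴱ prefix k l = no λ ()
area i j   ≟ᴱ area k l   = map′ (λ { (refl , refl) → refl }) (λ { refl → refl , refl }) (i ≟ k ×-dec j ≟ l)

cellCode : Cell → ℕ
cellCode (entry i j)        = pair 0 (pair i j)
cellCode (prefix (row i) j) = pair 1 (pair i j)
cellCode (prefix (col i) j) = pair 2 (pair i j)
cellCode (area i j)         = pair 3 (pair i j)

taggedCell : ℕ → ℕ × ℕ → Cell
taggedCell 0 (i , j) = entry i j
taggedCell 1 (i , j) = prefix (row i) j
taggedCell 2 (i , j) = prefix (col i) j
taggedCell _ (i , j) = area i j

decodeCell : ℕ → Cell
decodeCell k = let t , ij = unpair k in taggedCell t (unpair ij)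

decodeCell-pair : ∀ t i j → decodeCell (pair t (pair i j)) ≡ taggedCell t (i , j)
decodeCell-pair t i j rewrite unpair-pair t (pair i j) | unpair-pair i j = refl

decodeCell-cellCode : ∀ v → decodeCell (cellCode v) ≡ v
decodeCell-cellCode (entry i j)        = decodeCell-pair 0 i j
decodeCell-cellCode (prefix (row i) j) = decodeCell-pair 1 i j
decodeCell-cellCode (prefix (col i) j) = decodeCell-pair 2 i j
decodeCell-cellCode (area i j)         = decodeCell-pair 3 i j

bitCode : Bool → ℕ
bitCode false = 0
bitCode true  = 1

decodeBit : ℕ → Bool
decodeBit zero    = false
decodeBit (suc _) = true

decodeBit-bitCode : ∀ b → decodeBit (bitCode b) ≡ b
decodeBit-bitCode false = refl
decodeBit-bitCode true  = refl

-- A cell v is represented by two variables, of which it is the exclusive or;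
-- each of them has a twin, which serves in the second family of formulas.
record Symbol : Set where
  constructor symbol
  field
    cell : Cell
    side : Bool
    twin : Bool

open Symbol public

symbol-≡ : ∀ {v w : Cell} {c d f h : Bool} → v ≡ w → c ≡ d → f ≡ h → symbol v c f ≡ symbol w d h
symbol-≡ refl refl refl = refl

abstract

  -- Opaque, so that variables are handled through `decode-name` only and codes are never computed.
  name : Symbol → Var
  name (symbol v c f) = pair (bitCode f) (pair (bitCode c) (cellCode v))

  decode : Var → Symbol
  decode x =
    let f , y = unpair x
        c , v = unpair y
    in symbol (decodeCell v) (decodeBit c) (decodeBit f)

  decode-name : ∀ s → decode (name s) ≡ s
  decode-name (symbol v c f)
    rewrite unpair-pair (bitCode f) (pair (bitCode c) (cellCode v))
          | unpair-pair (bitCode c) (cellCode v)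
    = symbol-≡ (decodeCell-cellCode v) (decodeBit-bitCode c) (decodeBit-bitCode f)

name-injective : ∀ {s t} → name s ≡ name t → s ≡ t
name-injective {s} {t} eq = trans (sym (decode-name s)) (trans (cong decode eq) (decode-name t))

base : Cell → Bool → Var
base v c = name (symbol v c false)

cellOf : Literal → Cell
cellOf l = cell (decode (var l))

cellVars : List Cell → List Var
cellVars []       = []
cellVars (v ∷ vs) = base v false ∷ base v true ∷ cellVars vs

∈-cellVars⁻ : ∀ vs {x} → x ∈ cellVars vs → ∃₂ λ v c → v ∈ vs × x ≡ base v c
∈-cellVars⁻ (v ∷ vs) (here eq)         = v , false , here refl , eq
∈-cellVars⁻ (v ∷ vs) (there (here eq)) = v , true , here refl , eq
∈-cellVars⁻ (v ∷ vs) (there (there x∈)) =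
  let w , c , w∈ , eq = ∈-cellVars⁻ vs x∈ in w , c , there w∈ , eq

∈-cellVars⁺ : ∀ {vs v} c → v ∈ vs → base v c ∈ cellVars vs
∈-cellVars⁺ false (here refl) = here refl
∈-cellVars⁺ true  (here refl) = there (here refl)
∈-cellVars⁺ c     (there v∈)  = there (there (∈-cellVars⁺ c v∈))

-- Linear equations over cells

Valuation : Set
Valuation = Cell → Bool

value : Assignment → Valuation
value α v = α (base v false) xor α (base v true)

total : Valuation → List Cell → Bool
total f []       = false
total f (v ∷ vs) = f v xor total f vs

total-value : ∀ α vs → parity α (cellVars vs) ≡ total (value α) vs
total-value α []       = refl
total-value α (v ∷ vs) = trans (sym (Bool.xor-assoc (α (base v false)) _ _)) (cong (value α v xor_) (total-value α vs))

Equation : Set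
Equation = List Cell × Bool

Holds : Valuation → Equation → Set
Holds f (vs , c) = total f vs ≡ c

equationLits : Equation → List (List Literal)
equationLits (vs , c) = parityLits (cellVars vs) c

encode : Equation → CNF
encode e = clausesOf (equationLits e)

encode-sound : ∀ {α} e → α ⊨ᶜ encode e → Holds (value α) e
encode-sound {α} (vs , c) sat with total (value α) vs Bool.≟ c
... | yes eq = eq
... | no ne  =
  let L , L∈ , ⊭L = falsified-parity (cellVars vs) c (λ eq → ne (trans (sym (total-value α vs)) eq))
  in ⊥-elim (⊭L (⊨ᶜ-clausesOf _ sat L∈))

encode-complete : ∀ {α} e → Holds (value α) e → α ⊨ᶜ encode e
encode-complete {α} (vs , c) eq =
  clausesOf-⊨ᶜ _ (parity⇒⊨ (cellVars vs) c (trans (total-value α vs) eq))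

encode-vars : ∀ e {C l} → C ∈ encode e → l ∈ lits C → var l ∈ cellVars (proj₁ e)
encode-vars (vs , c) C∈ l∈ = parityLits-vars _ c (clausesOf⁻ _ C∈) l∈

-- The summation formula

crossing : Line → ℕ → Cell
crossing (row i) j = entry i j
crossing (col j) i = entry i j

charge : Line → Bool
charge (row zero) = true
charge _          = false

startEquation : Line → Equation
startEquation ℓ = prefix ℓ 0 ∷ [] , false

stepEquation : Line → ℕ → Equation
stepEquation ℓ k = prefix ℓ (suc k) ∷ prefix ℓ k ∷ crossing ℓ k ∷ [] , false

endEquation : ℕ → Line → Equation
endEquation g ℓ = prefix ℓ g ∷ [] , charge ℓ

lineEquations : ℕ → Line → List Equation
lineEquations g ℓ = startEquation ℓ ∷ endEquation g ℓ ∷ map (stepEquation ℓ) (upTo g)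

lines : ℕ → List Line
lines g = map row (upTo g) ++ map col (upTo g)

system : ℕ → List Equation
system g = concatMap (lineEquations g) (lines g)

formula : ℕ → CNF
formula g = concatMap encode (system g)

Balanced : ℕ → Valuation → Line → Set
Balanced g f ℓ = ∀ {e} → e ∈ lineEquations g ℓ → Holds f e

step∈ : ∀ {g k} ℓ → k < g → stepEquation ℓ k ∈ lineEquations g ℓ
step∈ ℓ k<g = there (there (∈-map⁺ (stepEquation ℓ) (∈-upTo⁺ k<g)))

row∈ : ∀ {g i} → i < g → row i ∈ lines g
row∈ i<g = ∈-++⁺ˡ (∈-map⁺ row (∈-upTo⁺ i<g))

col∈ : ∀ {g j} → j < g → col j ∈ lines g
col∈ {g} j<g = ∈-++⁺ʳ (map row (upTo g)) (∈-map⁺ col (∈-upTo⁺ j<g))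

system⁺ : ∀ {g ℓ e} → ℓ ∈ lines g → e ∈ lineEquations g ℓ → e ∈ system g
system⁺ {g} ℓ∈ e∈ = ∈-concatMap⁺ (lineEquations g) (lose ℓ∈ e∈)

formula⁺ : ∀ g {e C} → e ∈ system g → C ∈ encode e → C ∈ formula g
formula⁺ g e∈ C∈ = ∈-concatMap⁺ encode (lose e∈ C∈)

formula⁻ : ∀ g {C} → C ∈ formula g → ∃₂ λ ℓ e → ℓ ∈ lines g × e ∈ lineEquations g ℓ × C ∈ encode e
formula⁻ g C∈ =
  let e , e∈ , C∈e = find (∈-concatMap⁻ encode {xs = system g} C∈)
      ℓ , ℓ∈ , e∈ℓ = find (∈-concatMap⁻ (lineEquations g) {xs = lines g} e∈)
  in ℓ , e , ℓ∈ , e∈ℓ , C∈e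

-- Unsatisfiability of the linear system

xor-solve₁ : ∀ {a} c → a xor false ≡ c → a ≡ c
xor-solve₁ c = trans (sym (Bool.xor-identityʳ _))

xor-solve₃ : ∀ a b c → a xor (b xor (c xor false)) ≡ false → a ≡ b xor c
xor-solve₃ false false false eq = refl
xor-solve₃ false true  true  eq = refl
xor-solve₃ true  false true  eq = refl
xor-solve₃ true  true  false eq = refl

xor-unsolve₃ : ∀ a b c → a ≡ b xor c → a xor (b xor (c xor false)) ≡ false
xor-unsolve₃ _ false false refl = refl
xor-unsolve₃ _ false true  refl = refl
xor-unsolve₃ _ true  false refl = refl
xor-unsolve₃ _ true  true  refl = refl

-- Passing to the next row preserves the rule for adding a column to a block.
column-rule : ∀ {u₀₁ u₁₀ u₁₁ s′ t′} u₀₀ s t x →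
  u₁₀ ≡ u₀₀ xor s → u₁₁ ≡ u₀₁ xor s′ → u₀₁ ≡ u₀₀ xor t → s′ ≡ s xor x → t′ ≡ t xor x →
  u₁₁ ≡ u₁₀ xor t′
column-rule u s t x refl refl refl refl refl = lemma u s t x
  where
  lemma : ∀ u s t x → (u xor t) xor (s xor x) ≡ (u xor s) xor (t xor x)
  lemma false false t x = refl
  lemma true  false t x = sym (Bool.not-distribˡ-xor t x)
  lemma false true false x = refl
  lemma false true true  x = refl
  lemma true  true false x = Bool.not-involutive x
  lemma true  true true  x = refl

module _ (f : Valuation) where

  -- The value that `area i j` takes when the areas are defined; the refutations later repeat this
  -- argument with cells in place of values.
  block : ℕ → ℕ → Bool
  block zero    j = false
  block (suc i) j = block i j xor f (prefix (row i) j)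

  module _ (g : ℕ) (balanced : ∀ {ℓ} → ℓ ∈ lines g → Balanced g f ℓ) where

    start : ∀ {ℓ} → ℓ ∈ lines g → f (prefix ℓ 0) ≡ false
    start ℓ∈ = xor-solve₁ _ (balanced ℓ∈ (here refl))

    end : ∀ {ℓ} → ℓ ∈ lines g → f (prefix ℓ g) ≡ charge ℓ
    end ℓ∈ = xor-solve₁ _ (balanced ℓ∈ (there (here refl)))

    step : ∀ {ℓ k} → ℓ ∈ lines g → k < g → f (prefix ℓ (suc k)) ≡ f (prefix ℓ k) xor f (crossing ℓ k)
    step {ℓ} {k} ℓ∈ k<g = xor-solve₃ _ (f (prefix ℓ k)) (f (crossing ℓ k)) (balanced ℓ∈ (step∈ ℓ k<g))

    block-column : ∀ i j → i ≤ g → j < g → block i (suc j) ≡ block i j xor f (prefix (col j) i)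
    block-column zero    j i≤g j<g = sym (start (col∈ j<g))
    block-column (suc i) j i<g j<g =
      column-rule (block i j) (f (prefix (row i) j)) (f (prefix (col j) i)) (f (entry i j)) refl refl (block-column i j (ℕ.<⇒≤ i<g) j<g)
        (step (row∈ i<g) j<g) (step (col∈ j<g) i<g)

    block-end-row : ∀ i → i < g → block (suc i) g ≡ true
    block-end-row zero    i<g = end (row∈ i<g)
    block-end-row (suc i) i<g =
      trans (cong (_xor f (prefix (row (suc i)) g)) (block-end-row i (ℕ.<-trans (ℕ.n<1+n i) i<g)))
            (cong not (end (row∈ i<g)))

    block-first-column : ∀ i → i ≤ g → block i 0 ≡ false
    block-first-column zero    i≤g = refl
    block-first-column (suc i) i<g =
      trans (cong (_xor f (prefix (row i) 0)) (block-first-column i (ℕ.<⇒≤ i<g))) (start (row∈ i<g))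

    block-end-column : ∀ j → j ≤ g → block g j ≡ false
    block-end-column zero    j≤g = block-first-column g ℕ.≤-refl
    block-end-column (suc j) j<g =
      trans (block-column g j ℕ.≤-refl j<g)
            (trans (cong (_xor f (prefix (col j) g)) (block-end-column j (ℕ.<⇒≤ j<g))) (end (col∈ j<g)))

-- The full block is true when summed by rows and false when summed by columns; `1 ≤ g` supplies the
-- charged row.
system-unsolvable : ∀ g f → 1 ≤ g → ¬ (∀ {ℓ} → ℓ ∈ lines g → Balanced g f ℓ)
system-unsolvable (suc g) f _ balanced
  with trans (sym (block-end-row f (suc g) balanced g (ℕ.n<1+n g))) (block-end-column f (suc g) balanced (suc g) ℕ.≤-refl)
... | ()

formula-unsatisfiable : ∀ g α → 1 ≤ g → ¬ (α ⊨ᶜ formula g)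
formula-unsatisfiable g α 1≤g sat = system-unsolvable g (value α) 1≤g λ ℓ∈ {e} e∈ →
  encode-sound e λ C∈ → sat (formula⁺ g (system⁺ ℓ∈ e∈) C∈)

-- Inclusion of CNFs up to equality of clauses as sets

infix 4 _⊆ᶜ_

_⊆ᶜ_ : CNF → CNF → Set
Γ ⊆ᶜ Δ = ∀ {C} → C ∈ Γ → C ∈ᶜ Δ

⊆ᶜ-apply : ∀ {Γ Δ L} → Γ ⊆ᶜ Δ → L ∈ˡ Γ → L ∈ˡ Δ
⊆ᶜ-apply Γ⊆Δ L∈ = let D , D∈ , L⊆D , D⊆L = find-∈ᶜ L∈ in ∈ᶜ-resp L⊆D D⊆L (Γ⊆Δ D∈)

∈ᶜ-++⁻ : ∀ Γ {Δ L} → L ∈ˡ Γ ++ Δ → L ∈ˡ Γ ⊎ L ∈ˡ Δ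
∈ᶜ-++⁻ Γ L∈ with find-∈ᶜ L∈
... | D , D∈ , L⊆D , D⊆L with ∈-++⁻ Γ D∈
...   | inj₁ D∈Γ = inj₁ (∈ᶜ-resp L⊆D D⊆L (∈⇒∈ᶜ D∈Γ))
...   | inj₂ D∈Δ = inj₂ (∈ᶜ-resp L⊆D D⊆L (∈⇒∈ᶜ D∈Δ))

∈ᶜ-++⁺ˡ : ∀ {Γ} Δ {L} → L ∈ˡ Γ → L ∈ˡ Γ ++ Δ
∈ᶜ-++⁺ˡ Δ = ⊆ᶜ-apply λ C∈ → ∈⇒∈ᶜ (∈-++⁺ˡ C∈)

∈ᶜ-++⁺ʳ : ∀ Γ {Δ L} → L ∈ˡ Δ → L ∈ˡ Γ ++ Δ
∈ᶜ-++⁺ʳ Γ = ⊆ᶜ-apply λ C∈ → ∈⇒∈ᶜ (∈-++⁺ʳ Γ C∈)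

_∈ᶜ?_ : ∀ C Γ → Dec (C ∈ᶜ Γ)
C ∈ᶜ? Γ = Any.any? (C ≟ᶜ_) Γ

-- Padding

paddings : List Literal → List Var → List (List Literal)
paddings L []      = []
paddings L (x ∷ W) = (pos x ∷ L) ∷ (neg x ∷ L) ∷ paddings L W

padLits : CNF → List Var → List (List Literal)
padLits F W = concatMap (λ D → paddings (lits D) W) F

pad : CNF → List Var → CNF
pad F W = F ++ clausesOf (padLits F W)

paddings⁺ : ∀ L {W l} → var l ∈ W → l ∷ L ∈ paddings L W
paddings⁺ L {l = pos x} (here refl) = here refl
paddings⁺ L {l = neg x} (here refl) = there (here refl)
paddings⁺ L             (there x∈)  = there (there (paddings⁺ L x∈))

paddings⁻ : ∀ L W {M} → M ∈ paddings L W → ∃[ l ] var l ∈ W × M ≡ l ∷ L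
paddings⁻ L (x ∷ W) (here eq)          = pos x , here refl , eq
paddings⁻ L (x ∷ W) (there (here eq))  = neg x , here refl , eq
paddings⁻ L (x ∷ W) (there (there M∈)) =
  let l , l∈ , eq = paddings⁻ L W M∈ in l , there l∈ , eq

padded∈ : ∀ F W {D l} → D ∈ F → var l ∈ W → compl l ∉ lits D → ∃[ C ] C ∈ pad F W × lits C ≡ l ∷ lits D
padded∈ F W {D} {l} D∈ l∈ l̄∉ =
  let C , C∈ , eq = clausesOf⁺ (padLits F W)
        (∈-concatMap⁺ (λ D → paddings (lits D) W) (lose D∈ (paddings⁺ (lits D) l∈))) nontaut
  in C , ∈-++⁺ʳ F C∈ , eq
  where
  nontaut : ¬ Tautological (l ∷ lits D)
  nontaut (x , there p , there n) = nontautological D (x , p , n)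
  nontaut (x , here refl , there n) = l̄∉ n
  nontaut (x , there p , here refl) = l̄∉ p

data Padded (F : CNF) (W : List Var) (C : Clause) : Set where
  original : C ∈ F → Padded F W C
  weakened : ∀ {D} l → D ∈ F → var l ∈ W → lits C ≡ l ∷ lits D → Padded F W C

pad⁻ : ∀ F W {C} → C ∈ pad F W → Padded F W C
pad⁻ F W C∈ with ∈-++⁻ F C∈
... | inj₁ C∈F = original C∈F
... | inj₂ C∈P =
  let D , D∈ , C∈D = find (∈-concatMap⁻ (λ D → paddings (lits D) W) {xs = F} (clausesOf⁻ _ C∈P))
      l , l∈ , eq  = paddings⁻ (lits D) W C∈D
  in weakened l D∈ l∈ eq

vars-pad⊆ : ∀ F W → vars F ⊆ W → vars (pad F W) ⊆ W
vars-pad⊆ F W F⊆W x∈ with ∈-vars⁻ (pad F W) x∈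
... | C , l , C∈ , l∈ , refl with pad⁻ F W C∈
...   | original C∈F = F⊆W (∈-vars⁺ C∈F l∈)
...   | weakened m D∈ m∈ eq with subst (l ∈_) eq l∈
...     | here refl = m∈
...     | there l∈D = F⊆W (∈-vars⁺ D∈ l∈D)

-- An unsatisfiable formula has some clause `D`, and at least one of `x` and its negation can be
-- added to `D` without a tautology.
⊆vars-pad : ∀ F W → ¬ (∀ {α} → α ⊨ᶜ F) → W ⊆ vars (pad F W)
⊆vars-pad []      W unsat x∈ = ⊥-elim (unsat λ ())
⊆vars-pad (D ∷ F) W unsat {x} x∈ with neg x ∈ᴸ? lits D
... | no  n∉ = let C , C∈ , eq = padded∈ (D ∷ F) W {l = pos x} (here refl) x∈ n∉
               in ∈-vars⁺ {l = pos x} C∈ (subst (pos x ∈_) (sym eq) (here refl))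
... | yes n∈ = let C , C∈ , eq = padded∈ (D ∷ F) W {l = neg x} (here refl) x∈ λ p∈ → conflict-free D p∈ n∈
               in ∈-vars⁺ {l = neg x} C∈ (subst (neg x ∈_) (sym eq) (here refl))

-- If C = {p} ∪ C′ were blocked, then making p true and C′ false would satisfy
-- F: a clause D of F without p is satisfied by the literal that clashes with
-- C′ in the padded clause {p̄} ∪ D.
pad-nonblocked : ∀ {F W Γ} → (∀ α → ¬ (α ⊨ᶜ F)) → pad F W ⊆ᶜ Γ →
  ∀ {C p} → var p ∈ W → ¬ IsBlockedFor Γ C p
pad-nonblocked {F} {W} {Γ} unsat pad⊆ {C} {p} p∈W (C′ , C-split , blocked) = unsat α satisfies
  where
  truth : Literal → Bool
  truth (pos _) = true
  truth (neg _) = false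
  α : Assignment
  α x with x ≟ var p | neg x ∈ᴸ? C′
  ... | yes _ | _     = truth p
  ... | no _  | yes _ = true
  ... | no _  | no _  = false
  p-true : ∀ q → q ≡ p → eval α q ≡ true
  p-true (pos x) refl with x ≟ x
  ... | yes _ = refl
  ... | no ne = ⊥-elim (ne refl)
  p-true (neg x) refl with x ≟ x
  ... | yes _ = refl
  ... | no ne = ⊥-elim (ne refl)
  C′-false : ∀ l → compl l ∈ C′ → eval α l ≡ true
  C′-false (pos x) l̄∈ with x ≟ var p | neg x ∈ᴸ? C′
  ... | yes eq | _     = ⊥-elim (tail-≢ C-split l̄∈ eq)
  ... | no _   | yes _ = refl
  ... | no _   | no ∉  = ⊥-elim (∉ l̄∈)
  C′-false (neg x) l̄∈ with x ≟ var p | neg x ∈ᴸ? C′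
  ... | yes eq | _      = ⊥-elim (tail-≢ C-split l̄∈ eq)
  ... | no _   | yes n∈ = ⊥-elim (conflict-free C (tail⊆ C-split l̄∈) (tail⊆ C-split n∈))
  ... | no _   | no _   = refl
  satisfies : α ⊨ᶜ F
  satisfies {D} D∈ with p ∈ᴸ? lits D
  ... | yes p∈ = lose p∈ (p-true p refl)
  ... | no p∉ with padded∈ F W {l = compl p} D∈ (subst (_∈ W) (sym (var-compl p)) p∈W)
                     (subst (_∉ lits D) (sym (compl-involutive p)) p∉)
  ...   | E , E∈ , eq = clash (blocked E E′ (pad⊆ E∈) (≈-without E (subst (compl p ∈_) (sym eq) (here refl))))
    where
    E′ = without (compl p) (lits E)
    E′⊆D : E′ ⊆ lits D
    E′⊆D l∈ with ∈-without⁻ {compl p} {L = lits E} l∈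
    ... | l∈E , l≢ with subst (_ ∈_) eq l∈E
    ...   | here refl = ⊥-elim (l≢ refl)
    ...   | there l∈D = l∈D
    clash : Tautological (C′ ++ E′) → α ⊨ lits D
    clash (x , x∈ , x̄∈) with ∈-++⁻ C′ x∈ | ∈-++⁻ C′ x̄∈
    ... | inj₁ a | inj₁ b = ⊥-elim (conflict-free C (tail⊆ C-split a) (tail⊆ C-split b))
    ... | inj₁ a | inj₂ b = lose (E′⊆D b) (C′-false (neg x) a)
    ... | inj₂ a | inj₁ b = lose (E′⊆D a) (C′-false (pos x) b)
    ... | inj₂ a | inj₂ b = ⊥-elim (conflict-free D (E′⊆D a) (E′⊆D b))

module _ {F : CNF} {W : List Var} (unsat : ∀ α → ¬ (α ⊨ᶜ F)) (F⊆W : vars F ⊆ W) where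

  -- By `pad-nonblocked` neither CNF admits a single removal, so both are their own kernels, and
  -- equality of the kernels puts `Λ` inside the padded formula.
  pad-extension-⊆ : ∀ Λ → vars Λ ⊆ vars (pad F W) → IsBlockedExtension (pad F W) Λ → pad F W ++ Λ ⊆ᶜ pad F W
  pad-extension-⊆ Λ Λ⊆ (_ , _ , (steps , _) , (steps′ , _) , K⊆K′ , _) =
    unreduced steps steps′ λ {C} C∈ → K⊆K′ {C} (∈⇒∈ᶜ C∈)
    where
    irreducible : ∀ Γ {Δ} → pad F W ⊆ᶜ Γ → vars Γ ⊆ W → ¬ (Γ ⟶ Δ)
    irreducible Γ pad⊆ Γ⊆ (remove {C} C∈ (p , blocked@(_ , C-split , _))) =
      let D , D∈ , C⊆D , _ = find-∈ᶜ C∈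
      in pad-nonblocked unsat pad⊆ {C} {p} (Γ⊆ (∈-vars⁺ D∈ (C⊆D (head∈ C-split)))) blocked
    pad⊆W = vars-pad⊆ F W F⊆W
    all⊆W : vars (pad F W ++ Λ) ⊆ W
    all⊆W x∈ with ∈-vars⁻ (pad F W ++ Λ) x∈
    ... | C , l , C∈ , l∈ , refl with ∈-++⁻ (pad F W) C∈
    ...   | inj₁ C∈pad = pad⊆W (∈-vars⁺ C∈pad l∈)
    ...   | inj₂ C∈Λ   = pad⊆W (Λ⊆ (∈-vars⁺ C∈Λ l∈))
    unreduced : ∀ {K K′} → Star _⟶_ (pad F W ++ Λ) K → Star _⟶_ (pad F W) K′ →
      K ⊆ᶜ K′ → pad F W ++ Λ ⊆ᶜ pad F W
    unreduced (s ◅ _) _ _ = ⊥-elim (irreducible _ (λ C∈ → ∈⇒∈ᶜ (∈-++⁺ˡ C∈)) all⊆W s)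
    unreduced ε (s ◅ _) _ = ⊥-elim (irreducible _ ∈⇒∈ᶜ pad⊆W s)
    unreduced ε ε K⊆      = K⊆

  pad-kernel : ∀ {K} → K ≐ᶜ pad F W → ∀ C → C ∈ᶜ K → ¬ IsBlocked K C
  pad-kernel (K⊆ , pad⊆) C C∈ (p , blocked@(_ , C-split , _)) =
    let D , D∈ , C⊆D , _ = find-∈ᶜ (K⊆ {C} C∈)
    in pad-nonblocked unsat (λ {E} E∈ → pad⊆ {E} (∈⇒∈ᶜ E∈)) {C} {p}
         (vars-pad⊆ F W F⊆W (∈-vars⁺ D∈ (C⊆D (head∈ C-split)))) blocked

-- Removing blocked clauses one by one

data Eliminable (Γ : CNF) : CNF → Set where
  []  : Eliminable Γ []
  _∷_ : ∀ {C R} → IsBlocked (Γ ++ C ∷ R) C → Eliminable Γ R → Eliminable Γ (C ∷ R)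

blocked-antitone : ∀ {Γ Δ C} → Δ ⊆ᶜ Γ → IsBlocked Γ C → IsBlocked Δ C
blocked-antitone Δ⊆Γ (p , C′ , split , blocked) =
  p , C′ , split , λ D D′ D∈ → blocked D D′ (⊆ᶜ-apply Δ⊆Γ D∈)

-- A removal deletes all copies of a clause at once, while `R` may repeat it. Hence `Δ` is only
-- bounded from both sides, and a clause that is already gone is skipped.
eliminate : ∀ {Γ R} Δ → Δ ⊆ᶜ Γ ++ R → Γ ⊆ᶜ Δ → (∀ {C} → C ∈ R → ¬ (C ∈ᶜ Γ)) →
  Eliminable Γ R → ∃[ K ] Star _⟶_ Δ K × K ≐ᶜ Γ
eliminate {Γ} Δ Δ⊆ Γ⊆ fresh [] =
  Δ , ε , ⊆ᶜ-apply (λ C∈ → [ id , (λ ()) ]′ (∈ᶜ-++⁻ Γ (Δ⊆ C∈))) , ⊆ᶜ-apply Γ⊆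
eliminate {Γ} {C ∷ R} Δ Δ⊆ Γ⊆ fresh (blocked ∷ elim) with C ∈ᶜ? Δ
... | no C∉ = eliminate Δ Δ⊆R Γ⊆ (fresh ∘ there) elim
  where
  Δ⊆R : Δ ⊆ᶜ Γ ++ R
  Δ⊆R {D} D∈ with ∈ᶜ-++⁻ Γ (Δ⊆ D∈)
  ... | inj₁ D∈Γ = ∈ᶜ-++⁺ˡ R D∈Γ
  ... | inj₂ (here (D⊆C , C⊆D)) = ⊥-elim (C∉ (∈ᶜ-resp C⊆D D⊆C (∈⇒∈ᶜ D∈)))
  ... | inj₂ (there D∈R) = ∈ᶜ-++⁺ʳ Γ D∈R
... | yes C∈ =
  let K , steps , K≐ = eliminate (Δ ∖ C) Δ∖C⊆ Γ⊆′ (fresh ∘ there) elim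
  in K , remove C∈ (blocked-antitone Δ⊆ blocked) ◅ steps , K≐
  where
  other? : ∀ D → Dec (¬ (C ≈ᶜ D))
  other? D = ¬? (C ≟ᶜ D)
  Δ∖C⊆ : (Δ ∖ C) ⊆ᶜ Γ ++ R
  Δ∖C⊆ {D} D∈ with ∈-filter⁻ other? {xs = Δ} D∈
  ... | D∈Δ , C≉D with ∈ᶜ-++⁻ Γ (Δ⊆ D∈Δ)
  ...   | inj₁ D∈Γ = ∈ᶜ-++⁺ˡ R D∈Γ
  ...   | inj₂ (here (D⊆C , C⊆D)) = ⊥-elim (C≉D (C⊆D , D⊆C))
  ...   | inj₂ (there D∈R) = ∈ᶜ-++⁺ʳ Γ D∈R
  Γ⊆′ : Γ ⊆ᶜ Δ ∖ C
  Γ⊆′ {D} D∈ with find-∈ᶜ (Γ⊆ D∈)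
  ... | E , E∈ , D⊆E , E⊆D = ∈ᶜ-resp D⊆E E⊆D (∈⇒∈ᶜ (∈-filter⁺ other? E∈
          λ (C⊆E , E⊆C) → fresh (here refl) (∈ᶜ-resp (E⊆D ∘ C⊆E) (E⊆C ∘ D⊆E) (∈⇒∈ᶜ D∈))))

-- Twin variables

flip : Symbol → Symbol
flip (symbol v c f) = symbol v c (not f)

partner : Var → Var
partner x = name (flip (decode x))

mirror : Literal → Literal
mirror (pos x) = pos (partner x)
mirror (neg x) = neg (partner x)

partner-name : ∀ v c f → partner (name (symbol v c f)) ≡ name (symbol v c (not f))
partner-name v c f = cong (name ∘ flip) (decode-name (symbol v c f))

-- The implication from `l` to its twin; the pairs of both literals of a variable make it equivalent
-- to its twin.
twinPair : Literal → List Literal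
twinPair l = compl l ∷ mirror l ∷ []

twinPairs : List Var → List (List Literal)
twinPairs []      = []
twinPairs (x ∷ W) = twinPair (pos x) ∷ twinPair (neg x) ∷ twinPairs W

twins : List Var → CNF
twins W = clausesOf (twinPairs W)

Plain : Var → Set
Plain x = ∃₂ λ v c → x ≡ base v c

plain-decode : ∀ {x} → Plain x → twin (decode x) ≡ false
plain-decode (v , c , refl) = cong twin (decode-name (symbol v c false))

partner-decode : ∀ {x} → Plain x → twin (decode (partner x)) ≡ true
partner-decode (v , c , refl) =
  trans (cong (twin ∘ decode) (partner-name v c false)) (cong twin (decode-name (symbol v c true)))

partner-not-plain : ∀ {x} → Plain x → ¬ Plain (partner x)
partner-not-plain p q with trans (sym (plain-decode q)) (partner-decode p)
... | ()

partner-injective : ∀ {x y} → Plain x → Plain y → partner x ≡ partner y → x ≡ y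
partner-injective (v , c , refl) (w , d , refl) eq
  with name-injective (trans (sym (partner-name v c false)) (trans eq (partner-name w d false)))
... | refl = refl

var-mirror : ∀ l → var (mirror l) ≡ partner (var l)
var-mirror (pos x) = refl
var-mirror (neg x) = refl

partner-involutive : ∀ {x} → Plain x → partner (partner x) ≡ x
partner-involutive (v , c , refl) = trans (cong partner (partner-name v c false)) (partner-name v c true)

compl-mirror : ∀ l → compl (mirror l) ≡ mirror (compl l)
compl-mirror (pos x) = refl
compl-mirror (neg x) = refl

mirror-involutive : ∀ l → Plain (var l) → mirror (mirror l) ≡ l
mirror-involutive (pos x) pl = cong pos (partner-involutive pl)
mirror-involutive (neg x) pl = cong neg (partner-involutive pl)

mirror⁻ : ∀ p {y} → var p ≡ partner y → ∃[ q ] var q ≡ y × p ≡ mirror q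
mirror⁻ (pos x) refl = pos _ , refl , refl
mirror⁻ (neg x) refl = neg _ , refl , refl

twinPairs⁺ : ∀ W l → var l ∈ W → twinPair l ∈ twinPairs W
twinPairs⁺ (x ∷ W) (pos x) (here refl) = here refl
twinPairs⁺ (x ∷ W) (neg x) (here refl) = there (here refl)
twinPairs⁺ (x ∷ W) l       (there l∈)  = there (there (twinPairs⁺ W l l∈))

twinPairs⁻ : ∀ W {L} → L ∈ twinPairs W → ∃[ l ] var l ∈ W × L ≡ twinPair l
twinPairs⁻ (x ∷ W) (here eq)          = pos x , here refl , eq
twinPairs⁻ (x ∷ W) (there (here eq))  = neg x , here refl , eq
twinPairs⁻ (x ∷ W) (there (there L∈)) =
  let l , l∈ , eq = twinPairs⁻ W L∈ in l , there l∈ , eq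

twinPair-nontautological : ∀ l → Plain (var l) → ¬ Tautological (twinPair l)
twinPair-nontautological (pos x) pl (_ , there (here refl) , here eq) =
  partner-not-plain pl (subst Plain (cong var (sym eq)) pl)
twinPair-nontautological (neg x) pl (_ , here refl , there (here eq)) =
  partner-not-plain pl (subst Plain (cong var eq) pl)
twinPair-nontautological (pos x) pl (_ , there (here _) , there (here ()))
twinPair-nontautological (neg x) pl (_ , there (here ()) , _)

twins⁺ : ∀ W l → var l ∈ W → Plain (var l) → ∃[ C ] C ∈ twins W × lits C ≡ twinPair l
twins⁺ W l l∈ pl = clausesOf⁺ (twinPairs W) (twinPairs⁺ W l l∈) (twinPair-nontautological l pl)

data IsTwin (C : Clause) : Set where
  is-twin : ∀ l → Plain (var l) → lits C ≡ twinPair l → IsTwin C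

mirror-clash : ∀ l m → Plain (var l) → Plain (var m) → compl (mirror l) ≡ mirror m → m ≡ compl l
mirror-clash (pos x) (neg y) pl pm eq = cong neg (partner-injective pm pl (sym (cong var eq)))
mirror-clash (neg x) (pos y) pl pm eq = cong pos (partner-injective pm pl (sym (cong var eq)))

twins⁻ : ∀ W {C} → (∀ {x} → x ∈ W → Plain x) → C ∈ twins W → IsTwin C
twins⁻ W plain C∈ =
  let l , l∈ , eq = twinPairs⁻ W (clausesOf⁻ (twinPairs W) C∈) in is-twin l (plain l∈) eq

AllPlain : CNF → Set
AllPlain Γ = ∀ {C l} → C ∈ Γ → l ∈ lits C → Plain (var l)

compl-mirror-not-plain : ∀ l → Plain (var l) → ¬ Plain (var (compl (mirror l)))
compl-mirror-not-plain l pl q =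
  partner-not-plain pl (subst Plain (trans (var-compl (mirror l)) (var-mirror l)) q)

-- Each pair is blocked for its twin literal: the complement of that occurs only in the converse
-- implication, which contains `l` and so clashes with `compl l`. Twin clauses therefore go first,
-- before `Λ`.
twins-eliminable : ∀ {Γ Λ} Ts → (∀ {C} → C ∈ Ts → IsTwin C) → AllPlain Γ → AllPlain Λ →
  Eliminable Γ Λ → Eliminable Γ (Ts ++ Λ)
twins-eliminable []       _    plainΓ plainΛ elim = elim
twins-eliminable {Γ} {Λ} (C ∷ Ts) twin plainΓ plainΛ elim with twin (here refl)
... | is-twin l pl eq =
  (mirror l , without (mirror l) (lits C) , ≈-without C mirror∈ , clash) ∷
  twins-eliminable Ts (twin ∘ there) plainΓ plainΛ elim
  where
  mirror∈ : mirror l ∈ lits C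
  mirror∈ = subst (mirror l ∈_) (sym eq) (there (here refl))
  l̄∈ : compl l ∈ without (mirror l) (lits C)
  l̄∈ = ∈-without⁺ (subst (compl l ∈_) (sym eq) (here refl))
         λ e → partner-not-plain pl (subst Plain (trans (sym (var-compl l)) (trans (cong var e) (var-mirror l))) pl)
  only-twin : ∀ {D} → D ∈ C ∷ Ts → compl (mirror l) ∈ lits D → l ∈ lits D
  only-twin {D} D∈ m̄∈ with twin D∈
  ... | is-twin m pm eq′ with subst (_ ∈_) eq′ m̄∈
  ...   | here e = ⊥-elim (compl-mirror-not-plain l pl (subst Plain (sym (trans (cong var e) (var-compl m))) pm))
  ...   | there (here e) = subst (l ∈_) (sym eq′)
            (here (sym (trans (cong compl (mirror-clash l m pl pm e)) (compl-involutive l))))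
  l∈D : ∀ {D} → D ∈ Γ ++ C ∷ Ts ++ Λ → compl (mirror l) ∈ lits D → l ∈ lits D
  l∈D D∈ m̄∈ with ∈-++⁻ Γ D∈
  ... | inj₁ D∈Γ = ⊥-elim (compl-mirror-not-plain l pl (plainΓ D∈Γ m̄∈))
  ... | inj₂ D∈R with ∈-++⁻ (C ∷ Ts) D∈R
  ...   | inj₁ D∈Ts = only-twin D∈Ts m̄∈
  ...   | inj₂ D∈Λ  = ⊥-elim (compl-mirror-not-plain l pl (plainΛ D∈Λ m̄∈))
  clash : ∀ D D′ → D ∈ᶜ Γ ++ C ∷ Ts ++ Λ → D ≈[ compl (mirror l) ]∪ D′ →
    Tautological (without (mirror l) (lits C) ++ D′)
  clash D D′ D∈ split with find-∈ᶜ D∈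
  ... | E , E∈ , D⊆E , E⊆D with head∨tail split (E⊆D (l∈D E∈ (D⊆E (head∈ split))))
  ...   | inj₁ e = ⊥-elim (compl-mirror-not-plain l pl (subst (Plain ∘ var) e pl))
  ...   | inj₂ l∈D′ = conflict⇒tautological l (∈-++⁺ʳ _ l∈D′) (∈-++⁺ˡ l̄∈)

-- Restrictions

Choice : Set
Choice = Bool × Bool

-- ρ v = (c , b) fixes the variables on side c of the cell v to b.
Restriction : Set
Restriction = Cell → Choice

sign : Literal → Bool
sign (pos _) = true
sign (neg _) = false

Fixes : Cell → Choice → Literal → Set
Fixes v (c , b) l = cellOf l ≡ v × side (decode (var l)) ≡ c × sign l ≡ b

Kills : Cell → Choice → List Literal → Set
Kills v o = Any (Fixes v o)

kills? : ∀ v o L → Dec (Kills v o L)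
kills? v (c , b) = Any.any? λ l →
  (cellOf l ≟ᴱ v) ×-dec (side (decode (var l)) Bool.≟ c) ×-dec (sign l Bool.≟ b)

Mentions : List Literal → Cell → Set
Mentions L v = Any (λ l → cellOf l ≡ v) L

mentions? : ∀ L v → Dec (Mentions L v)
mentions? L v = Any.any? (λ l → cellOf l ≟ᴱ v) L

mentioned : List Cell → List Literal → List Cell
mentioned V L = filter (mentions? L) V

-- Counting restrictions

sumChoices : (Choice → ℕ) → ℕ
sumChoices f = f (false , false) + f (false , true) + f (true , false) + f (true , true)

sumChoices-+ : ∀ f h → sumChoices (λ o → f o + h o) ≡ sumChoices f + sumChoices h
sumChoices-+ f h = lemma (f _) (f _) (f _) (f _) (h _) (h _) (h _) (h _)
  where
  lemma : ∀ a b c d x y z w → (a + x) + (b + y) + (c + z) + (d + w) ≡ (a + b + c + d) + (x + y + z + w)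
  lemma = solve-∀

sumChoices-≤ : ∀ f w → (∀ o → f o ≤ w) → sumChoices f ≤ 4 * w
sumChoices-≤ f w f≤ = subst (sumChoices f ≤_) (lemma w)
  (ℕ.+-mono-≤ (ℕ.+-mono-≤ (ℕ.+-mono-≤ (f≤ _) (f≤ _)) (f≤ _)) (f≤ _))
  where
  lemma : ∀ w → w + w + w + w ≡ 4 * w
  lemma = solve-∀

sumChoices-<⇒ : ∀ f w → sumChoices f < 4 * w → ∃[ o ] f o < w
sumChoices-<⇒ f w lt with f (false , false) ℕ.<? w | f (false , true) ℕ.<? w | f (true , false) ℕ.<? w | f (true , true) ℕ.<? w
... | yes p | _ | _ | _ = _ , p
... | no _ | yes p | _ | _ = _ , p
... | no _ | no _ | yes p | _ = _ , p
... | no _ | no _ | no _ | yes p = _ , p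
... | no p | no q | no r | no s = ⊥-elim (ℕ.<⇒≱ lt (subst (_≤ sumChoices f) (lemma w)
  (ℕ.+-mono-≤ (ℕ.+-mono-≤ (ℕ.+-mono-≤ (ℕ.≮⇒≥ p) (ℕ.≮⇒≥ q)) (ℕ.≮⇒≥ r)) (ℕ.≮⇒≥ s))))
  where
  lemma : ∀ w → w + w + w + w ≡ 4 * w
  lemma = solve-∀

sumChoices-≤₃ : ∀ f w → (∀ o → f o ≤ w) → ∀ o → f o ≡ 0 → sumChoices f ≤ 3 * w
sumChoices-≤₃ f w f≤ o f≡0 = ℕ.≤-trans (case₃ o f≡0) (ℕ.≤-reflexive (lemma w))
  where
  lemma : ∀ w → w + w + w ≡ 3 * w
  lemma = solve-∀
  three : ∀ {a b c} → a ≤ w → b ≤ w → c ≤ w → a + b + c ≤ w + w + w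
  three p q r = ℕ.+-mono-≤ (ℕ.+-mono-≤ p q) r
  case₃ : ∀ o → f o ≡ 0 → sumChoices f ≤ w + w + w
  case₃ (false , false) eq rewrite eq = three (f≤ _) (f≤ _) (f≤ _)
  case₃ (false , true)  eq rewrite eq | ℕ.+-identityʳ (f (false , false)) = three (f≤ _) (f≤ _) (f≤ _)
  case₃ (true , false)  eq rewrite eq | ℕ.+-identityʳ (f (false , false) + f (false , true)) = three (f≤ _) (f≤ _) (f≤ _)
  case₃ (true , true)   eq rewrite eq | ℕ.+-identityʳ (f (false , false) + f (false , true) + f (true , false)) = three (f≤ _) (f≤ _) (f≤ _)

-- weight V L is the number of restrictions of the cells V, or an upper bound
-- for it, that fix no literal of L to true.
weight : List Cell → List Literal → ℕ
weight []      L = 1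
weight (v ∷ V) L = (if does (mentions? L v) then 3 else 4) * weight V L

potential : List Cell → List (List Literal) → ℕ
potential V Ls = sum (map (weight V) Ls)

survivors : Cell → List (List Literal) → Choice → List (List Literal)
survivors v Ls o = filter (λ L → ¬? (kills? v o L)) Ls

-- A clause that mentions `v` is killed by the choice that matches one of its literals, so at most
-- three of the four choices keep its weight; other clauses may keep it under all four.
potential-survivors : ∀ v V Ls → sumChoices (λ o → potential V (survivors v Ls o)) ≤ potential (v ∷ V) Ls
potential-survivors v V []       = z≤n
potential-survivors v V (L ∷ Ls) = begin
  sumChoices (λ o → potential V (survivors v (L ∷ Ls) o))              ≤⟨ sumChoices-mono (λ o → potential V (survivors v (L ∷ Ls) o)) _ split ⟩
  sumChoices (λ o → alive o + potential V (survivors v Ls o))          ≡⟨ sumChoices-+ alive (λ o → potential V (survivors v Ls o)) ⟩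
  sumChoices alive + sumChoices (λ o → potential V (survivors v Ls o)) ≤⟨ ℕ.+-mono-≤ alive-≤ (potential-survivors v V Ls) ⟩
  potential (v ∷ V) (L ∷ Ls)                                           ∎
  where
  open ℕ.≤-Reasoning
  alive : Choice → ℕ
  alive o = if does (kills? v o L) then 0 else weight V L
  sumChoices-mono : ∀ f h → (∀ o → f o ≤ h o) → sumChoices f ≤ sumChoices h
  sumChoices-mono f h f≤h = ℕ.+-mono-≤ (ℕ.+-mono-≤ (ℕ.+-mono-≤ (f≤h _) (f≤h _)) (f≤h _)) (f≤h _)
  split : ∀ o → potential V (survivors v (L ∷ Ls) o) ≤ alive o + potential V (survivors v Ls o)
  split o with does (kills? v o L)
  ... | true  = ℕ.≤-refl
  ... | false = ℕ.≤-refl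
  alive-≤w : ∀ o → alive o ≤ weight V L
  alive-≤w o with does (kills? v o L)
  ... | true  = z≤n
  ... | false = ℕ.≤-refl
  alive-0 : ∀ o → Kills v o L → alive o ≡ 0
  alive-0 o k rewrite dec-true (kills? v o L) k = refl
  alive-≤ : sumChoices alive ≤ weight (v ∷ V) L
  alive-≤ with mentions? L v
  ... | no _  = sumChoices-≤ alive (weight V L) alive-≤w
  ... | yes m =
    let l , l∈ , eq = find m
        o = side (decode (var l)) , sign l
    in sumChoices-≤₃ alive (weight V L) alive-≤w o (alive-0 o (lose l∈ (eq , refl , refl)))

-- The method of conditional expectations: at each cell some choice is no worse than the average of
-- the four, so the potential of the surviving clauses stays below the number of restrictions left.
-- When no cell is left, it counts the survivors and is less than one.
choose : ∀ V → Unique V → ∀ Ls → potential V Ls < 4 ^ length V →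
  ∃[ ρ ] ∀ {L} → L ∈ Ls → ∃[ v ] v ∈ V × Kills v (ρ v) L
choose [] _ [] _ = (λ _ → false , false) , λ ()
choose [] _ (L ∷ Ls) (s≤s ())
choose (v ∷ V) (v∉ ∷ uniq) Ls lt =
  let o , lt′ = sumChoices-<⇒ (λ o → potential V (survivors v Ls o)) _ (ℕ.≤-<-trans (potential-survivors v V Ls) lt)
      ρ , kills = choose V uniq (survivors v Ls o) lt′
  in extend ρ o , extended ρ o kills
  where
  extend : Restriction → Choice → Restriction
  extend ρ o w = if does (w ≟ᴱ v) then o else ρ w
  extended : ∀ ρ o → (∀ {L} → L ∈ survivors v Ls o → ∃[ w ] w ∈ V × Kills w (ρ w) L) →
    ∀ {L} → L ∈ Ls → ∃[ w ] w ∈ v ∷ V × Kills w (extend ρ o w) L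
  extended ρ o kills {L} L∈ with kills? v o L
  ... | yes k = v , here refl , subst (λ o → Kills v o L) (sym at-v) k
    where
    at-v : extend ρ o v ≡ o
    at-v rewrite dec-true (v ≟ᴱ v) refl = refl
  ... | no ¬k with kills (∈-filter⁺ (λ L → ¬? (kills? v o L)) L∈ ¬k)
  ...   | w , w∈ , k = w , there w∈ , subst (λ o → Kills w o L) (sym at-w) k
    where
    at-w : extend ρ o w ≡ ρ w
    at-w rewrite dec-false (w ≟ᴱ v) (λ eq → All.lookup v∉ w∈ (sym eq)) = refl

weight-≤ : ∀ V L m → m ≤ length (mentioned V L) → weight V L * 4 ^ m ≤ 3 ^ m * 4 ^ length V
weight-≤ []      L zero    m≤ = s≤s z≤n
weight-≤ (v ∷ V) L m       m≤ with does (mentions? L v)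
weight-≤ (v ∷ V) L m       m≤ | false = begin
  4 * weight V L * 4 ^ m       ≡⟨ ℕ.*-assoc 4 (weight V L) _ ⟩
  4 * (weight V L * 4 ^ m)     ≤⟨ ℕ.*-monoʳ-≤ 4 (weight-≤ V L m m≤) ⟩
  4 * (3 ^ m * 4 ^ length V)   ≡⟨ lemma (3 ^ m) (4 ^ length V) ⟩
  3 ^ m * (4 * 4 ^ length V)   ∎
  where
  open ℕ.≤-Reasoning
  lemma : ∀ a b → 4 * (a * b) ≡ a * (4 * b)
  lemma = solve-∀
weight-≤ (v ∷ V) L zero    m≤ | true = begin
  3 * weight V L * 1           ≡⟨ lemma (weight V L) ⟩
  3 * (weight V L * 1)         ≤⟨ ℕ.*-mono-≤ (ℕ.n≤1+n 3) (weight-≤ V L 0 z≤n) ⟩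
  4 * (1 * 4 ^ length V)       ≡⟨ lemma′ (4 ^ length V) ⟩
  1 * (4 * 4 ^ length V)       ∎
  where
  open ℕ.≤-Reasoning
  lemma : ∀ a → 3 * a * 1 ≡ 3 * (a * 1)
  lemma = solve-∀
  lemma′ : ∀ a → 4 * (1 * a) ≡ 1 * (4 * a)
  lemma′ = solve-∀
weight-≤ (v ∷ V) L (suc m) (s≤s m≤) | true = begin
  3 * weight V L * (4 * 4 ^ m)       ≡⟨ lemma (weight V L) (4 ^ m) ⟩
  12 * (weight V L * 4 ^ m)          ≤⟨ ℕ.*-monoʳ-≤ 12 (weight-≤ V L m m≤) ⟩
  12 * (3 ^ m * 4 ^ length V)        ≡⟨ lemma′ (3 ^ m) (4 ^ length V) ⟩
  3 * 3 ^ m * (4 * 4 ^ length V)     ∎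
  where
  open ℕ.≤-Reasoning
  lemma : ∀ a b → 3 * a * (4 * b) ≡ 12 * (a * b)
  lemma = solve-∀
  lemma′ : ∀ a b → 12 * (a * b) ≡ 3 * a * (4 * b)
  lemma′ = solve-∀

potential-≤ : ∀ V m Ls → (∀ {L} → L ∈ Ls → m ≤ length (mentioned V L)) →
  potential V Ls * 4 ^ m ≤ length Ls * (3 ^ m * 4 ^ length V)
potential-≤ V m []       wide = z≤n
potential-≤ V m (L ∷ Ls) wide = begin
  (weight V L + potential V Ls) * 4 ^ m          ≡⟨ ℕ.*-distribʳ-+ (4 ^ m) (weight V L) _ ⟩
  weight V L * 4 ^ m + potential V Ls * 4 ^ m    ≤⟨ ℕ.+-mono-≤ (weight-≤ V L m (wide (here refl))) (potential-≤ V m Ls (wide ∘ there)) ⟩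
  length (L ∷ Ls) * (3 ^ m * 4 ^ length V)       ∎
  where open ℕ.≤-Reasoning

-- Three mentioned cells at least halve the fraction of bad restrictions, as 54 is at most 64; hence
-- the width threshold `3 * n`.
2*27≤64 : ∀ n → 2 ^ n * 27 ^ n ≤ 64 ^ n
2*27≤64 zero    = ℕ.≤-refl
2*27≤64 (suc n) = begin
  2 * 2 ^ n * (27 * 27 ^ n)  ≡⟨ lemma (2 ^ n) (27 ^ n) ⟩
  54 * (2 ^ n * 27 ^ n)      ≤⟨ ℕ.*-mono-≤ (ℕ.m≤m+n 54 10) (2*27≤64 n) ⟩
  64 * 64 ^ n                ∎
  where
  open ℕ.≤-Reasoning
  lemma : ∀ a b → 2 * a * (27 * b) ≡ 54 * (a * b)
  lemma = solve-∀

2*3³≤4³ : ∀ n → 2 ^ n * 3 ^ (3 * n) ≤ 4 ^ (3 * n)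
2*3³≤4³ n = subst₂ (λ a b → 2 ^ n * a ≤ b) (ℕ.^-*-assoc 3 3 n) (ℕ.^-*-assoc 4 3 n) (2*27≤64 n)

-- A union bound: fewer than `2 ^ n` wide clauses, each missed by at most a fraction 1/2^n of the
-- restrictions, are all satisfied by some restriction. A narrow clause is returned with the cells
-- that it mentions.
restriction : ∀ n (Ls : List (List Literal)) → length Ls < 2 ^ n → ∃[ ρ ] ∀ {L} → L ∈ Ls →
  (∃[ v ] Kills v (ρ v) L) ⊎ (∃[ T ] length T ≤ 3 * n × (∀ {l} → l ∈ L → cellOf l ∈ T))
restriction n Ls few = ρ , λ {L} L∈ → classify L∈ (wide? L)
  where
  open ℕ.≤-Reasoning
  V : List Cell
  V = deduplicate _≟ᴱ_ (concatMap (map cellOf) Ls)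
  wide? : ∀ L → Dec (3 * n ≤ length (mentioned V L))
  wide? L = 3 * n ℕ.≤? length (mentioned V L)
  wide : List (List Literal)
  wide = filter wide? Ls
  potential-< : potential V wide < 4 ^ length V
  potential-< = ℕ.*-cancelʳ-< (4 ^ (3 * n)) _ _ (begin-strict
    potential V wide * 4 ^ (3 * n)                ≤⟨ potential-≤ V (3 * n) wide (λ L∈ → proj₂ (∈-filter⁻ wide? {xs = Ls} L∈)) ⟩
    length wide * (3 ^ (3 * n) * 4 ^ length V)    ≤⟨ ℕ.*-monoˡ-≤ _ (length-filter wide? Ls) ⟩
    length Ls * (3 ^ (3 * n) * 4 ^ length V)      <⟨ ℕ.*-monoˡ-< _ {{ℕ.m*n≢0 _ _ {{ℕ.m^n≢0 3 (3 * n)}} {{ℕ.m^n≢0 4 (length V)}}}} few ⟩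
    2 ^ n * (3 ^ (3 * n) * 4 ^ length V)          ≡⟨ ℕ.*-assoc (2 ^ n) _ _ ⟨
    2 ^ n * 3 ^ (3 * n) * 4 ^ length V            ≤⟨ ℕ.*-monoˡ-≤ _ (2*3³≤4³ n) ⟩
    4 ^ (3 * n) * 4 ^ length V                    ≡⟨ ℕ.*-comm (4 ^ (3 * n)) _ ⟩
    4 ^ length V * 4 ^ (3 * n)                    ∎)
  chosen : ∃[ ρ ] ∀ {L} → L ∈ wide → ∃[ v ] v ∈ V × Kills v (ρ v) L
  chosen = choose V (DecUnique.deduplicate-! _≟ᴱ_ (concatMap (map cellOf) Ls)) wide potential-<
  ρ : Restriction
  ρ = proj₁ chosen
  classify : ∀ {L} → L ∈ Ls → Dec (3 * n ≤ length (mentioned V L)) →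
    (∃[ v ] Kills v (ρ v) L) ⊎ (∃[ T ] length T ≤ 3 * n × (∀ {l} → l ∈ L → cellOf l ∈ T))
  classify L∈ (yes w) = let v , _ , k = proj₂ chosen (∈-filter⁺ wide? L∈ w) in inj₁ (v , k)
  classify {L} L∈ (no ¬w) = inj₂ (mentioned V L , ℕ.<⇒≤ (ℕ.≰⇒> ¬w) , λ l∈ →
    ∈-filter⁺ (mentions? L)
      (∈-deduplicate⁺ _≟ᴱ_ (∈-concatMap⁺ (map cellOf) (lose L∈ (∈-map⁺ cellOf l∈))))
      (lose l∈ refl))

-- Balancing lines one at a time

-- An entry is owned by its row and by its column. Areas occur in no equation of the system, but
-- clauses of a proof may mention them; giving them to a row lets every cell be charged to some
-- line.
data Owns : Line → Cell → Set where
  owns-prefix   : ∀ {ℓ} k → Owns ℓ (prefix ℓ k)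
  owns-crossing : ∀ {ℓ} k → Owns ℓ (crossing ℓ k)
  owns-area     : ∀ {i} j → Owns (row i) (area i j)

owner : Cell → Line
owner (entry i j)  = row i
owner (prefix ℓ k) = ℓ
owner (area i j)   = row i

owns-owner : ∀ v → Owns (owner v) v
owns-owner (entry i j)  = owns-crossing j
owns-owner (prefix ℓ k) = owns-prefix k
owns-owner (area i j)   = owns-area j

crossLine : Line → ℕ → Line
crossLine (row i) = col
crossLine (col j) = row

crossing-≡ : ∀ ℓ m {i j} → crossing ℓ i ≡ crossing m j → ℓ ≡ m ⊎ ℓ ≡ crossLine m j
crossing-≡ (row i) (row j) refl = inj₁ refl
crossing-≡ (row i) (col j) refl = inj₂ refl
crossing-≡ (col i) (row j) refl = inj₂ refl
crossing-≡ (col i) (col j) refl = inj₁ refl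

crossing-injective : ∀ ℓ {i j} → crossing ℓ i ≡ crossing ℓ j → i ≡ j
crossing-injective (row _) refl = refl
crossing-injective (col _) refl = refl

crossLine-injective : ∀ ℓ {i j} → crossLine ℓ i ≡ crossLine ℓ j → i ≡ j
crossLine-injective (row _) refl = refl
crossLine-injective (col _) refl = refl

missing : ∀ (h : ℕ → Line) → (∀ {i j} → h i ≡ h j → i ≡ j) → ∀ g S → length S < g → ∃[ k ] k < g × h k ∉ S
missing h inj (suc g) S lt with Any.any? (h g ≟ᴺ_) S
... | no ∉S = g , ℕ.n<1+n g , ∉S
... | yes ∈S =
  let k , k<g , ∉ = missing h inj g S′ (ℕ.<-≤-trans (filter-notAll other? S (Any.map (λ e ¬e → ¬e e) ∈S)) (s≤s⁻¹ lt))
  in k , ℕ.m<n⇒m<1+n k<g , λ k∈ → ∉ (∈-filter⁺ other? k∈ λ e → ℕ.<-irrefl (sym (inj e)) k<g)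
  where
  other? : ∀ ℓ → Dec (h g ≢ ℓ)
  other? ℓ = ¬? (h g ≟ᴺ ℓ)
  S′ = filter other? S

partialSum : Valuation → Line → ℕ → Bool
partialSum f ℓ zero    = false
partialSum f ℓ (suc k) = partialSum f ℓ k xor f (crossing ℓ k)

module _ {f h : Valuation} {ℓ : Line} {j : ℕ} {δ : Bool}
         (same : ∀ k → k ≢ j → h (crossing ℓ k) ≡ f (crossing ℓ k))
         (flipped : h (crossing ℓ j) ≡ f (crossing ℓ j) xor δ) where

  partialSum-before : ∀ k → k ≤ j → partialSum h ℓ k ≡ partialSum f ℓ k
  partialSum-before zero    _   = refl
  partialSum-before (suc k) k<j = cong₂ _xor_ (partialSum-before k (ℕ.<⇒≤ k<j)) (same k (ℕ.<⇒≢ k<j))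

  partialSum-after : ∀ k → j < k → partialSum h ℓ k ≡ partialSum f ℓ k xor δ
  partialSum-after (suc k) (s≤s j≤k) with k ≟ j
  ... | yes refl = trans (cong₂ _xor_ (partialSum-before k ℕ.≤-refl) flipped)
                         (sym (Bool.xor-assoc (partialSum f ℓ k) (f (crossing ℓ k)) δ))
  ... | no k≢j   = begin
    partialSum h ℓ k xor h (crossing ℓ k)         ≡⟨ cong₂ _xor_ (partialSum-after k (ℕ.≤∧≢⇒< j≤k (k≢j ∘ sym))) (same k k≢j) ⟩
    (partialSum f ℓ k xor δ) xor f (crossing ℓ k) ≡⟨ Bool.xor-assoc (partialSum f ℓ k) δ _ ⟩
    partialSum f ℓ k xor (δ xor f (crossing ℓ k)) ≡⟨ cong (partialSum f ℓ k xor_) (Bool.xor-comm δ _) ⟩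
    partialSum f ℓ k xor (f (crossing ℓ k) xor δ) ≡⟨ Bool.xor-assoc (partialSum f ℓ k) _ δ ⟨
    partialSum f ℓ (suc k) xor δ                  ∎
    where open ≡-Reasoning

xor-cancel : ∀ a b → a xor (a xor b) ≡ b
xor-cancel false b = refl
xor-cancel true  b = Bool.not-involutive b

Agree : List Line → Valuation → Valuation → Set
Agree S f h = ∀ {ℓ v} → ℓ ∈ S → Owns ℓ v → h v ≡ f v

module Balancing (g : ℕ) where

  BalancedOn : List Line → Valuation → Set
  BalancedOn S f = ∀ {ℓ} → ℓ ∈ S → Balanced g f ℓ

  balanced-intro : ∀ {f ℓ} → f (prefix ℓ 0) ≡ false →
    (∀ k → f (prefix ℓ (suc k)) ≡ f (prefix ℓ k) xor f (crossing ℓ k)) →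
    f (prefix ℓ g) ≡ charge ℓ → Balanced g f ℓ
  balanced-intro start step end (here refl)         = trans (Bool.xor-identityʳ _) start
  balanced-intro start step end (there (here refl)) = trans (Bool.xor-identityʳ _) end
  balanced-intro {f} {ℓ} start step end (there (there e∈)) with ∈-map⁻ (stepEquation ℓ) e∈
  ... | k , _ , refl = xor-unsolve₃ _ (f (prefix ℓ k)) (f (crossing ℓ k)) (step k)

  equation-owned : ∀ {ℓ e v} → e ∈ lineEquations g ℓ → v ∈ proj₁ e → Owns ℓ v
  equation-owned (here refl) (here refl) = owns-prefix 0
  equation-owned (there (here refl)) (here refl) = owns-prefix g
  equation-owned {ℓ} (there (there e∈)) v∈ with ∈-map⁻ (stepEquation ℓ) e∈
  equation-owned (there (there e∈)) (here refl)                 | k , _ , refl = owns-prefix (suc k)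
  equation-owned (there (there e∈)) (there (here refl))         | k , _ , refl = owns-prefix k
  equation-owned (there (there e∈)) (there (there (here refl))) | k , _ , refl = owns-crossing k

  total-cong : ∀ {f h} vs → (∀ {v} → v ∈ vs → h v ≡ f v) → total h vs ≡ total f vs
  total-cong []       eq = refl
  total-cong (v ∷ vs) eq = cong₂ _xor_ (eq (here refl)) (total-cong vs (eq ∘ there))

  balanced-agree : ∀ {f h ℓ} → Balanced g f ℓ → (∀ {v} → Owns ℓ v → h v ≡ f v) → Balanced g h ℓ
  balanced-agree bal eq {e} e∈ = trans (total-cong (proj₁ e) (λ v∈ → eq (equation-owned e∈ v∈))) (bal e∈)

  -- The entry at which ℓ meets a line outside S can be changed at will.
  module Rebalance (f : Valuation) (S : List Line) (ℓ : Line) (ℓ∉S : ℓ ∉ S)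
                   (j : ℕ) (j<g : j < g) (m∉S : crossLine ℓ j ∉ S) where

    -- The defect of `ℓ`: adding it to one entry corrects the sum, and changes nothing if the sum is
    -- already right.
    δ : Bool
    δ = partialSum f ℓ g xor charge ℓ

    toggle : Valuation
    toggle v = if does (v ≟ᴱ crossing ℓ j) then f v xor δ else f v

    -- The prefixes of `ℓ` are recomputed, so its start and step equations hold by construction and
    -- only the end equation depends on the toggled entry.
    rebalanced : Valuation
    rebalanced (prefix m k) = if does (m ≟ᴺ ℓ) then partialSum toggle ℓ k else f (prefix m k)
    rebalanced v            = toggle v

    toggle-same : ∀ {v} → v ≢ crossing ℓ j → toggle v ≡ f v
    toggle-same {v} v≢ rewrite dec-false (v ≟ᴱ crossing ℓ j) v≢ = refl

    toggle-flipped : toggle (crossing ℓ j) ≡ f (crossing ℓ j) xor δ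
    toggle-flipped rewrite dec-true (crossing ℓ j ≟ᴱ crossing ℓ j) refl = refl

    rebalanced-crossing : ∀ m k → rebalanced (crossing m k) ≡ toggle (crossing m k)
    rebalanced-crossing (row i) k = refl
    rebalanced-crossing (col i) k = refl

    rebalanced-prefix : ∀ k → rebalanced (prefix ℓ k) ≡ partialSum toggle ℓ k
    rebalanced-prefix k rewrite dec-true (ℓ ≟ᴺ ℓ) refl = refl

    agree : Agree S f rebalanced
    agree {m} m∈ (owns-prefix k)
      rewrite dec-false (m ≟ᴺ ℓ) (λ eq → ℓ∉S (subst (_∈ S) eq m∈)) = refl
    agree {m} m∈ (owns-crossing k) = trans (rebalanced-crossing m k) (toggle-same ne)
      where
      ne : crossing m k ≢ crossing ℓ j
      ne eq with crossing-≡ m ℓ eq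
      ... | inj₁ refl = ℓ∉S m∈
      ... | inj₂ refl = m∉S m∈
    agree m∈ (owns-area {i} k) = toggle-same (ne ℓ)
      where
      ne : ∀ ℓ → area i k ≢ crossing ℓ j
      ne (row _) ()
      ne (col _) ()

    balanced : Balanced g rebalanced ℓ
    balanced = balanced-intro (rebalanced-prefix 0)
      (λ k → trans (rebalanced-prefix (suc k))
        (sym (cong₂ _xor_ (rebalanced-prefix k) (rebalanced-crossing ℓ k))))
      (begin
        rebalanced (prefix ℓ g)    ≡⟨ rebalanced-prefix g ⟩
        partialSum toggle ℓ g      ≡⟨ partialSum-after (λ k k≢j → toggle-same (k≢j ∘ crossing-injective ℓ)) toggle-flipped g j<g ⟩
        partialSum f ℓ g xor δ     ≡⟨ xor-cancel (partialSum f ℓ g) (charge ℓ) ⟩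
        charge ℓ                   ∎)
      where open ≡-Reasoning

  -- Of the `g` lines that cross `ℓ`, one is outside the shorter list `S`; the entry where it meets
  -- `ℓ` is then owned by no line of `S`.
  balance-line : ∀ S ℓ {f} → BalancedOn S f → length S < g →
    ∃[ h ] BalancedOn (ℓ ∷ S) h × Agree S f h
  balance-line S ℓ {f} bal lt with Any.any? (ℓ ≟ᴺ_) S
  ... | yes ℓ∈ = f , (λ { (here refl) → bal ℓ∈ ; (there m∈) → bal m∈ }) , λ _ _ → refl
  ... | no  ℓ∉ with missing (crossLine ℓ) (crossLine-injective ℓ) g S lt
  ...   | j , j<g , m∉ = rebalanced , bal′ , agree
    where
    open Rebalance f S ℓ ℓ∉ j j<g m∉
    bal′ : BalancedOn (ℓ ∷ S) rebalanced
    bal′ (here refl) = balanced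
    bal′ (there m∈)  = balanced-agree (bal m∈) (agree m∈)

  balance : ∀ T S {f} → BalancedOn S f → length T + length S ≤ g →
    ∃[ h ] BalancedOn (T ++ S) h × Agree S f h
  balance []      S bal lt = _ , bal , λ _ _ → refl
  balance (ℓ ∷ T) S bal lt =
    let f₁ , bal₁ , agree₁ = balance T S bal (ℕ.<⇒≤ lt)
        f₂ , bal₂ , agree₂ = balance-line (T ++ S) ℓ bal₁ (subst (_< g) (sym (length-++ T)) lt)
    in f₂ , bal₂ , λ m∈ o → trans (agree₂ (∈-++⁺ʳ T m∈) o) (agree₁ m∈ o)

-- Valuations under a restriction

-- The free variable of a cell compensates for the fixed one, so the cell gets the value `f v` under
-- every `ρ`. The twin flag is ignored, which gives twins equal values.
assign : Restriction → Valuation → Assignment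
assign ρ f x =
  let symbol v c _ = decode x
      c′ , b       = ρ v
  in if does (c Bool.≟ c′) then b else f v xor b

decode-partner : ∀ x → decode (partner x) ≡ flip (decode x)
decode-partner x = decode-name (flip (decode x))

assign-partner : ∀ ρ f x → assign ρ f (partner x) ≡ assign ρ f x
assign-partner ρ f x rewrite decode-partner x = refl

assign-mirror : ∀ ρ f l → eval (assign ρ f) (mirror l) ≡ eval (assign ρ f) l
assign-mirror ρ f (pos x) = assign-partner ρ f x
assign-mirror ρ f (neg x) = cong not (assign-partner ρ f x)

cellOf-mirror : ∀ l → cellOf (mirror l) ≡ cellOf l
cellOf-mirror (pos x) = cong cell (decode-partner x)
cellOf-mirror (neg x) = cong cell (decode-partner x)

cellOf-compl : ∀ l → cellOf (compl l) ≡ cellOf l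
cellOf-compl l = cong (cell ∘ decode) (var-compl l)

value-assign : ∀ ρ f v → value (assign ρ f) v ≡ f v
value-assign ρ f v
  rewrite decode-name (symbol v false false) | decode-name (symbol v true false) with ρ v
... | false , b = trans (cong (b xor_) (Bool.xor-comm (f v) b)) (xor-cancel b (f v))
... | true  , b = trans (Bool.xor-comm (f v xor b) b) (trans (cong (b xor_) (Bool.xor-comm (f v) b)) (xor-cancel b (f v)))

assign-cong : ∀ ρ f h l → h (cellOf l) ≡ f (cellOf l) → eval (assign ρ h) l ≡ eval (assign ρ f) l
assign-cong ρ f h (pos x) eq rewrite eq = refl
assign-cong ρ f h (neg x) eq rewrite eq = refl

kills⇒⊨ : ∀ ρ {v L} → Kills v (ρ v) L → ∀ f → assign ρ f ⊨ L
kills⇒⊨ ρ {v} k f = Any.map (λ {l} → fixes l) k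
  where
  fixes : ∀ l → Fixes v (ρ v) l → eval (assign ρ f) l ≡ true
  fixes (pos x) (refl , s , b) rewrite dec-true (side (decode x) Bool.≟ proj₁ (ρ v)) s = sym b
  fixes (neg x) (refl , s , b) rewrite dec-true (side (decode x) Bool.≟ proj₁ (ρ v)) s = cong not (sym b)

-- The lower bound

derived : ∀ {R Γ} → Refutation R Γ → List (List Literal)
derived (stop _)    = []
derived (add C _ Π) = lits C ∷ derived Π

size-derived : ∀ {R Γ} (Π : Refutation R Γ) → size Π ≡ suc (length (derived Π))
size-derived (stop _)    = refl
size-derived (add _ _ Π) = cong suc (size-derived Π)

⊆-final : ∀ {R Γ} (Π : Refutation R Γ) → Γ ⊆ final Π
⊆-final (stop _)    = id
⊆-final (add _ _ Π) = ⊆-final Π ∘ there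

HasTwin : CNF → Literal → Set
HasTwin Γ p = ∃[ D ] D ∈ Γ × compl p ∈ lits D × (∀ {l} → l ∈ lits D → l ≡ compl p ⊎ l ≡ mirror p)

-- `w` bounds the lines behind one clause. A resolution step balances the lines of two premises and
-- of the conclusion; a unit propagation step those of a clause, of a unit and of the clause whose
-- RAT property is tested. Hence `w + w + w ≤ g`.
module Adversary (g w : ℕ) (1≤w : 1 ≤ w) (3w≤g : w + w + w ≤ g) (ρ : Restriction) where

  open Balancing g

  Covers : List Line → List Literal → Set
  Covers S L = ∀ {l} → l ∈ L → ∃[ ℓ ] ℓ ∈ S × Owns ℓ (cellOf l)

  -- A part of L that mentions few lines follows from the balance of few lines,
  -- given that the lines of S₀ are balanced and their cells valued as in f₀.
  record Implied (S₀ : List Line) (f₀ : Valuation) (L : List Literal) : Set where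
    constructor implied
    field
      core   : List Literal
      core⊆  : core ⊆ L
      T      : List Line
      small  : length T ≤ w
      covers : Covers (T ++ S₀) core
      sat    : ∀ {f} → Agree S₀ f₀ f → BalancedOn (T ++ S₀) f → assign ρ f ⊨ core

  -- The purpose of `core`: weakening and padding may bring in any number of lines, but leave the
  -- core as it is.
  implied-⊆ : ∀ {S f L M} → L ⊆ M → Implied S f L → Implied S f M
  implied-⊆ L⊆M (implied core core⊆ T small covers sat) = implied core (L⊆M ∘ core⊆) T small covers sat

  -- The cells of `L` have the same values under both valuations. So a valuation can be balanced on
  -- further lines for the sake of an argument, and the conclusion pulled back.
  agree-⊨ : ∀ {S f h L} → Agree S f h → Covers S L → assign ρ h ⊨ L → assign ρ f ⊨ L
  agree-⊨ {f = f} {h} agree covers sat =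
    let l , l∈ , t = find sat
        ℓ , ℓ∈ , o = covers l∈
    in lose l∈ (trans (sym (assign-cong ρ f h l (agree ℓ∈ o))) t)

  agree-trans : ∀ {S T f h k} → (∀ {ℓ} → ℓ ∈ S → ℓ ∈ T) → Agree S f h → Agree T h k → Agree S f k
  agree-trans S⊆T fh hk ℓ∈ o = trans (hk (S⊆T ℓ∈) o) (fh ℓ∈ o)

  length-++-≤ : ∀ {a b} (S T : List Line) → length S ≤ a → length T ≤ b → length (S ++ T) ≤ a + b
  length-++-≤ S T p q = subst (_≤ _) (sym (length-++ S)) (ℕ.+-mono-≤ p q)

  no-contradiction : ∀ {S f} → length S ≤ w → BalancedOn S f → ¬ Implied S f []
  no-contradiction {S} S≤w bal (implied core core⊆ T small covers sat) =
    let h , bal′ , agree = balance T S bal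
          (ℕ.≤-trans (ℕ.+-mono-≤ small S≤w) (ℕ.≤-trans (ℕ.m≤m+n (w + w) w) 3w≤g))
    in case find (⊨-⊆ core⊆ (sat agree bal′)) of λ { (_ , () , _) }

  -- The lines `U` of the unit can be balanced after those of `T` and `S`, without touching them.
  -- There `p` is true, so another literal of the core is, and it was already true before. The
  -- conclusion thus keeps the same `T`, and its size does not grow along a propagation.
  unit-step : ∀ {S f L M} p → length S ≤ w → Implied S f (p ∷ []) → Implied S f L →
    without (compl p) L ⊆ M → Implied S f M
  unit-step {S} {f} p S≤w (implied uc uc⊆ U U≤w _ usat) (implied core core⊆ T T≤w covers sat) L⊆M =
    implied (without (compl p) core)
      (λ l∈ → let l∈′ , l≢ = ∈-without⁻ {compl p} {L = core} l∈ in L⊆M (∈-without⁺ (core⊆ l∈′) l≢))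
      T T≤w (λ l∈ → covers (proj₁ (∈-without⁻ {compl p} {L = core} l∈))) sat′
    where
    sat′ : ∀ {h} → Agree S f h → BalancedOn (T ++ S) h → assign ρ h ⊨ without (compl p) core
    sat′ {h} fh bal with balance U (T ++ S) bal
          (ℕ.≤-trans (ℕ.+-mono-≤ U≤w (length-++-≤ T S T≤w S≤w)) (subst (_≤ g) (ℕ.+-assoc w w w) 3w≤g))
    ... | k , bal′ , hk = agree-⊨ hk (λ l∈ → covers (proj₁ (∈-without⁻ {compl p} {L = core} l∈))) (reduce (find (sat fk balTS)))
      where
      fk : Agree S f k
      fk = agree-trans (∈-++⁺ʳ T) fh hk
      balTS : BalancedOn (T ++ S) k
      balTS = bal′ ∘ ∈-++⁺ʳ U
      balUS : BalancedOn (U ++ S) k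
      balUS ℓ∈ with ∈-++⁻ U ℓ∈
      ... | inj₁ ℓ∈U = bal′ (∈-++⁺ˡ ℓ∈U)
      ... | inj₂ ℓ∈S = balTS (∈-++⁺ʳ T ℓ∈S)
      p-true : eval (assign ρ k) p ≡ true
      p-true with find (⊨-⊆ uc⊆ (usat fk balUS))
      ... | _ , here refl , t = t
      reduce : (∃[ l ] l ∈ core × eval (assign ρ k) l ≡ true) → assign ρ k ⊨ without (compl p) core
      reduce (l , l∈ , t) = lose (∈-without⁺ l∈ λ { refl → ⊨-compl {l = p} p-true t }) t

  implied-∈ : ∀ {S f Γ L} → (∀ {C} → C ∈ Γ → Implied S f (lits C)) → L ∈ˡ Γ → Implied S f L
  implied-∈ all L∈ = let C , C∈ , _ , C⊆L = find-∈ᶜ L∈ in implied-⊆ C⊆L (all C∈)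

  unit-propagation-step : ∀ {S f Γ E} → length S ≤ w → (∀ {C} → C ∈ Γ → Implied S f (lits C)) →
    UnitPropagationRule Γ E → Implied S f (lits E)
  unit-propagation-step S≤w all (weaken C∈ C⊆E) = implied-⊆ C⊆E (implied-∈ all C∈)
  unit-propagation-step S≤w all (resolve {C} {D} C∈ D∈ (inj₁ (q , C⊆q , _)) res) =
    unit-step (pos x) S≤w (implied-⊆ C⊆p (implied-∈ all C∈)) (implied-∈ all D∈) D⊆E
    where
    open Resolvent res
    C⊆p : lits C ⊆ pos x ∷ []
    C⊆p l∈ with C⊆q l∈ | C⊆q (head∈ left)
    ... | here eq | here eq′ = here (trans eq (sym eq′))
    D⊆E : without (neg x) (lits D) ⊆ _
    D⊆E l∈ with ∈-without⁻ {neg x} {L = lits D} l∈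
    ... | l∈D , l≢ with head∨tail right l∈D
    ...   | inj₁ eq  = ⊥-elim (l≢ eq)
    ...   | inj₂ l∈B = proj₂ union (∈-++⁺ʳ A l∈B)
  unit-propagation-step S≤w all (resolve {C} {D} C∈ D∈ (inj₂ (q , D⊆q , _)) res) =
    unit-step (neg x) S≤w (implied-⊆ D⊆p (implied-∈ all D∈)) (implied-∈ all C∈) C⊆E
    where
    open Resolvent res
    D⊆p : lits D ⊆ neg x ∷ []
    D⊆p l∈ with D⊆q l∈ | D⊆q (head∈ right)
    ... | here eq | here eq′ = here (trans eq (sym eq′))
    C⊆E : without (pos x) (lits C) ⊆ _
    C⊆E l∈ with ∈-without⁻ {pos x} {L = lits C} l∈
    ... | l∈C , l≢ with head∨tail left l∈C
    ...   | inj₁ eq  = ⊥-elim (l≢ eq)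
    ...   | inj₂ l∈A = proj₂ union (∈-++⁺ˡ l∈A)

  unit-propagation-fails : ∀ {S f Γ} → length S ≤ w → BalancedOn S f →
    (∀ {C} → C ∈ Γ → Implied S f (lits C)) → ¬ Refutation UnitPropagationRule Γ
  unit-propagation-fails S≤w bal all (stop ⊥∈) = no-contradiction S≤w bal (implied-∈ all ⊥∈)
  unit-propagation-fails S≤w bal all (add C r Π) =
    unit-propagation-fails S≤w bal (λ { (here refl) → unit-propagation-step S≤w all r ; (there C∈) → all C∈ }) Π

  -- A default value: agreement on the empty list of lines is vacuous.
  f₀ : Valuation
  f₀ _ = false

  Entailed : List Literal → Set
  Entailed = Implied [] f₀

  Tractable : List Literal → Set
  Tractable L = (∃[ v ] Kills v (ρ v) L) ⊎ (∃[ vs ] length vs ≤ w × (∀ {l} → l ∈ L → cellOf l ∈ vs))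

  -- Clauses satisfied by ρ are entailed by one of their literals; the others
  -- mention few lines.
  tractable-entailed : ∀ {L} → Tractable L →
    (∀ {T} → length T ≤ w → Covers T L → (∀ {f} → BalancedOn T f → assign ρ f ⊨ L)) → Entailed L
  tractable-entailed {L} (inj₁ (v , k)) _ =
    let l , l∈ , fixes = find k
    in implied (l ∷ []) (λ { (here refl) → l∈ }) (owner (cellOf l) ∷ []) 1≤w
         (λ { (here refl) → _ , here refl , owns-owner (cellOf l) })
         λ {f} _ _ → kills⇒⊨ ρ {v} (here fixes) f
  tractable-entailed {L} (inj₂ (vs , vs≤w , ∈vs)) sat =
    implied L id (map owner vs) small covers λ _ bal → sat small covers′ (bal ∘ ∈-++⁺ˡ)
    where
    small : length (map owner vs) ≤ w
    small = subst (_≤ w) (sym (length-map owner vs)) vs≤w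
    covers′ : Covers (map owner vs) L
    covers′ l∈ = _ , ∈-map⁺ owner (∈vs l∈) , owns-owner _
    covers : Covers (map owner vs ++ []) L
    covers l∈ = let ℓ , ℓ∈ , o = covers′ l∈ in ℓ , ∈-++⁺ˡ ℓ∈ , o

  -- The premises together may depend on `w + w` lines, so the bound for the resolvent has to come
  -- from its being satisfied by `ρ` or narrow. If it is narrow, its own lines `S` are balanced
  -- first, those of the premises are added, and the truth of `E` is pulled back to `S`.
  resolution-step : ∀ {Γ E} → (∀ {C} → C ∈ Γ → Entailed (lits C)) → Tractable (lits E) →
    ResolutionRule Γ E → Entailed (lits E)
  resolution-step all tractable (weaken C∈ C⊆E) = implied-⊆ C⊆E (implied-∈ all C∈)
  resolution-step {E = E} all tractable (resolve {C} {D} C∈ D∈ res)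
    with implied-∈ all C∈ | implied-∈ all D∈
  ... | implied c c⊆ T T≤w _ csat | implied d d⊆ U U≤w _ dsat = tractable-entailed tractable sat
    where
    open Resolvent res
    sat : ∀ {S} → length S ≤ w → Covers S (lits E) → ∀ {f} → BalancedOn S f → assign ρ f ⊨ lits E
    sat {S} S≤w covers {f} bal with balance (T ++ U) S bal
          (ℕ.≤-trans (ℕ.+-mono-≤ (length-++-≤ T U T≤w U≤w) S≤w) 3w≤g)
    ... | h , bal′ , fh = agree-⊨ fh covers
            (resolvent (find (⊨-⊆ c⊆ (csat (λ ()) balT))) (find (⊨-⊆ d⊆ (dsat (λ ()) balU))))
      where
      balT : BalancedOn (T ++ []) h
      balT ℓ∈ with ∈-++⁻ T ℓ∈
      ... | inj₁ ℓ∈T = bal′ (∈-++⁺ˡ (∈-++⁺ˡ ℓ∈T))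
      balU : BalancedOn (U ++ []) h
      balU ℓ∈ with ∈-++⁻ U ℓ∈
      ... | inj₁ ℓ∈U = bal′ (∈-++⁺ˡ (∈-++⁺ʳ T ℓ∈U))
      resolvent : (∃[ l ] l ∈ lits C × eval (assign ρ h) l ≡ true) →
        (∃[ l ] l ∈ lits D × eval (assign ρ h) l ≡ true) → assign ρ h ⊨ lits E
      resolvent (l , l∈ , t) (m , m∈ , u) with head∨tail left l∈ | head∨tail right m∈
      ... | inj₂ l∈A | _         = lose (proj₂ union (∈-++⁺ˡ l∈A)) t
      ... | inj₁ _   | inj₂ m∈B  = lose (proj₂ union (∈-++⁺ʳ A m∈B)) u
      ... | inj₁ refl | inj₁ refl = ⊥-elim (⊨-compl {assign ρ h} {pos x} t u)

  resolution-fails : ∀ {Γ} (Π : Refutation ResolutionRule Γ) → (∀ {C} → C ∈ Γ → Entailed (lits C)) →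
    ¬ (∀ {L} → L ∈ derived Π → Tractable L)
  resolution-fails (stop ⊥∈) all _ = no-contradiction z≤n (λ ()) (implied-∈ all ⊥∈)
  resolution-fails (add C r Π) all tractable =
    resolution-fails Π (λ { (here refl) → resolution-step all (tractable (here refl)) r ; (there C∈) → all C∈ })
      (tractable ∘ there)

  -- When the twin of p is equivalent to p, the unit propagation that makes
  -- p ∪ C′ a RAT already shows that C′ ∪ {twin of p} is entailed.
  rat-step : ∀ {Γ E p} → (∀ {C} → C ∈ Γ → Entailed (lits C)) → Tractable (lits E) →
    HasTwin Γ p → IsRATFor Γ E p → Entailed (lits E)
  rat-step {Γ} {E} {p} all tractable (D , D∈ , p̄∈ , D⊆) (E′ , split , propagates) =
    tractable-entailed tractable sat
    where
    D′ : List Literal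
    D′ = without (compl p) (lits D)
    sat : ∀ {S} → length S ≤ w → Covers S (lits E) → ∀ {f} → BalancedOn S f → assign ρ f ⊨ lits E
    sat {S} S≤w covers {f} bal with assign ρ f ⊨? lits E
    ... | yes sat = sat
    -- If `E` is false, so is the twin of `p`, and hence all of `E′ ++ D′`; then every initial
    -- clause of the propagation is implied relative to `S` and `f`.
    ... | no ⊭E = ⊥-elim (unit-propagation-fails S≤w bal local
                    (propagates D D′ (∈⇒∈ᶜ D∈) (≈-without D p̄∈)))
      where
      falsified : ∀ {l} → l ∈ E′ ++ D′ → eval (assign ρ f) l ≡ false × (∃[ ℓ ] ℓ ∈ S × Owns ℓ (cellOf l))
      falsified l∈ with ∈-++⁻ E′ l∈
      ... | inj₁ l∈E′ = ⊭⇒false ⊭E (tail⊆ split l∈E′) , covers (tail⊆ split l∈E′)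
      ... | inj₂ l∈D′ with ∈-without⁻ {compl p} {L = lits D} l∈D′
      ...   | l∈D , l≢ with D⊆ l∈D
      ...     | inj₁ eq   = ⊥-elim (l≢ eq)
      ...     | inj₂ refl =
        trans (assign-mirror ρ f p) (⊭⇒false ⊭E (head∈ split)) ,
        subst (λ v → ∃[ ℓ ] ℓ ∈ S × Owns ℓ v) (sym (cellOf-mirror p)) (covers (head∈ split))
      local : ∀ {C} → C ∈ Γ ++ map (λ l → unit (compl l)) (E′ ++ D′) → Implied S f (lits C)
      local C∈ with ∈-++⁻ Γ C∈
      ... | inj₁ C∈Γ =
        let implied core core⊆ T T≤w covers sat = all C∈Γ
        in implied core core⊆ T T≤w
             (λ l∈ → let ℓ , ℓ∈ , o = covers l∈ in ℓ , [ ∈-++⁺ˡ , (λ ()) ]′ (∈-++⁻ T ℓ∈) , o)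
             (λ _ bal → sat (λ ()) (λ ℓ∈ → bal ([ ∈-++⁺ˡ , (λ ()) ]′ (∈-++⁻ T ℓ∈))))
      ... | inj₂ C∈U with ∈-map⁻ (λ l → unit (compl l)) C∈U
      ...   | l , l∈ , refl with falsified l∈
      ...     | l-false , ℓ , ℓ∈ , o =
        -- The added units speak of cells owned by `S`, where the values of `f` are kept, and so
        -- involve no further lines.
        implied (compl l ∷ []) id [] z≤n
          (λ { (here refl) → ℓ , ℓ∈ , subst (Owns ℓ) (sym (cellOf-compl l)) o })
          (λ {h} fh _ → here (trans (eval-compl (assign ρ h) l)
            (cong not (trans (assign-cong ρ f h l (fh ℓ∈ o)) l-false))))

  rat-fails : ∀ {Γ} (Π : Refutation RATRule Γ) → (∀ {C} → C ∈ Γ → Entailed (lits C)) →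
    (∀ {p} → var p ∈ vars (final Π) → HasTwin Γ p) → ¬ (∀ {L} → L ∈ derived Π → Tractable L)
  rat-fails (stop ⊥∈) all _ _ = no-contradiction z≤n (λ ()) (implied-∈ all ⊥∈)
  rat-fails {Γ} (add C r Π) all hasTwin tractable =
    rat-fails Π (λ { (here refl) → entailed r ; (there C∈) → all C∈ })
      (λ v∈ → let D , D∈ , rest = hasTwin v∈ in D , there D∈ , rest) (tractable ∘ there)
    where
    entailed : RATRule Γ C → Entailed (lits C)
    entailed (resolution r)    = resolution-step all (tractable (here refl)) r
    entailed (rat (p , isRAT)) = rat-step {p = p} all (tractable (here refl))
      (hasTwin (∈-vars⁺ (⊆-final Π (here refl)) (head∈ (proj₁ (proj₂ isRAT))))) isRAT

  formula-entailed : ∀ {C} → C ∈ formula g → Entailed (lits C)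
  formula-entailed {C} C∈ with formula⁻ g C∈
  ... | ℓ , e , _ , e∈ , C∈e = implied _ id (ℓ ∷ []) 1≤w covers
          λ {f} _ bal → encode-complete {assign ρ f} e
            (trans (total-cong (proj₁ e) (λ {v} _ → value-assign ρ f v)) (bal (here refl) e∈)) C∈e
    where
    covers : Covers (ℓ ∷ []) (lits C)
    covers l∈ with ∈-cellVars⁻ (proj₁ e) (encode-vars e C∈e l∈)
    ... | v , c , v∈ , eq = ℓ , here refl ,
            subst (Owns ℓ) (sym (trans (cong (cell ∘ decode) eq) (cong cell (decode-name (symbol v c false)))))
              (equation-owned e∈ v∈)

  pad-entailed : ∀ {W C} → C ∈ pad (formula g) W → Entailed (lits C)
  pad-entailed {W} C∈ with pad⁻ (formula g) W C∈
  ... | original C∈F = formula-entailed C∈F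
  ... | weakened l D∈ _ eq = implied-⊆ (λ l∈ → subst (_ ∈_) (sym eq) (there l∈)) (formula-entailed D∈)

  twin-entailed : ∀ {C} → IsTwin C → Entailed (lits C)
  twin-entailed {C} (is-twin l pl eq) = subst Entailed (sym eq)
    (implied (twinPair l) id (owner (cellOf l) ∷ []) 1≤w covers λ {f} _ _ → sat f)
    where
    covers : Covers (owner (cellOf l) ∷ []) (twinPair l)
    covers (here refl)         = _ , here refl , subst (Owns _) (sym (cellOf-compl l)) (owns-owner _)
    covers (there (here refl)) = _ , here refl , subst (Owns _) (sym (cellOf-mirror l)) (owns-owner _)
    sat : ∀ f → assign ρ f ⊨ twinPair l
    sat f with eval (assign ρ f) l in t
    ... | true  = there (here (trans (assign-mirror ρ f l) t))
    ... | false = here (trans (eval-compl (assign ρ f) l) (cong not t))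

-- The two families

matrixCells areaCells allCells : ℕ → List Cell
matrixCells g = concatMap proj₁ (system g)
areaCells g   = concatMap (λ i → map (area i) (upTo (suc g))) (upTo (suc g))
allCells g    = matrixCells g ++ areaCells g

matrixVars allVars : ℕ → List Var
matrixVars g = cellVars (matrixCells g)
allVars g    = cellVars (allCells g)

-- Padding by all variables brings the areas into the vocabulary and at the same time prevents every
-- clause over it from being blocked.
paddedFormula : ℕ → CNF
paddedFormula g = pad (formula g) (allVars g)

-- Padding uses the matrix variables only: the areas occur in twin clauses alone, and once these are
-- removed the definitions of the areas are blocked.
twinnedFormula : ℕ → CNF
twinnedFormula g = pad (formula g) (matrixVars g) ++ twins (allVars g)

area∈ : ∀ {g i j} → i ≤ g → j ≤ g → area i j ∈ allCells g
area∈ {g} {i} i≤g j≤g = ∈-++⁺ʳ (matrixCells g)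
  (∈-concatMap⁺ (λ i → map (area i) (upTo (suc g)))
    (lose (∈-upTo⁺ (s≤s i≤g)) (∈-map⁺ (area i) (∈-upTo⁺ (s≤s j≤g)))))

matrixCell∈ : ∀ g {e v} → e ∈ system g → v ∈ proj₁ e → v ∈ matrixCells g
matrixCell∈ g e∈ v∈ = ∈-concatMap⁺ proj₁ (lose e∈ v∈)

cellVars-⊆ : ∀ {vs ws} → vs ⊆ ws → cellVars vs ⊆ cellVars ws
cellVars-⊆ {vs} vs⊆ws x∈ with ∈-cellVars⁻ vs x∈
... | v , c , v∈ , refl = ∈-cellVars⁺ c (vs⊆ws v∈)

matrixVars⊆allVars : ∀ g → matrixVars g ⊆ allVars g
matrixVars⊆allVars g = cellVars-⊆ {matrixCells g} ∈-++⁺ˡ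

vars-formula⊆ : ∀ g → vars (formula g) ⊆ matrixVars g
vars-formula⊆ g x∈ with ∈-vars⁻ (formula g) x∈
... | C , l , C∈ , l∈ , refl with formula⁻ g C∈
...   | ℓ , e , ℓ∈ , e∈ , C∈e =
  cellVars-⊆ {proj₁ e} (matrixCell∈ g (system⁺ {g} ℓ∈ e∈)) (encode-vars e C∈e l∈)

plain-∈ : ∀ vs {x} → x ∈ cellVars vs → Plain x
plain-∈ vs x∈ with ∈-cellVars⁻ vs x∈
... | v , c , _ , eq = v , c , eq

-- Exponential lower bounds

3n+3n+3n≤9n : ∀ n → 3 * n + 3 * n + 3 * n ≤ 9 * n
3n+3n+3n≤9n n = ℕ.≤-reflexive (lemma n)
  where
  lemma : ∀ n → 3 * n + 3 * n + 3 * n ≡ 9 * n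
  lemma = solve-∀

module _ (n : ℕ) (1≤n : 1 ≤ n) where

  private
    g : ℕ
    g = 9 * n

    1≤g : 1 ≤ g
    1≤g = ℕ.≤-trans 1≤n (ℕ.m≤n*m n 9)

    module Play (ρ : Restriction) =
      Adversary g (3 * n) (ℕ.≤-trans 1≤n (ℕ.m≤n*m n 3)) (3n+3n+3n≤9n n) ρ

    few-derived : ∀ {R Γ} (Π : Refutation R Γ) → size Π < 2 ^ n → length (derived Π) < 2 ^ n
    few-derived Π lt = ℕ.<-trans (ℕ.n<1+n _) (subst (_< 2 ^ n) (size-derived Π) lt)

  unsatisfiable : ∀ α → ¬ (α ⊨ᶜ formula g)
  unsatisfiable α = formula-unsatisfiable g α 1≤g

  -- The clauses of `Λ` already belong to the padded formula, so `Π` starts from entailed clauses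
  -- only.
  GER⁻-lower-bound : (π : ProofSystem.Proof GER⁻ (paddedFormula g)) → 2 ^ n ≤ ProofSystem.∣_∣ GER⁻ π
  GER⁻-lower-bound (π , Λ⊆) with 2 ^ n ℕ.≤? GERProof.sizeᴳ π
  ... | yes le = le
  ... | no ¬le =
    let ρ , tractable = restriction n (derived Π)
          (few-derived Π (ℕ.≤-<-trans (ℕ.m≤n+m (size Π) (numClauses Λ)) (ℕ.≰⇒> ¬le)))
    in ⊥-elim (Play.resolution-fails ρ Π
         (λ C∈ → Play.implied-∈ ρ (Play.pad-entailed ρ {allVars g})
           (pad-extension-⊆ unsatisfiable (λ x∈ → matrixVars⊆allVars g (vars-formula⊆ g x∈)) Λ Λ⊆ blockedExtension C∈))
         tractable)
    where open GERProof π

  private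
    W : List Var
    W = allVars g

    twinned-vars : ∀ {x} → x ∈ vars (twinnedFormula g) → x ∈ W ⊎ (∃[ y ] y ∈ W × x ≡ partner y)
    twinned-vars x∈ with ∈-vars⁻ (twinnedFormula g) x∈
    ... | C , l , C∈ , l∈ , refl with ∈-++⁻ (pad (formula g) (matrixVars g)) C∈
    ...   | inj₁ C∈pad = inj₁ (matrixVars⊆allVars g
              (vars-pad⊆ (formula g) (matrixVars g) (vars-formula⊆ g) (∈-vars⁺ C∈pad l∈)))
    ...   | inj₂ C∈twins with twinPairs⁻ W (clausesOf⁻ (twinPairs W) C∈twins)
    ...     | m , m∈ , eq with subst (l ∈_) eq l∈
    ...       | here refl         = inj₁ (subst (_∈ W) (sym (var-compl m)) m∈)
    ...       | there (here refl) = inj₂ (var m , m∈ , var-mirror m)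

  -- If `p` is itself the twin of `q`, the pair of `compl q`, read contrapositively, is the
  -- implication from `p` to `q`.
  has-twin : ∀ {p} → var p ∈ vars (twinnedFormula g) → HasTwin (twinnedFormula g) p
  has-twin {p} p∈ with twinned-vars p∈
  ... | inj₁ p∈W with twins⁺ W p p∈W (plain-∈ (allCells g) p∈W)
  ...   | C , C∈ , eq = C , ∈-++⁺ʳ _ C∈ , subst (compl p ∈_) (sym eq) (here refl) , λ l∈ → is (subst (_ ∈_) eq l∈)
    where
    is : ∀ {l} → l ∈ twinPair p → l ≡ compl p ⊎ l ≡ mirror p
    is (here e)         = inj₁ e
    is (there (here e)) = inj₂ e
  has-twin {p} p∈ | inj₂ (y , y∈W , eq) with mirror⁻ p eq
  ... | q , refl , refl with twins⁺ W (compl q) (subst (_∈ W) (sym (var-compl q)) y∈W)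
                               (subst Plain (sym (var-compl q)) (plain-∈ (allCells g) y∈W))
  ...   | C , C∈ , eq′ = C , ∈-++⁺ʳ _ C∈ ,
            subst (_ ∈_) (sym eq′) (there (here (compl-mirror q))) , λ l∈ → is (subst (_ ∈_) eq′ l∈)
    where
    is : ∀ {l} → l ∈ twinPair (compl q) → l ≡ compl (mirror q) ⊎ l ≡ mirror (mirror q)
    is (here e)         = inj₂ (trans e (trans (compl-involutive q) (sym (mirror-involutive q (plain-∈ (allCells g) y∈W)))))
    is (there (here e)) = inj₁ (trans e (sym (compl-mirror q)))

  RAT⁻-lower-bound : (π : ProofSystem.Proof RAT⁻ (twinnedFormula g)) → 2 ^ n ≤ ProofSystem.∣_∣ RAT⁻ π
  RAT⁻-lower-bound (Π , vars⊆) with 2 ^ n ℕ.≤? size Π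
  ... | yes le = le
  ... | no ¬le =
    let ρ , tractable = restriction n (derived Π) (few-derived Π (ℕ.≰⇒> ¬le))
    in ⊥-elim (Play.rat-fails ρ Π (entailed ρ) (λ p∈ → has-twin (vars⊆ p∈)) tractable)
    where
    entailed : ∀ ρ {C} → C ∈ twinnedFormula g → Play.Entailed ρ (lits C)
    entailed ρ C∈ with ∈-++⁻ (pad (formula g) (matrixVars g)) C∈
    ... | inj₁ C∈pad   = Play.pad-entailed ρ {matrixVars g} C∈pad
    ... | inj₂ C∈twins = Play.twin-entailed ρ (twins⁻ W (plain-∈ (allCells g)) C∈twins)

2^-exponential : IsExponential (2 ^_)
2^-exponential = 1 , 0 , _ , λ n _ → ℕ.≤-reflexive (sym (ℕ.^-identityʳ (2 ^ n)))

-- Derivations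

-- At most k applications of the resolution rule over the variables W.
data Steps (W : List Var) : CNF → CNF → ℕ → Set where
  done : ∀ {Γ k} → Steps W Γ Γ k
  add  : ∀ {Γ Δ k} C → ResolutionRule Γ C → map var (lits C) ⊆ W → Steps W (C ∷ Γ) Δ k → Steps W Γ Δ (suc k)

Reach : List Var → CNF → ℕ → (CNF → Set) → Set
Reach W Γ k P = ∃[ Δ ] Steps W Γ Δ k × P Δ

steps-⊆ : ∀ {W Γ Δ k} → Steps W Γ Δ k → Γ ⊆ Δ
steps-⊆ done          = id
steps-⊆ (add C _ _ s) = steps-⊆ s ∘ there

steps-≤ : ∀ {W Γ Δ k m} → k ≤ m → Steps W Γ Δ k → Steps W Γ Δ m
steps-≤ _        done          = done
steps-≤ (s≤s le) (add C r W s) = add C r W (steps-≤ le s)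

steps-trans : ∀ {W Γ Δ Θ k m} → Steps W Γ Δ k → Steps W Δ Θ m → Steps W Γ Θ (k + m)
steps-trans {k = k} {m} done s  = steps-≤ (ℕ.m≤n+m m k) s
steps-trans (add C r W s) t     = add C r W (steps-trans s t)

reach-≤ : ∀ {W Γ k m P} → k ≤ m → Reach W Γ k P → Reach W Γ m P
reach-≤ le (Δ , s , p) = Δ , steps-≤ le s , p

bind : ∀ {W Γ k m P Q} → Reach W Γ k P → (∀ {Δ} → Γ ⊆ Δ → P Δ → Reach W Δ m Q) → Reach W Γ (k + m) Q
bind (Δ , s , p) f = let Θ , t , q = f (steps-⊆ s) p in Θ , steps-trans s t , q

refutation : ∀ {R : Rule} {W Γ Δ k} → (∀ {Γ C} → ResolutionRule Γ C → R Γ C) → Steps W Γ Δ k → ⊥ᶜ ∈ᶜ Δ →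
  Σ[ Π ∈ Refutation R Γ ] size Π ≤ suc k × (vars Γ ⊆ W → vars (final Π) ⊆ W)
refutation {Γ = Γ} _ done ⊥∈ = stop ⊥∈ , s≤s z≤n , id
refutation {W = W} {Γ} embed (add C r C⊆ s) ⊥∈ =
  let Π , size≤ , vars⊆ = refutation embed s ⊥∈
  in add C (embed r) Π , s≤s size≤ , λ Γ⊆ → vars⊆ λ x∈ → [ C⊆ , Γ⊆ ]′ (∈-++⁻ (map var (lits C)) x∈)

-- Implicational completeness of resolution on few variables

abstract

  -- The number of nodes of the complete binary tree of depth `k`; abstract, so that `treeSize 30`
  -- is never evaluated.
  treeSize : ℕ → ℕ
  treeSize zero    = 1
  treeSize (suc k) = treeSize k + (treeSize k + 1)

  treeSize-zero : 1 ≤ treeSize 0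
  treeSize-zero = ℕ.≤-refl

  treeSize-split : ∀ k → treeSize k + (treeSize k + 1) ≤ treeSize (suc k)
  treeSize-split k = ℕ.≤-refl

  treeSize-suc : ∀ k → treeSize k ≤ treeSize (suc k)
  treeSize-suc k = ℕ.m≤m+n (treeSize k) _

treeSize-mono : ∀ {k m} → k ≤ m → treeSize k ≤ treeSize m
treeSize-mono = mono ∘ ℕ.≤⇒≤′
  where
  mono : ∀ {k m} → k ≤′ m → treeSize k ≤ treeSize m
  mono (≤′-reflexive refl) = ℕ.≤-refl
  mono (≤′-step le)        = ℕ.≤-trans (mono le) (treeSize-suc _)

-- Entailment of `L` in a form suited to branching: the falsified clause lies over `vs` and the
-- variables of `L`, so it is inside `L` once `L` decides all of `vs`.
Witnessed : CNF → List Var → List Literal → Set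
Witnessed Γ vs L = ∀ α → ¬ (α ⊨ L) → ∃[ C ] C ∈ Γ × ¬ (α ⊨ lits C) ×
  (∀ {l} → l ∈ lits C → var l ∈ vs ⊎ var l ∈ map var L)

-- The assignment that falsifies `D` falsifies some `C` on variables of `D`, and a false literal on
-- such a variable is a literal of `D`.
leaf-weakening : ∀ {Γ} D → Witnessed Γ [] (lits D) → ∃[ C ] C ∈ Γ × lits C ⊆ lits D
leaf-weakening D witness with witness α ⊭D
  where
  α : Assignment
  α x = does (neg x ∈ᴸ? lits D)
  false-on : ∀ l → l ∈ lits D → eval α l ≢ true
  false-on (pos x) l∈ with neg x ∈ᴸ? lits D
  ... | yes n∈ = λ _ → conflict-free D l∈ n∈
  ... | no _   = λ ()
  false-on (neg x) l∈ with neg x ∈ᴸ? lits D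
  ... | yes _ = λ ()
  ... | no ∉  = λ _ → ∉ l∈
  ⊭D : ¬ (α ⊨ lits D)
  ⊭D sat = let l , l∈ , t = find sat in false-on l l∈ t
... | C , C∈ , ⊭C , within = C , C∈ , λ l∈ → inside l∈ (within l∈)
  where
  α : Assignment
  α x = does (neg x ∈ᴸ? lits D)
  inside : ∀ {l} → l ∈ lits C → var l ∈ [] ⊎ var l ∈ map var (lits D) → l ∈ lits D
  inside {l} l∈ (inj₂ v∈) with ∈-map⁻ var v∈
  ... | m , m∈ , eq with same-var l m eq
  ...   | inj₁ refl = m∈
  ...   | inj₂ refl = ⊥-elim (contradict m m∈ (⊭⇒false {α} ⊭C l∈))
    where
    contradict : ∀ m → m ∈ lits D → eval α (compl m) ≢ false
    contradict (pos x) m∈ with neg x ∈ᴸ? lits D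
    ... | yes n∈ = λ _ → conflict-free D m∈ n∈
    ... | no _   = λ ()
    contradict (neg x) m∈ with neg x ∈ᴸ? lits D
    ... | yes _ = λ ()
    ... | no ∉  = λ _ → ∉ m∈

-- The tree of all cases on vs resolves to D when each case falsifies a clause.
derive : ∀ {W Γ} vs D → map var (lits D) ⊆ W → vs ⊆ W → Witnessed Γ vs (lits D) →
  Reach W Γ (treeSize (length vs)) (D ∈_)
derive [] D D⊆W vs⊆W witness =
  let C , C∈ , C⊆D = leaf-weakening D witness
  in _ , steps-≤ treeSize-zero (add D (weaken {C = C} (∈⇒∈ᶜ C∈) C⊆D) D⊆W done) , here refl
derive {W} {Γ} (v ∷ vs) D D⊆W vs⊆W witness with DecMembership._∈?_ _≟_ v (map var (lits D))
-- `D` already decides `v`; branching on it would repeat a literal or give a tautology.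
... | yes v∈ = reach-≤ (treeSize-suc (length vs)) (derive vs D D⊆W (vs⊆W ∘ there) witness′)
  where
  witness′ : Witnessed Γ vs (lits D)
  witness′ α ⊭D with witness α ⊭D
  ... | C , C∈ , ⊭C , within = C , C∈ , ⊭C , λ l∈ → case within l∈ of λ
    { (inj₁ (here refl)) → inj₂ v∈ ; (inj₁ (there l∈vs)) → inj₁ l∈vs ; (inj₂ l∈D) → inj₂ l∈D }
... | no v∉ = reach-≤ (treeSize-split (length vs)) (
  bind (branch (pos v) refl Γ id) λ Γ⊆Δ D⁺∈ →
  bind (branch (neg v) refl _ Γ⊆Δ) λ Δ⊆Θ D⁻∈ →
  _ , add D (resolve (∈⇒∈ᶜ (Δ⊆Θ D⁺∈)) (∈⇒∈ᶜ D⁻∈) resolvent) D⊆W done , here refl)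
  where
  branchClause : ∀ l → var l ≡ v → Clause
  branchClause l eq = clause (l ∷ lits D) λ
    { (x , here p , here n) → case trans p (sym n) of λ ()
    ; (x , here refl , there n) → v∉ (subst (_∈ map var (lits D)) eq (∈-map⁺ var n))
    ; (x , there p , here refl) → v∉ (subst (_∈ map var (lits D)) eq (∈-map⁺ var p))
    ; (x , there p , there n) → nontautological D (x , p , n) }
  branch : ∀ l (eq : var l ≡ v) Δ → Γ ⊆ Δ → Reach W Δ (treeSize (length vs)) (branchClause l eq ∈_)
  branch l refl Δ Γ⊆Δ = derive vs (branchClause l refl)
    (λ { (here refl) → vs⊆W (here refl) ; (there x∈) → D⊆W x∈ }) (vs⊆W ∘ there) witness′
    where
    witness′ : Witnessed Δ vs (l ∷ lits D)
    witness′ α ⊭ with witness α (⊭ ∘ there)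
    ... | C , C∈ , ⊭C , within = C , Γ⊆Δ C∈ , ⊭C , λ l∈ → case within l∈ of λ
      { (inj₁ (here eq)) → inj₂ (here eq) ; (inj₁ (there l∈vs)) → inj₁ l∈vs ; (inj₂ l∈D) → inj₂ (there l∈D) }
  resolvent : Resolvent (branchClause (pos v) refl) (branchClause (neg v) refl) D
  resolvent = record
    { x     = v
    ; A     = lits D
    ; B     = lits D
    ; left  = record { fresh = v∉ ; union = id , id }
    ; right = record { fresh = v∉ ; union = id , id }
    ; union = ∈-++⁺ˡ , λ l∈ → [ id , id ]′ (∈-++⁻ (lits D) l∈)
    }

derive-all : ∀ {W Γ} vs Ds → vs ⊆ W → vars Ds ⊆ W → (∀ {D} → D ∈ Ds → Witnessed Γ vs (lits D)) →
  Reach W Γ (length Ds * treeSize (length vs)) (Ds ⊆_)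
derive-all vs []       vs⊆W Ds⊆W witness = _ , done , λ ()
derive-all {W} {Γ} vs (D ∷ Ds) vs⊆W Ds⊆W witness =
  bind (derive vs D (Ds⊆W ∘ ∈-++⁺ˡ) vs⊆W (witness (here refl))) λ Γ⊆Δ D∈ →
  let Θ , s , Ds⊆ = derive-all vs Ds vs⊆W (Ds⊆W ∘ ∈-++⁺ʳ (map var (lits D))) λ D∈ α ⊭D →
        let C , C∈ , rest = witness (there D∈) α ⊭D in C , Γ⊆Δ C∈ , rest
  in Θ , s , λ { (here refl) → steps-⊆ s D∈ ; (there E∈) → Ds⊆ E∈ }

-- Linear inferences from at most five equations with at most three cells each.
budget : ℕ
budget = 2 ^ 6 * treeSize 30

length-cellVars : ∀ vs → length (cellVars vs) ≡ 2 * length vs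
length-cellVars []       = refl
length-cellVars (v ∷ vs) = trans (cong (λ k → suc (suc k)) (length-cellVars vs)) (sym (ℕ.*-suc 2 (length vs)))

length-encode : ∀ e → length (encode e) ≤ 2 ^ (2 * length (proj₁ e))
length-encode (vs , c) = ℕ.≤-trans (length-clausesOf (parityLits (cellVars vs) c))
  (subst (λ k → length (parityLits (cellVars vs) c) ≤ 2 ^ k) (length-cellVars vs) (length-parityLits (cellVars vs) c))

record Known (g : ℕ) (Γ : CNF) (e : Equation) : Set where
  constructor knows
  field
    clauses⊆ : encode e ⊆ Γ
    cells⊆   : proj₁ e ⊆ allCells g

open Known public

known-⊆ : ∀ {g Γ Δ e} → Γ ⊆ Δ → Known g Γ e → Known g Δ e
known-⊆ Γ⊆Δ (knows e⊆ cells) = knows (Γ⊆Δ ∘ e⊆) cells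

-- Semantic implication suffices, at constant cost: 15 cells are 30 variables to branch on, and an
-- equation of three cells has at most `2 ^ 6` clauses.
infer : ∀ g {Γ} es e → All (Known g Γ) es → proj₁ e ⊆ allCells g →
  length (concatMap proj₁ es) ≤ 15 → length (proj₁ e) ≤ 3 →
  (∀ f → All (Holds f) es → Holds f e) → Reach (allVars g) Γ budget (λ Δ → Known g Δ e)
infer g {Γ} es e known cells es≤ e≤ implies =
  let Δ , s , e⊆ = derive-all vs (encode e) vs⊆W e⊆W witness
  in Δ , steps-≤ cost≤ s , knows e⊆ cells
  where
  vs : List Var
  vs = cellVars (concatMap proj₁ es)
  cost≤ : length (encode e) * treeSize (length vs) ≤ budget
  cost≤ = ℕ.*-mono-≤
    (ℕ.≤-trans (length-encode e) (ℕ.^-monoʳ-≤ 2 (ℕ.*-monoʳ-≤ 2 e≤)))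
    (treeSize-mono (subst (_≤ 30) (sym (length-cellVars (concatMap proj₁ es))) (ℕ.*-monoʳ-≤ 2 es≤)))
  vs⊆W : vs ⊆ allVars g
  vs⊆W = cellVars-⊆ {concatMap proj₁ es} λ v∈ →
    let e′ , e′∈ , v∈e′ = find (∈-concatMap⁻ proj₁ {xs = es} v∈)
    in cells⊆ (All.lookup known e′∈) v∈e′
  e⊆W : vars (encode e) ⊆ allVars g
  e⊆W x∈ with ∈-vars⁻ (encode e) x∈
  ... | C , l , C∈ , l∈ , refl = cellVars-⊆ {proj₁ e} cells (encode-vars e C∈ l∈)
  witness : ∀ {D} → D ∈ encode e → Witnessed Γ vs (lits D)
  witness {D} D∈ α ⊭D with Any.any? (λ C → ¬? (α ⊨? lits C)) (concatMap encode es)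
  ... | yes falsified =
    let C , C∈ , ⊭C    = find falsified
        e′ , e′∈ , C∈e′ = find (∈-concatMap⁻ encode {xs = es} C∈)
    in C , clauses⊆ (All.lookup known e′∈) C∈e′ , ⊭C , λ l∈ → inj₁
         (cellVars-⊆ {proj₁ e′} (λ v∈ → ∈-concatMap⁺ proj₁ (lose e′∈ v∈)) (encode-vars e′ C∈e′ l∈))
  ... | no none = ⊥-elim (⊭D (encode-complete e
    (implies (value α) (All.tabulate λ {e′} e′∈ → encode-sound e′ λ {C} C∈ →
      decidable-stable (α ⊨? lits C) λ ⊭C → none (lose (∈-concatMap⁺ encode (lose e′∈ C∈)) ⊭C))) D∈))

-- Summing the matrix in two ways

-- Every area has one defining equation, and apart from that it is used only to define the area one
-- row further down.
areaEquation : ℕ → ℕ → Equation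
areaEquation zero    j = area 0 j ∷ [] , false
areaEquation (suc i) j = area (suc i) j ∷ area i j ∷ prefix (row i) j ∷ [] , false

columnEquation : ℕ → ℕ → Equation
columnEquation i j = area i (suc j) ∷ area i j ∷ prefix (col j) i ∷ [] , false

valueEquation : ℕ → ℕ → Bool → Equation
valueEquation i j c = area i j ∷ [] , c

column-rule-holds : ∀ f i j → All (Holds f)
  (areaEquation (suc i) (suc j) ∷ areaEquation (suc i) j ∷ columnEquation i j ∷ stepEquation (row i) j ∷ stepEquation (col j) i ∷ []) →
  Holds f (columnEquation (suc i) j)
column-rule-holds f i j (a ∷ b ∷ c ∷ r ∷ s ∷ []) =
  xor-unsolve₃ (f (area (suc i) (suc j))) (f (area (suc i) j)) (f (prefix (col j) (suc i)))
    (column-rule (f (area i j)) (f (prefix (row i) j)) (f (prefix (col j) i)) (f (entry i j))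
      (xor-solve₃ (f (area (suc i) j)) (f (area i j)) (f (prefix (row i) j)) b)
      (xor-solve₃ (f (area (suc i) (suc j))) (f (area i (suc j))) (f (prefix (row i) (suc j))) a)
      (xor-solve₃ (f (area i (suc j))) (f (area i j)) (f (prefix (col j) i)) c)
      (xor-solve₃ (f (prefix (row i) (suc j))) (f (prefix (row i) j)) (f (entry i j)) r)
      (xor-solve₃ (f (prefix (col j) (suc i))) (f (prefix (col j) i)) (f (entry i j)) s))

combine-holds : ∀ f u v w {b c} → All (Holds f) ((u ∷ v ∷ w ∷ [] , false) ∷ (v ∷ [] , b) ∷ (w ∷ [] , c) ∷ []) →
  Holds f (u ∷ [] , b xor c)
combine-holds f u v w {b} {c} (uvw ∷ v≡ ∷ w≡ ∷ []) = trans (Bool.xor-identityʳ (f u))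
  (trans (xor-solve₃ (f u) (f v) (f w) uvw) (cong₂ _xor_ (xor-solve₁ {f v} b v≡) (xor-solve₁ {f w} c w≡)))

column-start-holds : ∀ f u v w → All (Holds f) ((u ∷ [] , false) ∷ (v ∷ [] , false) ∷ (w ∷ [] , false) ∷ []) →
  Holds f (u ∷ v ∷ w ∷ [] , false)
column-start-holds f u v w (u≡ ∷ v≡ ∷ w≡ ∷ []) = xor-unsolve₃ (f u) (f v) (f w)
  (trans (xor-solve₁ false u≡) (sym (cong₂ _xor_ (xor-solve₁ {f v} false v≡) (xor-solve₁ {f w} false w≡))))

module _ (g : ℕ) (1≤g : 1 ≤ g) where

  line-cells : ∀ {ℓ e} → ℓ ∈ lines g → e ∈ lineEquations g ℓ → proj₁ e ⊆ allCells g
  line-cells ℓ∈ e∈ v∈ = ∈-++⁺ˡ (matrixCell∈ g (system⁺ {g} ℓ∈ e∈) v∈)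

  prefix∈ : ∀ {ℓ k} → ℓ ∈ lines g → k ≤ g → prefix ℓ k ∈ allCells g
  prefix∈     {k = zero}  ℓ∈ k≤g = line-cells ℓ∈ (here refl) (here refl)
  prefix∈ {ℓ} {k = suc k} ℓ∈ k<g = line-cells ℓ∈ (step∈ ℓ k<g) (here refl)

  area-cells : ∀ i {j} → i ≤ g → j ≤ g → proj₁ (areaEquation i j) ⊆ allCells g
  area-cells zero    i≤g j≤g (here refl)                 = area∈ i≤g j≤g
  area-cells (suc i) i<g j≤g (here refl)                 = area∈ i<g j≤g
  area-cells (suc i) i<g j≤g (there (here refl))         = area∈ (ℕ.<⇒≤ i<g) j≤g
  area-cells (suc i) i<g j≤g (there (there (here refl))) = prefix∈ (row∈ i<g) j≤g

  column-cells : ∀ {i j} → i ≤ g → j < g → proj₁ (columnEquation i j) ⊆ allCells g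
  column-cells i≤g j<g (here refl)                 = area∈ i≤g j<g
  column-cells i≤g j<g (there (here refl))         = area∈ i≤g (ℕ.<⇒≤ j<g)
  column-cells i≤g j<g (there (there (here refl))) = prefix∈ (col∈ j<g) i≤g

  value-cells : ∀ {i j} → i ≤ g → j ≤ g → area i j ∷ [] ⊆ allCells g
  value-cells i≤g j≤g (here refl) = area∈ i≤g j≤g

  record Base (Γ : CNF) : Set where
    field
      system⊆ : ∀ {e} → e ∈ system g → encode e ⊆ Γ
      areas⊆  : ∀ {i j} → i ≤ g → j ≤ g → encode (areaEquation i j) ⊆ Γ

    line : ∀ {ℓ e} → ℓ ∈ lines g → e ∈ lineEquations g ℓ → Known g Γ e
    line ℓ∈ e∈ = knows (system⊆ (system⁺ {g} ℓ∈ e∈)) (line-cells ℓ∈ e∈)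

    area-known : ∀ i {j} → i ≤ g → j ≤ g → Known g Γ (areaEquation i j)
    area-known i i≤g j≤g = knows (areas⊆ {i} i≤g j≤g) (area-cells i i≤g j≤g)

  base-⊆ : ∀ {Γ Δ} → Γ ⊆ Δ → Base Γ → Base Δ
  base-⊆ Γ⊆Δ base = record
    { system⊆ = λ e∈ C∈ → Γ⊆Δ (Base.system⊆ base e∈ C∈)
    ; areas⊆  = λ i≤g j≤g C∈ → Γ⊆Δ (Base.areas⊆ base i≤g j≤g C∈)
    }

  private
    K : ℕ
    K = budget

    Derives : CNF → ℕ → Equation → Set
    Derives Γ k e = Reach (allVars g) Γ k (λ Δ → Known g Δ e)

    after : ∀ {Γ k m Q e} → k + m ≤ Q → Derives Γ k e → ∀ {e′} →
      (∀ {Δ} → Γ ⊆ Δ → Known g Δ e → Derives Δ m e′) → Derives Γ Q e′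
    after le r f = reach-≤ le (bind r f)

    known : ∀ {Γ e k} → Known g Γ e → Derives Γ k e
    known kn = _ , done , kn

    K+mK : ∀ m → m * K + K ≤ suc m * K
    K+mK m = ℕ.≤-reflexive (ℕ.+-comm (m * K) K)

    3≤15 : 3 ≤ 15
    3≤15 = ℕ.m≤m+n 3 12

  column : ∀ {Γ} → Base Γ → ∀ i j → i ≤ g → j < g → Derives Γ (suc i * K) (columnEquation i j)
  column base zero j i≤g j<g = reach-≤ (ℕ.m≤m+n K 0) (infer g
    (areaEquation 0 (suc j) ∷ areaEquation 0 j ∷ startEquation (col j) ∷ []) _
    (area-known 0 i≤g j<g ∷ area-known 0 i≤g (ℕ.<⇒≤ j<g) ∷ line (col∈ j<g) (here refl) ∷ [])
    (column-cells i≤g j<g) 3≤15 ℕ.≤-refl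
    (λ f → column-start-holds f (area 0 (suc j)) (area 0 j) (prefix (col j) 0)))
    where open Base base
  column base (suc i) j i<g j<g = after (K+mK (suc i)) (column base i j (ℕ.<⇒≤ i<g) j<g) λ Γ⊆Δ prev →
    let open Base (base-⊆ Γ⊆Δ base) in
    infer g
      (areaEquation (suc i) (suc j) ∷ areaEquation (suc i) j ∷ columnEquation i j ∷ stepEquation (row i) j ∷ stepEquation (col j) i ∷ []) _
      (area-known (suc i) i<g j<g ∷ area-known (suc i) i<g (ℕ.<⇒≤ j<g) ∷ prev ∷
       line (row∈ i<g) (step∈ (row i) j<g) ∷ line (col∈ j<g) (step∈ (col j) i<g) ∷ [])
      (column-cells i<g j<g) ℕ.≤-refl ℕ.≤-refl
      (λ f → column-rule-holds f i j)

  first-column : ∀ {Γ} → Base Γ → ∀ i → i ≤ g → Derives Γ (suc i * K) (valueEquation i 0 false)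
  first-column base zero    i≤g = known (Base.area-known base 0 i≤g z≤n)
  first-column base (suc i) i<g = after (K+mK (suc i)) (first-column base i (ℕ.<⇒≤ i<g)) λ Γ⊆Δ prev →
    let open Base (base-⊆ Γ⊆Δ base) in
    infer g (areaEquation (suc i) 0 ∷ valueEquation i 0 false ∷ startEquation (row i) ∷ []) _
      (area-known (suc i) i<g z≤n ∷ prev ∷ line (row∈ i<g) (here refl) ∷ [])
      (value-cells i<g z≤n) (ℕ.m≤m+n 5 10) (ℕ.m≤m+n 1 2)
      (λ f → combine-holds f (area (suc i) 0) (area i 0) (prefix (row i) 0))

  last-column : ∀ {Γ} → Base Γ → ∀ i → i < g → Derives Γ (suc (suc i) * K) (valueEquation (suc i) g true)
  last-column base zero i<g = after (K+mK 1) (known {k = 1 * K} (Base.area-known base 0 z≤n ℕ.≤-refl)) λ Γ⊆Δ prev →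
    let open Base (base-⊆ Γ⊆Δ base) in
    infer g (areaEquation 1 g ∷ valueEquation 0 g false ∷ endEquation g (row 0) ∷ []) _
      (area-known 1 i<g ℕ.≤-refl ∷ prev ∷ line (row∈ i<g) (there (here refl)) ∷ [])
      (value-cells i<g ℕ.≤-refl) (ℕ.m≤m+n 5 10) (ℕ.m≤m+n 1 2)
      (λ f → combine-holds f (area 1 g) (area 0 g) (prefix (row 0) g))
  last-column base (suc i) i<g = after (K+mK (suc (suc i))) (last-column base i (ℕ.<⇒≤ i<g)) λ Γ⊆Δ prev →
    let open Base (base-⊆ Γ⊆Δ base) in
    infer g (areaEquation (suc (suc i)) g ∷ valueEquation (suc i) g true ∷ endEquation g (row (suc i)) ∷ []) _
      (area-known (suc (suc i)) i<g ℕ.≤-refl ∷ prev ∷ line (row∈ i<g) (there (here refl)) ∷ [])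
      (value-cells i<g ℕ.≤-refl) (ℕ.m≤m+n 5 10) (ℕ.m≤m+n 1 2)
      (λ f → combine-holds f (area (suc (suc i)) g) (area (suc i) g) (prefix (row (suc i)) g))

  -- Each column costs `suc g` inferences to carry its equation down to row `g` and one more to use
  -- it, whence the factor `suc (suc g)`.
  last-row : ∀ {Γ} → Base Γ → ∀ j → j ≤ g → Derives Γ (suc j * (suc (suc g) * K)) (valueEquation g j false)
  last-row base zero j≤g = reach-≤ (ℕ.≤-trans (ℕ.m≤n+m (suc g * K) K) (ℕ.m≤m+n _ 0)) (first-column base g ℕ.≤-refl)
  last-row base (suc j) j<g = after cost (last-row base j (ℕ.<⇒≤ j<g)) λ Γ⊆Δ prev →
    after (K+mK (suc g)) (column (base-⊆ Γ⊆Δ base) g j ℕ.≤-refl j<g) λ Δ⊆Θ column →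
    let open Base (base-⊆ (Δ⊆Θ ∘ Γ⊆Δ) base) in
    infer g (columnEquation g j ∷ valueEquation g j false ∷ endEquation g (col j) ∷ []) _
      (column ∷ known-⊆ Δ⊆Θ prev ∷ line (col∈ j<g) (there (here refl)) ∷ [])
      (value-cells ℕ.≤-refl j<g) (ℕ.m≤m+n 5 10) (ℕ.m≤m+n 1 2)
      (λ f → combine-holds f (area g (suc j)) (area g j) (prefix (col j) g))
    where
    cost : suc j * (suc (suc g) * K) + suc (suc g) * K ≤ suc (suc j) * (suc (suc g) * K)
    cost = ℕ.≤-reflexive (ℕ.+-comm (suc j * (suc (suc g) * K)) _)

  summation : ∀ {Γ} → Base Γ → Reach (allVars g) Γ (suc (suc g) * (suc (suc g) * K)) (⊥ᶜ ∈ᶜ_)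
  summation {Γ} base =
    let Δ , s , ⊥-known = derivation
    in Δ , s , ∈⇒∈ᶜ (clauses⊆ ⊥-known (here refl))
    where
    derivation : Derives Γ (suc (suc g) * (suc (suc g) * K)) ([] , true)
    derivation = after cost (last-row base g ℕ.≤-refl) λ Γ⊆Δ by-columns →
      after (K+mK (suc g)) (corner (base-⊆ Γ⊆Δ base)) λ Δ⊆Θ by-rows →
      infer g (valueEquation g g false ∷ valueEquation g g true ∷ []) _
        (known-⊆ Δ⊆Θ by-columns ∷ by-rows ∷ []) (λ ()) (ℕ.m≤m+n 2 13) z≤n
        (λ { f (p ∷ q ∷ []) → trans (sym p) q })
      where
      cost : suc g * (suc (suc g) * K) + suc (suc g) * K ≤ suc (suc g) * (suc (suc g) * K)
      cost = ℕ.≤-reflexive (ℕ.+-comm (suc g * (suc (suc g) * K)) _)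
      corner : ∀ {Δ} → Base Δ → Derives Δ (suc g * K) (valueEquation g g true)
      corner {Δ} base′ = subst (λ m → Derives Δ (suc m * K) (valueEquation m g true))
        (ℕ.suc-pred g {{>-nonZero 1≤g}})
        (last-column base′ (pred g) (ℕ.≤-reflexive (ℕ.suc-pred g {{>-nonZero 1≤g}})))

-- Unit propagation

units : List Literal → CNF
units L = map (λ l → unit (compl l)) L

-- The units of `M` strike out the literals of `E` one at a time, until the empty clause remains.
falsified-clause : ∀ M {Γ} E → E ∈ Γ → lits E ⊆ M → (∀ {l} → l ∈ M → unit (compl l) ∈ Γ) →
  Refutation UnitPropagationRule Γ
falsified-clause [] E E∈ E⊆ units∈ =
  stop (∈ᶜ-resp (λ ()) (λ l∈ → case E⊆ l∈ of λ ()) (∈⇒∈ᶜ E∈))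
falsified-clause (l ∷ M) {Γ} E E∈ E⊆ units∈ with l ∈ᴸ? lits E
... | no l∉ = falsified-clause M E E∈ E⊆M (units∈ ∘ there)
  where
  E⊆M : lits E ⊆ M
  E⊆M m∈ with E⊆ m∈
  ... | here refl = ⊥-elim (l∉ m∈)
  ... | there m∈M = m∈M
... | yes l∈ = add E′ (propagate l (units∈ (here refl)) (≈-without E l∈))
    (falsified-clause M E′ (here refl) E′⊆M (there ∘ units∈ ∘ there))
  where
  E′ : Clause
  E′ = clause (without l (lits E)) λ taut →
    nontautological E (tautological-⊆ (λ m∈ → proj₁ (∈-without⁻ {l} {L = lits E} m∈)) taut)
  E′⊆M : lits E′ ⊆ M
  E′⊆M m∈ with ∈-without⁻ {l} {L = lits E} m∈
  ... | m∈E , m≢ with E⊆ m∈E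
  ...   | here eq   = ⊥-elim (m≢ eq)
  ...   | there m∈M = m∈M
  singleton : ∀ p → unit p ≈[ p ]∪ []
  singleton p = record { fresh = λ () ; union = id , id }
  propagate : ∀ l → unit (compl l) ∈ Γ → E ≈[ l ]∪ lits E′ → UnitPropagationRule Γ E′
  propagate (pos x) u∈ split = resolve {C = E} {D = unit (neg x)} (∈⇒∈ᶜ E∈) (∈⇒∈ᶜ u∈) (inj₂ (neg x , id , id)) (record
    { x = x ; A = lits E′ ; B = [] ; left = split ; right = singleton (neg x)
    ; union = ∈-++⁺ˡ , λ m∈ → [ id , (λ ()) ]′ (∈-++⁻ (lits E′) m∈) })
  propagate (neg x) u∈ split = resolve {C = unit (pos x)} {D = E} (∈⇒∈ᶜ u∈) (∈⇒∈ᶜ E∈) (inj₁ (pos x , id , id)) (record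
    { x = x ; A = [] ; B = lits E′ ; left = singleton (pos x) ; right = split
    ; union = id , id })

units∈ : ∀ Γ {L l} → l ∈ L → unit (compl l) ∈ Γ ++ units L
units∈ Γ l∈ = ∈-++⁺ʳ Γ (∈-map⁺ (λ l → unit (compl l)) l∈)

subsumed⇒⊢₁ : ∀ {Γ D L} → D ∈ Γ → lits D ⊆ L → Γ ⊢₁ L
subsumed⇒⊢₁ {Γ} {D} D∈ D⊆L = falsified-clause _ D (∈-++⁺ˡ D∈) D⊆L (units∈ Γ)

tautological⇒⊢₁ : ∀ {Γ L} → Tautological L → Γ ⊢₁ L
tautological⇒⊢₁ {Γ} (x , p , n) = falsified-clause (neg x ∷ []) (unit (neg x)) (units∈ Γ p) id
  λ { (here refl) → units∈ Γ n }

-- The definitions of the areas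

-- Of the two variables of an area only this one is defined; the other is a free parameter in the
-- definition.
data IsArea (x : Var) : Set where
  is-area : ∀ i j → x ≡ base (area i j) false → IsArea x

-- Each clause is blocked with respect to those after it. Read from the head, this is an order of
-- elimination for the kernel; read from the end, an order of introduction by RAT.
data Definitions : CNF → Set where
  []  : Definitions []
  _∷_ : ∀ {C R} → (∃[ p ] IsArea (var p) × IsBlockedFor R C p) → Definitions R → Definitions (C ∷ R)

definitions-area : ∀ {Λ C} → Definitions Λ → C ∈ Λ → ∃[ p ] p ∈ lits C × IsArea (var p)
definitions-area ((p , p-area , _ , split , _) ∷ _) (here refl) = p , head∈ split , p-area
definitions-area (_ ∷ defs) (there C∈) = definitions-area defs C∈

AreaFree : CNF → Set
AreaFree Γ = ∀ {C l} → C ∈ Γ → l ∈ lits C → ¬ IsArea (var l)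

definitions-eliminable : ∀ {Γ Λ} → AreaFree Γ → Definitions Λ → Eliminable Γ Λ
definitions-eliminable free [] = []
definitions-eliminable {Γ} free (_∷_ {C} {R} (p , p-area , C′ , split , blocked) defs) =
  (p , C′ , split , blocked′) ∷ definitions-eliminable free defs
  where
  p̄-area : IsArea (var (compl p))
  p̄-area = subst IsArea (sym (var-compl p)) p-area
  blocked′ : ∀ D D′ → D ∈ᶜ Γ ++ C ∷ R → D ≈[ compl p ]∪ D′ → Tautological (C′ ++ D′)
  blocked′ D D′ D∈ split′ with ∈ᶜ-++⁻ Γ D∈
  ... | inj₂ (there D∈R) = blocked D D′ D∈R split′
  ... | inj₂ (here (D⊆C , _)) = ⊥-elim (conflict-free C (head∈ split) (D⊆C (head∈ split′)))
  ... | inj₁ D∈Γ = let E , E∈ , D⊆E , _ = find-∈ᶜ D∈Γ in ⊥-elim (free E∈ (D⊆E (head∈ split′)) p̄-area)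

-- Here RAT goes beyond blocked clauses: a clause of the padding that contains the complement of `p`
-- is a clause of `F` with that literal added, so what remains of it is subsumed by `F` and refuted
-- by unit propagation.
definitions-RAT : ∀ {F W C Λ p} → AreaFree F → IsArea (var p) → IsBlockedFor Λ C p → IsRATFor (Λ ++ pad F W) C p
definitions-RAT {F} {W} {C} {Λ} {p} free p-area (C′ , split , blocked) = C′ , split , propagates
  where
  p̄-area : IsArea (var (compl p))
  p̄-area = subst IsArea (sym (var-compl p)) p-area
  propagates : ∀ D D′ → D ∈ᶜ Λ ++ pad F W → D ≈[ compl p ]∪ D′ → Λ ++ pad F W ⊢₁ C′ ++ D′
  propagates D D′ D∈ split′ with ∈ᶜ-++⁻ Λ D∈
  ... | inj₁ D∈Λ = tautological⇒⊢₁ (blocked D D′ D∈Λ split′)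
  ... | inj₂ D∈pad with find-∈ᶜ D∈pad
  ...   | E , E∈ , D⊆E , E⊆D with pad⁻ F W E∈
  ...     | original E∈F = ⊥-elim (free E∈F (D⊆E (head∈ split′)) p̄-area)
  ...     | weakened {G} l G∈ _ eq = subsumed⇒⊢₁ (∈-++⁺ʳ Λ (∈-++⁺ˡ G∈)) G⊆
    where
    G⊆ : lits G ⊆ C′ ++ D′
    G⊆ {m} m∈ with head∨tail split′ (E⊆D (subst (m ∈_) (sym eq) (there m∈)))
    ... | inj₁ refl = ⊥-elim (free G∈ m∈ p̄-area)
    ... | inj₂ m∈D′ = ∈-++⁺ʳ C′ m∈D′

introduce : ∀ {F W k Q} Λ → AreaFree F → Definitions Λ →
  (Σ[ Π ∈ Refutation RATRule (Λ ++ pad F W) ] size Π ≤ k × vars (final Π) ⊆ Q) →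
  Σ[ Π ∈ Refutation RATRule (pad F W) ] size Π ≤ length Λ + k × vars (final Π) ⊆ Q
introduce []      free []   π = π
introduce {k = k} (C ∷ Λ) free ((p , p-area , blocked) ∷ defs) (Π , size≤ , vars⊆) =
  let Π′ , size≤′ , vars⊆′ = introduce Λ free defs
        (add C (rat (p , definitions-RAT {Λ = Λ} {p = p} free p-area blocked)) Π , s≤s size≤ , vars⊆)
  in Π′ , ℕ.≤-trans size≤′ (ℕ.≤-reflexive (ℕ.+-suc (length Λ) k)) , vars⊆′

-- Parity definitions as blocked clauses

-- Opposite signs of `x` leave opposite constraints on `xs`, so the tails clash; since `x` is not in
-- `xs`, they do so on another variable.
parity-blocked : ∀ x xs c {C R} → x ∉ xs → lits C ∈ parityLits (x ∷ xs) c →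
  (∀ {D l} → D ∈ R → l ∈ lits D → var l ≡ x → lits D ∈ parityLits (x ∷ xs) c) →
  ∃[ p ] var p ≡ x × IsBlockedFor R C p
parity-blocked x xs c {C} {R} x∉ C∈ only with ∈-parityLits⁻ x xs c C∈
... | p , M , eq , refl , signs = p , refl , without p (lits C) , ≈-without C p∈ , clash
  where
  p∈ : p ∈ lits C
  p∈ = subst (p ∈_) (sym eq) (here refl)
  tail-var : ∀ {l N} c → N ∈ parityLits xs c → l ∈ N → ∀ {q} → var q ≡ var p → l ≢ q
  tail-var c N∈ l∈ q≡ refl = x∉ (subst (_∈ xs) q≡ (parityLits-vars xs c N∈ l∈))
  opposite : ∀ {D q N} → lits D ≡ q ∷ N → compl p ∈ lits D →
    (p ≡ pos (var p) × M ∈ parityLits xs c ⊎ p ≡ neg (var p) × M ∈ parityLits xs (not c)) →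
    (q ≡ pos (var p) × N ∈ parityLits xs c ⊎ q ≡ neg (var p) × N ∈ parityLits xs (not c)) →
    ∃[ l ] (l ∈ M × l ≢ p) × (compl l ∈ lits D × compl l ≢ compl p)
  opposite {D} eqD p̄∈ (inj₁ (p≡ , M∈)) (inj₁ (q≡ , N∈)) =
    ⊥-elim (conflict-free D (subst (p ∈_) (sym eqD) (here (trans p≡ (sym q≡)))) p̄∈)
  opposite {D} eqD p̄∈ (inj₂ (p≡ , M∈)) (inj₂ (q≡ , N∈)) =
    ⊥-elim (conflict-free D (subst (p ∈_) (sym eqD) (here (trans p≡ (sym q≡)))) p̄∈)
  opposite eqD p̄∈ (inj₁ (p≡ , M∈)) (inj₂ (q≡ , N∈)) =
    let l , l∈ , l̄∈ = parityLits-conflict xs c M∈ N∈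
    in l , (l∈ , tail-var c M∈ l∈ refl) , subst (_ ∈_) (sym eqD) (there l̄∈) , tail-var (not c) N∈ l̄∈ (var-compl p)
  opposite eqD p̄∈ (inj₂ (p≡ , M∈)) (inj₁ (q≡ , N∈)) =
    let l , l∈ , l̄∈ = parityLits-conflict xs (not c) M∈ (subst (λ b → _ ∈ parityLits xs b) (sym (Bool.not-involutive c)) N∈)
    in l , (l∈ , tail-var (not c) M∈ l∈ refl) , subst (_ ∈_) (sym eqD) (there l̄∈) , tail-var c N∈ l̄∈ (var-compl p)
  clash : ∀ D D′ → D ∈ᶜ R → D ≈[ compl p ]∪ D′ → Tautological (without p (lits C) ++ D′)
  clash D D′ D∈ split with find-∈ᶜ D∈
  ... | E , E∈ , D⊆E , E⊆D with ∈-parityLits⁻ x xs c (only E∈ (D⊆E (head∈ split)) (var-compl p))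
  ...   | q , N , eqE , _ , signs′ with opposite {E} eqE (D⊆E (head∈ split)) signs signs′
  ...     | l , (l∈ , l≢) , l̄∈ , l̄≢ with head∨tail split (E⊆D l̄∈)
  ...       | inj₁ eq′   = ⊥-elim (l̄≢ eq′)
  ...       | inj₂ l̄∈D′ = conflict⇒tautological l
                (∈-++⁺ˡ (∈-without⁺ (subst (l ∈_) (sym eq) (there l∈)) l≢)) (∈-++⁺ʳ _ l̄∈D′)

areaTail : ℕ → ℕ → List Cell
areaTail zero    j = []
areaTail (suc i) j = area i j ∷ prefix (row i) j ∷ []

areaEquation-≡ : ∀ i j → areaEquation i j ≡ (area i j ∷ areaTail i j , false)
areaEquation-≡ zero    j = refl
areaEquation-≡ (suc i) j = refl

base-injective : ∀ {v w c d} → base v c ≡ base w d → v ≡ w × c ≡ d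
base-injective eq with name-injective eq
... | refl = refl , refl

fresh-area : ∀ i j → base (area i j) false ∉ base (area i j) true ∷ cellVars (areaTail i j)
fresh-area i j (here eq) with proj₂ (base-injective eq)
... | ()
fresh-area i j (there x∈) with ∈-cellVars⁻ (areaTail i j) x∈
... | v , c , v∈ , eq = not-tail i (proj₁ (base-injective eq)) v∈
  where
  not-tail : ∀ i {v} → area i j ≡ v → v ∉ areaTail i j
  not-tail (suc i) refl (here ())
  not-tail (suc i) refl (there (here ()))

UpTo : ℕ → List Equation → Set
UpTo i es = ∀ {e} → e ∈ es → ∃₂ λ k j → k ≤ i × e ≡ areaEquation k j

-- The only other equations with `area i m` belong to row `suc i`, which `k ≤ i` rules out.
defines-only : ∀ {k j i m} → k ≤ i → area i m ∈ proj₁ (areaEquation k j) → areaEquation k j ≡ areaEquation i m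
defines-only {zero}  k≤i (here refl) = refl
defines-only {suc k} k≤i (here refl) = refl
defines-only {suc k} k<i (there (here refl)) = ⊥-elim (ℕ.<-irrefl refl k<i)
defines-only {suc k} k≤i (there (there (here ())))

definitions-++ : ∀ i j Cs es → UpTo i es → (∀ {C} → C ∈ Cs → lits C ∈ equationLits (areaEquation i j)) →
  Definitions (concatMap encode es) → Definitions (Cs ++ concatMap encode es)
definitions-++ i j []       es upTo Cs∈ defs = defs
definitions-++ i j (C ∷ Cs) es upTo Cs∈ defs =
  (let p , eq , blocked = parity-blocked (base (area i j) false) _ false (fresh-area i j)
                            (into (Cs∈ (here refl))) only
   in p , is-area i j eq , blocked) ∷
  definitions-++ i j Cs es upTo (Cs∈ ∘ there) defs
  where
  into : ∀ {L} → L ∈ equationLits (areaEquation i j) → L ∈ equationLits (area i j ∷ areaTail i j , false)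
  into {L} = subst (λ e → L ∈ equationLits e) (areaEquation-≡ i j)
  only : ∀ {D l} → D ∈ Cs ++ concatMap encode es → l ∈ lits D → var l ≡ base (area i j) false →
    lits D ∈ equationLits (area i j ∷ areaTail i j , false)
  only {D} D∈ l∈ eq with ∈-++⁻ Cs D∈
  ... | inj₁ D∈Cs = into (Cs∈ (there D∈Cs))
  ... | inj₂ D∈es with find (∈-concatMap⁻ encode {xs = es} D∈es)
  ...   | e , e∈ , D∈e with upTo e∈
  ...     | k , m , k≤i , refl with ∈-cellVars⁻ (proj₁ (areaEquation k m)) (encode-vars (areaEquation k m) D∈e l∈)
  ...       | v , c , v∈ , eq′ with base-injective (trans (sym eq) eq′)
  ...         | refl , _ = into (subst (λ e → lits D ∈ equationLits e) (defines-only k≤i v∈)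
                  (clausesOf⁻ (equationLits (areaEquation k m)) D∈e))

areaRow : ℕ → ℕ → List Equation
areaRow g i = map (areaEquation i) (upTo (suc g))

-- Rows in descending order, so that no area at the head is used further down the list.
areaEquations : ℕ → ℕ → List Equation
areaEquations g zero    = areaRow g 0
areaEquations g (suc i) = areaRow g (suc i) ++ areaEquations g i

areaDefinitions : ℕ → CNF
areaDefinitions g = concatMap encode (areaEquations g g)

row-definitions : ∀ i js es → UpTo i es → Definitions (concatMap encode es) →
  Definitions (concatMap encode (map (areaEquation i) js ++ es))
row-definitions i []       es upTo defs = defs
row-definitions i (j ∷ js) es upTo defs =
  definitions-++ i j (encode (areaEquation i j)) (map (areaEquation i) js ++ es) upTo′
    (clausesOf⁻ (equationLits (areaEquation i j))) (row-definitions i js es upTo defs)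
  where
  upTo′ : UpTo i (map (areaEquation i) js ++ es)
  upTo′ e∈ with ∈-++⁻ (map (areaEquation i) js) e∈
  ... | inj₂ e∈es = upTo e∈es
  ... | inj₁ e∈js = let k , _ , eq = ∈-map⁻ (areaEquation i) e∈js in i , k , ℕ.≤-refl , eq

areaEquations⁻ : ∀ g i {e} → e ∈ areaEquations g i → ∃₂ λ k j → k ≤ i × j ≤ g × e ≡ areaEquation k j
areaEquations⁻ g zero e∈ =
  let j , j∈ , eq = ∈-map⁻ (areaEquation 0) e∈ in 0 , j , z≤n , s≤s⁻¹ (∈-upTo⁻ j∈) , eq
areaEquations⁻ g (suc i) e∈ with ∈-++⁻ (areaRow g (suc i)) e∈
... | inj₁ e∈row = let j , j∈ , eq = ∈-map⁻ (areaEquation (suc i)) e∈row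
                   in suc i , j , ℕ.≤-refl , s≤s⁻¹ (∈-upTo⁻ j∈) , eq
... | inj₂ e∈below = let k , j , k≤ , rest = areaEquations⁻ g i e∈below in k , j , ℕ.m≤n⇒m≤1+n k≤ , rest

areaEquations⁺ : ∀ g {i k j} → k ≤ i → j ≤ g → areaEquation k j ∈ areaEquations g i
areaEquations⁺ g {zero} z≤n j≤g = ∈-map⁺ (areaEquation 0) (∈-upTo⁺ (s≤s j≤g))
areaEquations⁺ g {suc i} {k} k≤ j≤g with k ≟ suc i
... | yes refl = ∈-++⁺ˡ (∈-map⁺ (areaEquation k) (∈-upTo⁺ (s≤s j≤g)))
... | no k≢    = ∈-++⁺ʳ (areaRow g (suc i)) (areaEquations⁺ g (s≤s⁻¹ (ℕ.≤∧≢⇒< k≤ k≢)) j≤g)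

up-to : ∀ g i → UpTo i (areaEquations g i)
up-to g i e∈ = let k , j , k≤ , _ , eq = areaEquations⁻ g i e∈ in k , j , k≤ , eq

area-definitions : ∀ g i → Definitions (concatMap encode (areaEquations g i))
area-definitions g zero    = subst (Definitions ∘ concatMap encode) (++-identityʳ (areaRow g 0))
  (row-definitions 0 (upTo (suc g)) [] (λ ()) [])
area-definitions g (suc i) =
  row-definitions (suc i) (upTo (suc g)) (areaEquations g i)
    (λ e∈ → let k , j , k≤ , eq = up-to g i e∈ in k , j , ℕ.m≤n⇒m≤1+n k≤ , eq) (area-definitions g i)

length-areaEquations : ∀ g i → length (areaEquations g i) ≡ suc i * suc g
length-areaEquations g zero    = trans (length-map (areaEquation 0) (upTo (suc g)))
  (trans (length-upTo (suc g)) (sym (ℕ.+-identityʳ (suc g))))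
length-areaEquations g (suc i) = trans (length-++ (areaRow g (suc i)))
  (cong₂ _+_ (trans (length-map (areaEquation (suc i)) (upTo (suc g))) (length-upTo (suc g))) (length-areaEquations g i))

length-concatMap-encode : ∀ es → (∀ {e} → e ∈ es → length (proj₁ e) ≤ 3) → length (concatMap encode es) ≤ length es * 64
length-concatMap-encode []       _     = z≤n
length-concatMap-encode (e ∷ es) short = subst (_≤ length (e ∷ es) * 64) (sym (length-++ (encode e)))
  (ℕ.+-mono-≤ (ℕ.≤-trans (length-encode e) (ℕ.^-monoʳ-≤ 2 (ℕ.*-monoʳ-≤ 2 (short (here refl)))))
              (length-concatMap-encode es (short ∘ there)))

length-areaEquation : ∀ i j → length (proj₁ (areaEquation i j)) ≤ 3
length-areaEquation zero    j = ℕ.m≤m+n 1 2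
length-areaEquation (suc i) j = ℕ.≤-refl

length-areaDefinitions : ∀ g → length (areaDefinitions g) ≤ suc g * suc g * 64
length-areaDefinitions g = subst (λ k → length (areaDefinitions g) ≤ k * 64) (length-areaEquations g g)
  (length-concatMap-encode (areaEquations g g) short)
  where
  short : ∀ {e} → e ∈ areaEquations g g → length (proj₁ e) ≤ 3
  short e∈ with up-to g g e∈
  ... | k , j , _ , refl = length-areaEquation k j

-- Polynomial upper bounds

matrix-not-area : ∀ g {i j} → area i j ∉ matrixCells g
matrix-not-area g {i} {j} v∈ =
  let e , e∈ , v∈e  = find (∈-concatMap⁻ proj₁ {xs = system g} v∈)
      ℓ , ℓ∈ , e∈ℓ = find (∈-concatMap⁻ (lineEquations g) {xs = lines g} e∈)
  in not-in-line ℓ e∈ℓ v∈e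
  where
  not-crossing : ∀ ℓ {k} → area i j ≢ crossing ℓ k
  not-crossing (row _) ()
  not-crossing (col _) ()
  not-in-line : ∀ ℓ {e} → e ∈ lineEquations g ℓ → area i j ∉ proj₁ e
  not-in-line ℓ (here refl)         (here ())
  not-in-line ℓ (there (here refl)) (here ())
  not-in-line ℓ (there (there e∈)) v∈ with ∈-map⁻ (stepEquation ℓ) e∈
  not-in-line ℓ (there (there e∈)) (there (there (here eq))) | k , _ , refl = not-crossing ℓ eq

matrix-vars-area-free : ∀ g {x} → x ∈ matrixVars g → ¬ IsArea x
matrix-vars-area-free g x∈ (is-area i j refl) with ∈-cellVars⁻ (matrixCells g) x∈
... | v , c , v∈ , eq = matrix-not-area g (subst (_∈ matrixCells g) (sym (proj₁ (base-injective eq))) v∈)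

formula-area-free : ∀ g → AreaFree (formula g)
formula-area-free g C∈ l∈ = matrix-vars-area-free g (vars-formula⊆ g (∈-vars⁺ C∈ l∈))

-- The clauses defining the areas, plus a refutation from them. The constants are parameters, so
-- that the arithmetic never unfolds `budget`.
sizeBound : ℕ → ℕ → ℕ → ℕ
sizeBound a b g = suc g * suc g * a + suc (suc (suc g) * (suc (suc g) * b))

proofSize : ℕ → ℕ
proofSize = sizeBound 64 budget

module _ (g : ℕ) (1≤g : 1 ≤ g) where

  private
    F Λ : CNF
    F = formula g
    Λ = areaDefinitions g

    V W : List Var
    V = matrixVars g
    W = allVars g

    unsat : ∀ α → ¬ (α ⊨ᶜ F)
    unsat α = formula-unsatisfiable g α 1≤g

    V⊆W : V ⊆ W
    V⊆W = matrixVars⊆allVars g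

    definitions : Definitions Λ
    definitions = area-definitions g g

    Λ⊆W : vars Λ ⊆ W
    Λ⊆W x∈ with ∈-vars⁻ Λ x∈
    ... | C , l , C∈ , l∈ , refl with find (∈-concatMap⁻ encode {xs = areaEquations g g} C∈)
    ...   | e , e∈ , C∈e with areaEquations⁻ g g e∈
    ...     | i , j , i≤g , j≤g , refl =
      cellVars-⊆ {proj₁ (areaEquation i j)} (area-cells g 1≤g i i≤g j≤g) (encode-vars (areaEquation i j) C∈e l∈)

    base-intro : ∀ {Γ} → F ⊆ Γ → Λ ⊆ Γ → Base g 1≤g Γ
    base-intro F⊆ Λ⊆ = record
      { system⊆ = λ e∈ C∈ → F⊆ (formula⁺ g e∈ C∈)
      ; areas⊆  = λ i≤g j≤g C∈ → Λ⊆ (∈-concatMap⁺ encode (lose (areaEquations⁺ g i≤g j≤g) C∈))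
      }

  RAT⁻-upper-bound : Σ[ π ∈ ProofSystem.Proof RAT⁻ (paddedFormula g) ] ProofSystem.∣_∣ RAT⁻ π ≤ proofSize g
  RAT⁻-upper-bound =
    let _ , steps , ⊥∈     = summation g 1≤g (base-intro (∈-++⁺ʳ Λ ∘ ∈-++⁺ˡ) ∈-++⁺ˡ)
        Π , size≤ , vars⊆   = refutation resolution steps ⊥∈
        Π′ , size≤′ , vars⊆′ = introduce Λ (formula-area-free g) definitions (Π , size≤ , vars⊆ start⊆W)
    in (Π′ , λ x∈ → ⊆vars-pad F W (λ sat → unsat (λ _ → true) sat) (vars⊆′ x∈)) ,
       ℕ.≤-trans size≤′ (ℕ.+-monoˡ-≤ _ (length-areaDefinitions g))
    where
    start⊆W : vars (Λ ++ pad F W) ⊆ W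
    start⊆W x∈ with ∈-vars⁻ (Λ ++ pad F W) x∈
    ... | C , l , C∈ , l∈ , refl with ∈-++⁻ Λ C∈
    ...   | inj₁ C∈Λ   = Λ⊆W (∈-vars⁺ C∈Λ l∈)
    ...   | inj₂ C∈pad = vars-pad⊆ F W (λ y∈ → V⊆W (vars-formula⊆ g y∈)) (∈-vars⁺ C∈pad l∈)

  private
    core : CNF
    core = pad F V

    Δ : CNF
    Δ = twinnedFormula g

    core⊆V : vars core ⊆ V
    core⊆V = vars-pad⊆ F V (vars-formula⊆ g)

    core-area-free : AreaFree core
    core-area-free C∈ l∈ = matrix-vars-area-free g (core⊆V (∈-vars⁺ C∈ l∈))

    core-plain : AllPlain core
    core-plain C∈ l∈ = plain-∈ (matrixCells g) (core⊆V (∈-vars⁺ C∈ l∈))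

    Λ-plain : AllPlain Λ
    Λ-plain C∈ l∈ = plain-∈ (allCells g) (Λ⊆W (∈-vars⁺ C∈ l∈))

    twin-∈ : ∀ {C} → C ∈ twins W → IsTwin C
    twin-∈ = twins⁻ W (plain-∈ (allCells g))

    twins-fresh : ∀ {C} → C ∈ twins W → ¬ (C ∈ᶜ core)
    twins-fresh C∈ C∈core with twin-∈ C∈ | find-∈ᶜ C∈core
    ... | is-twin l pl eq | D , D∈ , C⊆D , _ =
      partner-not-plain pl (subst Plain (var-mirror l)
        (core-plain D∈ (C⊆D (subst (mirror l ∈_) (sym eq) (there (here refl))))))

    definitions-fresh : ∀ {C} → C ∈ Λ → ¬ (C ∈ᶜ core)
    definitions-fresh C∈ C∈core with definitions-area definitions C∈ | find-∈ᶜ C∈core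
    ... | p , p∈ , p-area | D , D∈ , C⊆D , _ = core-area-free D∈ (C⊆D p∈) p-area

    -- Applied once with the definitions and once with none, this reduces both CNFs of the blocked
    -- extension to the same core.
    core-kernel : ∀ Θ Λ′ → AllPlain Λ′ → Eliminable core Λ′ → (∀ {C} → C ∈ Λ′ → ¬ (C ∈ᶜ core)) →
      Θ ⊆ᶜ core ++ (twins W ++ Λ′) → core ⊆ᶜ Θ → ∃[ K ] IsKernel Θ K × K ≐ᶜ core
    core-kernel Θ Λ′ plain elim fresh Θ⊆ core⊆ =
      let K , steps , K≐ = eliminate Θ Θ⊆ core⊆
            (λ C∈ → [ twins-fresh , fresh ]′ (∈-++⁻ (twins W) C∈))
            (twins-eliminable (twins W) twin-∈ core-plain plain elim)
      in K , (steps , pad-kernel unsat (vars-formula⊆ g) K≐) , K≐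

    blocked-extension : IsBlockedExtension Δ Λ
    blocked-extension =
      let K  , kernel  , K⊆  , ⊆K  = core-kernel (Δ ++ Λ) Λ Λ-plain (definitions-eliminable core-area-free definitions)
            definitions-fresh Δ++Λ⊆ (λ C∈ → ∈⇒∈ᶜ (∈-++⁺ˡ (∈-++⁺ˡ C∈)))
          K′ , kernel′ , K′⊆ , ⊆K′ = core-kernel Δ [] (λ ()) [] (λ ())
            (λ {C} C∈ → subst (λ Θ → C ∈ᶜ core ++ Θ) (sym (++-identityʳ (twins W))) (∈⇒∈ᶜ C∈)) (λ C∈ → ∈⇒∈ᶜ (∈-++⁺ˡ C∈))
      in K , K′ , kernel , kernel′ , (λ {C} C∈ → ⊆K′ {C} (K⊆ {C} C∈)) , λ {C} C∈ → ⊆K {C} (K′⊆ {C} C∈)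
      where
      Δ++Λ⊆ : Δ ++ Λ ⊆ᶜ core ++ (twins W ++ Λ)
      Δ++Λ⊆ {C} C∈ = ∈⇒∈ᶜ (subst (C ∈_) (++-assoc core (twins W) Λ) C∈)

  GER⁻-upper-bound : Σ[ π ∈ ProofSystem.Proof GER⁻ (twinnedFormula g) ] ProofSystem.∣_∣ GER⁻ π ≤ proofSize g
  GER⁻-upper-bound =
    let _ , steps , ⊥∈   = summation g 1≤g (base-intro (∈-++⁺ˡ ∘ ∈-++⁺ˡ ∘ ∈-++⁺ˡ) (∈-++⁺ʳ Δ))
        Π , size≤ , _    = refutation id steps ⊥∈
    in (record { Λ = Λ ; blockedExtension = blocked-extension ; Π = Π } , Λ⊆Δ) ,
       ℕ.+-mono-≤ (ℕ.≤-trans (length-deduplicate _≟ᶜ_ Λ) (length-areaDefinitions g)) size≤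
    where
    Λ⊆Δ : vars Λ ⊆ vars Δ
    Λ⊆Δ {x} x∈ =
      let C , C∈ , eq = twins⁺ W (pos x) (Λ⊆W x∈) (plain-∈ (allCells g) (Λ⊆W x∈))
      in ∈-vars⁺ {l = neg x} (∈-++⁺ʳ core C∈) (subst (neg x ∈_) (sym eq) (here refl))

-- The size is quadratic, and a third factor `n` absorbs the constant once `n` exceeds it.
sizeBound-cubic : ∀ a b c g n → 1 ≤ n → suc (suc g) ≤ c * n → c * c * a + 1 + c * c * b ≤ n → sizeBound a b g ≤ n ^ 3
sizeBound-cubic a b c g n 1≤n g+2≤ ≤n = begin
  sizeBound a b g
    ≤⟨ ℕ.+-mono-≤ (ℕ.*-monoˡ-≤ a (ℕ.*-mono-≤ g+1≤ g+1≤)) (ℕ.+-mono-≤ (ℕ.*-mono-≤ 1≤n 1≤n) (ℕ.*-mono-≤ g+2≤ (ℕ.*-monoˡ-≤ b g+2≤))) ⟩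
  c * n * (c * n) * a + (n * n + c * n * (c * n * b))
    ≡⟨ identity c a b n ⟩
  (c * c * a + 1 + c * c * b) * (n * n)
    ≤⟨ ℕ.*-monoˡ-≤ (n * n) ≤n ⟩
  n * (n * n)
    ≡⟨ cube n ⟩
  n ^ 3 ∎
  where
  open ℕ.≤-Reasoning
  identity : ∀ c a b n → c * n * (c * n) * a + (n * n + c * n * (c * n * b)) ≡ (c * c * a + 1 + c * c * b) * (n * n)
  identity = solve-∀
  cube : ∀ n → n * (n * n) ≡ n * (n * (n * 1))
  cube = solve-∀
  g+1≤ : suc g ≤ c * n
  g+1≤ = ℕ.<⇒≤ g+2≤

sizeBound-polynomial : ∀ a b c (h : ℕ → ℕ) → (∀ n → 1 ≤ n → suc (suc (h n)) ≤ c * n) →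
  IsPolynomial (λ n → sizeBound a b (h n))
sizeBound-polynomial a b c h h≤ = 3 , c * c * a + 1 + c * c * b , λ n large →
  let 1≤n = ℕ.≤-trans (ℕ.≤-trans (ℕ.m≤n+m 1 (c * c * a)) (ℕ.m≤m+n _ _)) large
  in sizeBound-cubic a b c (h n) n 1≤n (h≤ n 1≤n) large

2+9n≤11n : ∀ n → 1 ≤ n → suc (suc (9 * n)) ≤ 11 * n
2+9n≤11n n 1≤n = subst₂ _≤_ (ℕ.+-comm (9 * n) 2) (sym (ℕ.*-distribʳ-+ n 9 2)) (ℕ.+-monoʳ-≤ (9 * n) (ℕ.*-monoʳ-≤ 2 1≤n))

proofSize-polynomial : IsPolynomial (λ n → proofSize (9 * n))
proofSize-polynomial = sizeBound-polynomial 64 budget 11 (9 *_) 2+9n≤11n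

1≤9n : ∀ {n} → 1 ≤ n → 1 ≤ 9 * n
1≤9n {n} 1≤n = ℕ.≤-trans 1≤n (ℕ.m≤n*m n 9)

theorem1p2 : (Σ[ Γ ∈ (ℕ → CNF) ] (AdmitsPolynomial RAT⁻ Γ × RequiresExponential GER⁻ Γ))
    × (Σ[ Δ ∈ (ℕ → CNF) ] (AdmitsPolynomial GER⁻ Δ × RequiresExponential RAT⁻ Δ))
theorem1p2 =
  ( (λ n → paddedFormula (9 * n))
  , (_ , proofSize-polynomial , λ n 1≤n → RAT⁻-upper-bound (9 * n) (1≤9n 1≤n))
  , (2 ^_ , 2^-exponential , GER⁻-lower-bound) ) ,
  ( (λ n → twinnedFormula (9 * n))
  , (_ , proofSize-polynomial , λ n 1≤n → GER⁻-upper-bound (9 * n) (1≤9n 1≤n))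
  , (2 ^_ , 2^-exponential , RAT⁻-lower-bound) )
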